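{- Every triangulation $G$ of the projective plane has a weak or near-weak 2-coloring.
   Context: A triangulation of a surface is a simple graph 2-cell embedded on the surface such that every facial closed walk has length 3. A 2-coloring is an arbitrary (not necessarily proper) map $c:V(G)\to\{B,W\}$. A face is monochromatic under $c$ if all vertices on its boundary receive the same colour. The coloring $c$ is weak if no face is monochromatic, and near-weak if exactly one face is monochromatic. -}

module Defs where

open import Data.Nat using (ℕ; zero; suc; _+_)
open import Data.Fin using (Fin; zero; suc; toℕ; _<_)
open import Data.Fin.Properties using (any?; _≟_; _<?_)
open import Data.Product using (Σ; ∃; _×_; _,_)
open import Data.Sum using (_⊎_)
open import Relation.Nullary using (¬_; Dec; yes; no)
open import Relation.Nullary.Decidable using (_×-dec_)
open import Relation.Binary.PropositionalEquality using (_≡_; _≢_)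
open import Relation.Binary.Construct.Closure.ReflexiveTransitive using (Star)

data Colour : Set where
  B W : Colour

sumFin : ∀ {k} → (Fin k → ℕ) → ℕ
sumFin {zero}  f = 0
sumFin {suc k} f = f zero + sumFin (λ i → f (suc i))

countFin : ∀ {k} {P : Fin k → Set} → (∀ i → Dec (P i)) → ℕ
countFin P? = sumFin (λ i → indicator (P? i))
  where
  indicator : ∀ {A : Set} → Dec A → ℕ
  indicator (yes _) = 1
  indicator (no  _) = 0

-- A finite collection of triangular faces on the vertex set Fin n:
-- face f i is the i-th corner (i : Fin 3) of face f (faces indexed by Fin m).
record FaceData : Set where
  field
    n     : ℕ
    m     : ℕ
    face  : Fin m → Fin 3 → Fin n

module _ (T : FaceData) where
  open FaceData T

  OnFace : Fin m → Fin n → Set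
  OnFace f u = ∃ λ i → face f i ≡ u

  onFace? : ∀ f u → Dec (OnFace f u)
  onFace? f u = any? (λ i → face f i ≟ u)

  EdgeOf : Fin m → Fin n → Fin n → Set
  EdgeOf f u v = u ≢ v × OnFace f u × OnFace f v

  IsEdge : Fin n → Fin n → Set
  IsEdge u v = u < v × (∃ λ f → OnFace f u × OnFace f v)

  isEdge? : ∀ u v → Dec (IsEdge u v)
  isEdge? u v = (u <? v) ×-dec any? (λ f → onFace? f u ×-dec onFace? f v)

  edgeCount : ℕ
  edgeCount = sumFin (λ u → countFin (isEdge? u))

  Adjacent : Fin m → Fin m → Set
  Adjacent f g = ∃ λ u → ∃ λ v → EdgeOf f u v × EdgeOf g u v

  AdjacentAt : Fin n → Fin m → Fin m → Set
  AdjacentAt v f g = ∃ λ x → EdgeOf f v x × EdgeOf g v x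

  -- Combinatorial description of a triangulation (simple graph 2-cell
  -- embedded with all faces triangles) of a closed connected surface,
  -- together with Euler characteristic V - E + F = 1, i.e. of the
  -- projective plane.
  record IsProjectivePlaneTriangulation : Set where
    field
      corners-distinct : ∀ f i j → face f i ≡ face f j → i ≡ j
      vertex-on-face   : ∀ u → ∃ λ f → OnFace f u
      edge-two-faces   : ∀ f u v → EdgeOf f u v →
                           Σ (Fin m) λ g → g ≢ f × EdgeOf g u v ×
                             (∀ h → EdgeOf h u v → h ≡ f ⊎ h ≡ g)
      -- the faces around each vertex form a single cycle (the link of
      -- every vertex is connected), so the complex is a closed surface
      link-connected   : ∀ v f g → OnFace f v → OnFace g v →
                           Star (λ f' g' → OnFace f' v × OnFace g' v × AdjacentAt v f' g') f g
      connected        : ∀ f g → Star Adjacent f g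
      euler            : n + m ≡ 1 + edgeCount

  Monochromatic : (Fin n → Colour) → Fin m → Set
  Monochromatic c f = ∀ i j → c (face f i) ≡ c (face f j)

  Weak : (Fin n → Colour) → Set
  Weak c = ∀ f → ¬ Monochromatic c f

  NearWeak : (Fin n → Colour) → Set
  NearWeak c = Σ (Fin m) λ f → Monochromatic c f × (∀ g → Monochromatic c g → g ≡ f)

-- A 2-colouring c is recorded by the set y of edges with ends of equal colour: y meets every face in
-- an odd number of edges, in all three exactly at the monochromatic faces, and the complement of y
-- is the coboundary of c.  By Petersen's theorem the dual cubic graph has a perfect matching y₀.
-- Since V - E + F = 1, the first cohomology group over GF(2) has dimension at most one; so if the
-- complement of y₀ is no coboundary, there is a functional α that vanishes on coboundaries and is 1 on
-- the complement of y₀, and every cocycle on which α vanishes is a coboundary.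
--
-- For any connected bridgeless cubic graph with a perfect matching and any α, some y with at most
-- one vertex of degree 3 has a complement on which α vanishes.  Run Edmonds' blossom algorithm
-- from a vertex h, leaving out its partner u, and contract a blossom only if α vanishes on all
-- cycles in it.  An obstruction to a contraction is a cycle on which α is 1 and which meets the
-- matching in all but at most one of its vertices; exchanging along it changes the class.  If none
-- occurs, r + 1 blobs, each with at least 3 leaving edges, send all of these to the r inner
-- vertices and u.  So the contracted graph is cubic and bipartite and splits into three perfect
-- matchings, and these extend to perfect matchings of the dual graph.  The sum of the three
-- complements lies inside the blobs, so α vanishes on one of the complements.
module Submission where

open import Defs hiding (B; W)
open import Algebra.Bundles using (CommutativeMonoid; CommutativeRing)
open import Data.Bool using (Bool; true; false; _∧_; _∨_; _xor_; not; if_then_else_)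
open import Data.Bool.Properties using (xor-∧-commutativeRing; xor-same; xor-assoc; xor-comm; xor-identityʳ; ∧-distribʳ-xor; ∧-distribˡ-xor; ∧-zeroʳ; ∧-comm; ∧-identityʳ)
open import Data.Bool.Solver using (module xor-∧-Solver)
open import Data.Empty using (⊥; ⊥-elim)
open import Data.Fin using (Fin; zero; suc; toℕ; combine; remQuot; _≟_) renaming (_<_ to _<ᶠ_)
import Data.Fin.Properties as FP
open import Data.Fin.Permutation using (Permutation; permutation)
open import Data.List using (List; []; _∷_; _++_; length; map; allFin; cartesianProduct)
import Data.List as List
open import Data.List.Membership.Propositional using () renaming (_∈_ to _∈ˡ_)
open import Data.List.Membership.Propositional.Properties using (∈-allFin; ∈-++⁺ˡ; ∈-++⁺ʳ; ∈-cartesianProduct⁺; ∈-lookup)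
open import Data.List.Properties using (length-++; length-map; ∷-injectiveʳ)
open import Data.List.Relation.Unary.All using (All; []; _∷_)
import Data.List.Relation.Unary.All as All
import Data.List.Relation.Unary.All.Properties as AllP
open import Data.List.Relation.Unary.Any using (Any; here; there)
import Data.List.Relation.Unary.Any as Any
import Data.List.Relation.Unary.Any.Properties as AnyP
open import Data.Nat using (ℕ; zero; suc; _+_; _*_; _∸_; _<_; _≤_; s≤s; z≤n)
import Data.Nat.Properties as ℕP
open import Data.Nat.Solver using (module +-*-Solver)
open import Data.Product using (Σ; ∃; _×_; _,_; proj₁; proj₂)
open import Data.Sum using (_⊎_; inj₁; inj₂)
open import Data.Unit using (⊤; tt)
open import Data.Vec using (Vec; []; _∷_; zipWith; replicate; lookup; tabulate) renaming (_++_ to _++ᵛ_)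
import Data.Vec as Vec
import Data.Vec.Properties as VecP
open import Function using (_∘_)
open import Level using (0ℓ)
open import Relation.Binary.Construct.Closure.ReflexiveTransitive using (Star; ε; _◅_)
open import Relation.Binary.Definitions using (Tri; tri<; tri≈; tri>)
open import Relation.Binary.PropositionalEquality
open import Relation.Nullary using (¬_; Dec; yes; no; does; contradiction)
open import Relation.Nullary.Decidable using (dec-true; dec-false)

-- That `α` vanishes on the cycles inside a blob is carried by a potential `β`: an edge is balanced
-- if the value of `α` on it is the difference of `β` at its ends. An unbalanced edge `e` between
-- outer vertices is the obstruction, and it is the only source of a monochromatic face: to use `e`,
-- the tree must be completed with three darts leaving it, the two of `e` and one towards u, and
-- this may force a vertex of degree 3. Hence blobs need more than factor-criticality: any three
-- leaving darts must cost at most one such vertex. In a blossom the costs of several blobs might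
-- add up. The remedy is an invariant for chains of evenly many blobs that bounds the sum of the
-- costs of the two ways of using the ends; these bounds add under concatenation, and closing the
-- ring selects a cheap way. With `α` zero every edge is balanced, and the same search, with the
-- other exposed vertices blocked, proves Petersen's theorem. The linear algebra is elimination on
-- lists of equations that carries a certificate of unsolvability along, so that no bases or
-- dimensions occur.

module X = xor-∧-Solver
module N = +-*-Solver
open X using (_:=_; _:+_)
open N using () renaming (_:+_ to _:⊞_; _:=_ to _:≡_)
open import Algebra.Properties.CommutativeMonoid.Sum ℕP.+-0-commutativeMonoid
  using () renaming (sum to sumℕ; sum-cong-≗ to sumℕ-cong; ∑-distrib-+ to sumℕ-distrib; ∑-comm to sumℕ-comm)

-- Linear algebra over GF(2)

infixl 6 _⊞_

_⊞_ : ∀ {N} → Vec Bool N → Vec Bool N → Vec Bool N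
_⊞_ = zipWith _xor_

zeros : ∀ {N} → Vec Bool N
zeros = replicate _ false

dot : ∀ {N} → Vec Bool N → Vec Bool N → Bool
dot []      []      = false
dot (a ∷ u) (b ∷ v) = (a ∧ b) xor dot u v

xor-interchange : ∀ a b c d → (a xor b) xor (c xor d) ≡ (a xor c) xor (b xor d)
xor-interchange = X.solve 4 (λ a b c d → (a :+ b) :+ (c :+ d) := (a :+ c) :+ (b :+ d)) refl

dot-⊞ : ∀ {N} (u v x : Vec Bool N) → dot (u ⊞ v) x ≡ dot u x xor dot v x
dot-⊞ []      []      []      = refl
dot-⊞ (a ∷ u) (b ∷ v) (c ∷ x) =
  trans (cong₂ _xor_ (∧-distribʳ-xor c a b) (dot-⊞ u v x)) (xor-interchange (a ∧ c) (b ∧ c) _ _)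

dot-zeros : ∀ {N} (u : Vec Bool N) → dot u zeros ≡ false
dot-zeros []      = refl
dot-zeros (a ∷ u) = cong₂ _xor_ (∧-zeroʳ a) (dot-zeros u)

eliminate : ∀ {N} → Vec Bool N → Vec Bool (suc N) → Vec Bool N
eliminate p (true  ∷ v) = v ⊞ p
eliminate p (false ∷ v) = v

dot-eliminate : ∀ {N} (p x : Vec Bool N) r → dot r (dot p x ∷ x) ≡ dot (eliminate p r) x
dot-eliminate p x (true  ∷ v) = trans (xor-comm (dot p x) _) (sym (dot-⊞ v p x))
dot-eliminate p x (false ∷ v) = refl

HeadFalse : ∀ {N} → Vec Bool (suc N) → Set
HeadFalse {N} r = ∃ λ (v : Vec Bool N) → r ≡ false ∷ v

pivot : ∀ {N} (rows : List (Vec Bool (suc N))) →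
  All HeadFalse rows ⊎ (∃ λ xs → ∃ λ p → ∃ λ ys → rows ≡ xs ++ (true ∷ p) ∷ ys)
pivot [] = inj₁ []
pivot ((true ∷ p) ∷ rows) = inj₂ ([] , p , rows , refl)
pivot ((false ∷ v) ∷ rows) with pivot rows
... | inj₁ h = inj₁ ((v , refl) ∷ h)
... | inj₂ (xs , p , ys , refl) = inj₂ ((false ∷ v) ∷ xs , p , ys , refl)

-- Eliminating with a pivot row removes one row and one unknown, which keeps the strict inequality;
-- if no row involves the first unknown, the first unit vector is a solution.
kernel : ∀ {N} (rows : List (Vec Bool N)) → length rows < N →
  ∃ λ x → x ≢ zeros × All (λ r → dot r x ≡ false) rows
kernel {suc N} rows l with pivot rows
... | inj₁ h = true ∷ zeros , (λ ()) , All.map (λ { (v , refl) → dot-zeros v }) h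
... | inj₂ (xs , p , ys , refl) with kernel {N} (map (eliminate p) (xs ++ ys)) small
  where
  len : length (map (eliminate p) (xs ++ ys)) ≡ length xs + length ys
  len = trans (length-map (eliminate p) (xs ++ ys)) (length-++ xs)
  small : length (map (eliminate p) (xs ++ ys)) < N
  small = subst₂ _≤_ (trans (length-++ xs) (trans (ℕP.+-suc (length xs) (length ys)) (cong suc (sym len)))) refl (ℕP.≤-pred l)
... | x , nz , sol = dot p x ∷ x , (λ { e → nz (cong (λ { (_ ∷ t) → t }) e) }) ,
      AllP.++⁺ (proj₁ parts) (xor-same (dot p x) ∷ proj₂ parts)
  where
  lifted : All (λ r → dot r (dot p x ∷ x) ≡ false) (xs ++ ys)
  lifted = All.map (λ {r} e → trans (dot-eliminate p x r) e) (AllP.map⁻ sol)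
  parts : All (λ r → dot r (dot p x ∷ x) ≡ false) xs × All (λ r → dot r (dot p x ∷ x) ≡ false) ys
  parts = AllP.++⁻ xs lifted

Equation : ℕ → Set
Equation N = Vec Bool N × Bool

Solves : ∀ {N} → Vec Bool N → Equation N → Set
Solves x (v , r) = dot v x ≡ r

eliminateEq : ∀ {N} → Equation N → Equation (suc N) → Equation N
eliminateEq (p , s) (true  ∷ v , r) = v ⊞ p , r xor s
eliminateEq (p , s) (false ∷ v , r) = v , r

-- Over GF(2), a system is solvable unless 0 = 1 is a sum of its equations; D is any set of
-- equations closed under addition.
fredholm : ∀ {N} (D : Equation N → Set) →
  (∀ {u r v s} → D (u , r) → D (v , s) → D (u ⊞ v , r xor s)) →
  (rows : List (Equation N)) → All D rows →
  (∃ λ x → All (Solves x) rows) ⊎ D (zeros , true)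
fredholm {zero} D add [] [] = inj₁ ([] , [])
fredholm {zero} D add (([] , true) ∷ rows) (d ∷ ds) = inj₂ d
fredholm {zero} D add (([] , false) ∷ rows) (d ∷ ds) with fredholm D add rows ds
... | inj₁ ([] , s) = inj₁ ([] , refl ∷ s)
... | inj₂ e = inj₂ e
fredholm {suc N} D add rows ds with pivot (map proj₁ rows)
... | inj₁ h with fredholm {N} (λ e → D (false ∷ proj₁ e , proj₂ e)) add (map (eliminateEq (zeros , false)) rows)
    (AllP.map⁺ (go (AllP.map⁻ h) ds))
  where
  go : ∀ {rs} → All (λ e → HeadFalse (proj₁ e)) rs → All D rs →
    All (λ e → D (false ∷ proj₁ (eliminateEq (zeros , false) e) , proj₂ (eliminateEq (zeros , false) e))) rs
  go [] [] = []
  go ((v , refl) ∷ hs) (e ∷ es) = e ∷ go hs es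
... | inj₂ e = inj₂ e
... | inj₁ (x , sol) = inj₁ (false ∷ x , go (AllP.map⁻ h) (AllP.map⁻ sol))
  where
  go : ∀ {rs} → All (λ e → HeadFalse (proj₁ e)) rs → All (λ e → Solves x (eliminateEq (zeros , false) e)) rs →
    All (Solves (false ∷ x)) rs
  go [] [] = []
  go ((v , refl) ∷ hs) (e ∷ es) = e ∷ go hs es
fredholm {suc N} D add rows ds | inj₂ (xs , p , ys , eq) = finish (pivotEq rows ds eq)
  where
  pivotEq : ∀ {xs} rs → All D rs → map proj₁ rs ≡ xs ++ (true ∷ p) ∷ ys → ∃ λ s → D (true ∷ p , s)
  pivotEq {[]}     ((v , s) ∷ rs) (d ∷ ds) refl = s , d
  pivotEq {_ ∷ xs} (_ ∷ rs) (d ∷ ds) e = pivotEq {xs} rs ds (∷-injectiveʳ e)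
  finish : (∃ λ s → D (true ∷ p , s)) → (∃ λ x → All (Solves x) rows) ⊎ D (zeros , true)
  -- No row is removed, not even the pivot row: reduced by itself it becomes 0 = 0. The recursion is
  -- on the number of unknowns.
  finish (s , dp) with fredholm {N} (λ e → D (false ∷ proj₁ e , proj₂ e)) add (map (eliminateEq (p , s)) rows)
                         (AllP.map⁺ (All.map (λ {e} → elimD e) ds))
    where
    elimD : ∀ e → D e → D (false ∷ proj₁ (eliminateEq (p , s) e) , proj₂ (eliminateEq (p , s) e))
    elimD (true  ∷ v , r) d = add d dp
    elimD (false ∷ v , r) d = d
  ... | inj₂ e = inj₂ e
  ... | inj₁ (x , sol) = inj₁ ((dot p x xor s) ∷ x , All.map (λ {e} → back e) (AllP.map⁻ sol))
    where
    cancel : ∀ a b c d → a xor b ≡ c xor d → (b xor d) xor a ≡ c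
    cancel a b c d e = trans (X.solve 3 (λ a b d → (b :+ d) :+ a := (a :+ b) :+ d) refl a b d)
      (trans (cong (_xor d) e) (trans (xor-assoc c d d) (trans (cong (c xor_) (xor-same d)) (xor-identityʳ c))))
    back : ∀ e → Solves x (eliminateEq (p , s) e) → Solves ((dot p x xor s) ∷ x) e
    back (true  ∷ v , r) e = cancel (dot v x) (dot p x) r s (trans (sym (dot-⊞ v p x)) e)
    back (false ∷ v , r) e = e

-- Finite sums

xorMonoid : CommutativeMonoid 0ℓ 0ℓ
xorMonoid = CommutativeRing.+-commutativeMonoid xor-∧-commutativeRing

open import Algebra.Properties.CommutativeMonoid.Sum xorMonoid
  using () renaming (sum to sumB; sum-cong-≗ to sumB-cong; ∑-distrib-+ to sumB-distrib; ∑-comm to sumB-comm; sum-replicate-zero to sumB-zero)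


_==_ : ∀ {n} → Fin n → Fin n → Bool
a == b = does (a ≟ b)

==-refl : ∀ {n} (a : Fin n) → (a == a) ≡ true
==-refl a = dec-true (a ≟ a) refl

==-≢ : ∀ {n} {a b : Fin n} → a ≢ b → (a == b) ≡ false
==-≢ {a = a} {b} = dec-false (a ≟ b)

==-sound : ∀ {n} (a b : Fin n) → (a == b) ≡ true → a ≡ b
==-sound a b e with a ≟ b
... | yes p = p
... | no _ = contradiction e λ ()

==-sym : ∀ {n} (a b : Fin n) → (a == b) ≡ (b == a)
==-sym a b with a ≟ b
... | yes refl = sym (==-refl a)
... | no a≢b = sym (==-≢ (a≢b ∘ sym))

ι : Bool → ℕ
ι b = if b then 1 else 0

module FinSum (M : CommutativeMonoid 0ℓ 0ℓ) where
  open CommutativeMonoid M renaming (Carrier to A; ε to 0ᴹ; refl to ≈-refl; sym to ≈-sym; trans to ≈-trans)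
  open import Algebra.Properties.CommutativeMonoid.Sum M
  
  sum-== : ∀ {n} (a : Fin n) (h : Fin n → A) → sum (λ l → if a == l then h l else 0ᴹ) ≈ h a
  sum-== {suc n} zero    h = ≈-trans (∙-congˡ (sum-replicate-zero n)) (identityʳ _)
  sum-== {suc n} (suc a) h = ≈-trans (identityˡ _) (sum-== a (λ l → h (suc l)))

  Σ² : ∀ {m k} → (Fin m × Fin k → A) → A
  Σ² g = sum (λ f → sum (λ i → g (f , i)))

  Σ²-cong : ∀ {m k} {g h : Fin m × Fin k → A} → (∀ d → g d ≈ h d) → Σ² g ≈ Σ² h
  Σ²-cong e = sum-cong-≋ (λ f → sum-cong-≋ (λ i → e (f , i)))

  Σ²-distrib : ∀ {m k} (g h : Fin m × Fin k → A) → Σ² (λ d → g d ∙ h d) ≈ Σ² g ∙ Σ² h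
  Σ²-distrib {m} {k} g h = ≈-trans (sum-cong-≋ (λ f → ∑-distrib-+ (λ i → g (f , i)) (λ i → h (f , i))))
    (∑-distrib-+ {m} (λ f → sum (λ i → g (f , i))) (λ f → sum (λ i → h (f , i))))

  sum-flatten : ∀ m (g : Fin m × Fin 3 → A) → sum (λ x → g (remQuot {m} 3 x)) ≈ Σ² g
  sum-flatten zero    g = ≈-refl
  sum-flatten (suc m) g =
    ≈-trans (∙-congˡ (∙-congˡ (∙-congˡ (sum-flatten m (λ { (f , i) → g (suc f , i) })))))
      (≈-trans (∙-congˡ (∙-congˡ (∙-congʳ (≈-sym (identityʳ _)))))
        (≈-trans (∙-congˡ (≈-sym (assoc _ _ _))) (≈-sym (assoc _ _ _))))

  -- An involution of the pairs becomes a permutation of `Fin (m * 3)`, under which a sum over one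
  -- index is invariant.
  Σ²-reindex : ∀ {m} (op : Fin m × Fin 3 → Fin m × Fin 3) → (∀ d → op (op d) ≡ d) →
    (g : Fin m × Fin 3 → A) → Σ² (λ d → g (op d)) ≈ Σ² g
  Σ²-reindex {m} op inv g = ≈-trans (≈-sym (sum-flatten m (λ d → g (op d)))) (≈-trans
      (sum-cong-≋ (λ x → reflexive (cong g (sym (FP.remQuot-combine {m} (proj₁ (op (remQuot 3 x))) _)))))
      (≈-trans (≈-sym (sum-permute (λ x → g (remQuot {m} 3 x)) π)) (sum-flatten m g)))
    where
    φ : Fin (m * 3) → Fin (m * 3)
    φ x = combine (proj₁ (op (remQuot 3 x))) (proj₂ (op (remQuot 3 x)))
    φφ : ∀ x → φ (φ x) ≡ x
    φφ x = trans (cong (λ d → combine (proj₁ (op d)) (proj₂ (op d))) (FP.remQuot-combine {m} (proj₁ (op (remQuot 3 x))) _))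
      (trans (cong (λ d → combine {m} (proj₁ d) (proj₂ d)) (inv (remQuot 3 x))) (FP.combine-remQuot {m} 3 x))
    π : Permutation (m * 3) (m * 3)
    π = permutation φ φ φφ φφ

module ℕS = FinSum ℕP.+-0-commutativeMonoid
module BS = FinSum xorMonoid

par : ℕ → Bool
par zero    = false
par (suc n) = not (par n)

par-+ : ∀ a b → par (a + b) ≡ par a xor par b
par-+ zero    b = refl
par-+ (suc a) b = trans (cong not (par-+ a b))
    (X.solve 2 (λ x y → X.con true :+ (x :+ y) := (X.con true :+ x) :+ y) refl (par a) (par b))

par-ι : ∀ b → par (ι b) ≡ b
par-ι true  = refl
par-ι false = refl

par-sum : ∀ {n} (f : Fin n → ℕ) → par (sumℕ f) ≡ sumB (λ i → par (f i))
par-sum {zero}  f = refl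
par-sum {suc n} f = trans (par-+ (f zero) _) (cong (par (f zero) xor_) (par-sum (λ i → f (suc i))))

ι≤1 : ∀ b → ι b ≤ 1
ι≤1 true  = s≤s z≤n
ι≤1 false = z≤n

sumℕ-pull : ∀ {p q} (t : Fin p → Fin q) (h : Fin q → ℕ) →
  sumℕ (λ k → h (t k)) ≡ sumℕ (λ l → sumℕ (λ k → if t k == l then h l else 0))
sumℕ-pull {p} {q} t h = trans (sumℕ-cong (λ k → sym (ℕS.sum-== (t k) h))) (sumℕ-comm {p} {q} _)

sumℕ-const-if : ∀ {p} (t : Fin p → Bool) (c : ℕ) → sumℕ (λ k → if t k then c else 0) ≡ sumℕ (λ k → ι (t k)) * c
sumℕ-const-if {zero}  t c = refl
sumℕ-const-if {suc p} t c = trans (cong₂ _+_ (head (t zero)) (sumℕ-const-if (λ k → t (suc k)) c))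
    (sym (ℕP.*-distribʳ-+ c (ι (t zero)) _))
  where
  head : ∀ b → (if b then c else 0) ≡ ι b * c
  head true  = sym (ℕP.+-identityʳ c)
  head false = refl

-- Bijectivity enters as a count of preimages, the form in which perfect matchings of the contracted
-- graph are obtained.
sumℕ-reindex : ∀ {p q} (t : Fin p → Fin q) → (∀ l → sumℕ (λ k → ι (t k == l)) ≡ 1) → (h : Fin q → ℕ) →
  sumℕ (λ k → h (t k)) ≡ sumℕ h
sumℕ-reindex t once h = trans (sumℕ-pull t h) (sumℕ-cong (λ l →
  trans (sumℕ-const-if (λ k → t k == l) (h l)) (trans (cong (_* h l) (once l)) (ℕP.*-identityˡ (h l)))))

dot-lookup : ∀ {q} (u x : Vec Bool q) → dot u x ≡ sumB (λ k → lookup u k ∧ lookup x k)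
dot-lookup []      []      = refl
dot-lookup (a ∷ u) (b ∷ x) = cong ((a ∧ b) xor_) (dot-lookup u x)

double-injective : ∀ a b → a + a ≡ b + b → a ≡ b
double-injective zero    zero    e = refl
double-injective (suc a) (suc b) e =
  cong suc (double-injective a b (ℕP.suc-injective (trans (sym (ℕP.+-suc a a)) (trans (ℕP.suc-injective e) (ℕP.+-suc b b)))))

xor-true : ∀ p q → p xor q ≡ true → p ≡ true ⊎ q ≡ true
xor-true true  q e = inj₁ refl
xor-true false q e = inj₂ e

xor-undo : ∀ a b → a ≡ (a xor b) xor b
xor-undo a b = sym (trans (xor-assoc a b b) (trans (cong (a xor_) (xor-same b)) (xor-identityʳ a)))

∧-if : ∀ p q → p ∧ q ≡ (if p then q else false)
∧-if true  q = refl
∧-if false q = refl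

if-true : ∀ b → b ≡ (if b then true else false)
if-true true  = refl
if-true false = refl

term≤sum : ∀ {n} (g : Fin n → ℕ) k → g k ≤ sumℕ g
term≤sum g zero = ℕP.m≤m+n _ _
term≤sum g (suc k) = ℕP.≤-trans (term≤sum (λ i → g (suc i)) k) (ℕP.m≤n+m _ _)

-- A 2-regular bipartite multigraph has a perfect matching whose complement is one: a set Q of
-- targets obstructing the linear system for the choice contains both or none of τ k false and
-- τ k true, so by double counting as many k have both in Q as Q has elements, and Q does not
-- obstruct.
module Halving {q : ℕ} (τ : Fin q → Bool → Fin q)
    (twice : ∀ l → sumℕ (λ k → ι (τ k false == l) + ι (τ k true == l)) ≡ 2) where

  -- The sums of the equations `row l` over `l` in `Q`, written out so that the right-hand side can
  -- be evaluated by counting.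
  Dual : Equation q → Set
  Dual (v , r) = ∃ λ (Q : Fin q → Bool) →
    (∀ k → lookup v k ≡ Q (τ k false) xor Q (τ k true)) × r ≡ sumB Q xor sumB (λ k → Q (τ k false))

  -- The condition that an odd number of `k` choose `l`: over GF(2) the bit saying that `k` chooses
  -- `l` is affine in the choice `x`, namely `(τ k false == l) xor (((τ k false == l) xor (τ k true
  -- == l)) ∧ x)`.
  row : Fin q → Equation q
  row l = tabulate (λ k → (τ k false == l) xor (τ k true == l)) , true xor sumB (λ k → τ k false == l)

  Dual-add : ∀ {u r v s} → Dual (u , r) → Dual (v , s) → Dual (u ⊞ v , r xor s)
  Dual-add {u} {r} {v} {s} (Q , a , b) (Q′ , a′ , b′) = (λ l → Q l xor Q′ l) ,
    (λ k → trans (VecP.lookup-zipWith _xor_ k u v)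
        (trans (cong₂ _xor_ (a k) (a′ k)) (xor-interchange (Q (τ k false)) (Q (τ k true)) _ _))) ,
    trans (cong₂ _xor_ b b′) (trans (xor-interchange (sumB Q) (sumB (λ k → Q (τ k false))) _ _)
      (sym (cong₂ _xor_ (sumB-distrib Q Q′) (sumB-distrib (λ k → Q (τ k false)) (λ k → Q′ (τ k false))))))

  sumB-== : ∀ {n} (l : Fin n) → sumB (λ j → j == l) ≡ true
  sumB-== l = trans (sumB-cong (λ j → trans (==-sym j l) (if-true (l == j)))) (BS.sum-== l (λ _ → true))

  Dual-row : ∀ l → Dual (row l)
  Dual-row l = (λ j → j == l) , (λ k → VecP.lookup∘tabulate _ k) , cong (_xor sumB (λ k → τ k false == l)) (sym (sumB-== l))

  ¬Dual : ¬ Dual (zeros , true)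
  ¬Dual (Q , a , b) = contradiction (trans b (trans (cong₂ _xor_ (parQ Q) (parQ (λ k → Q (τ k false))))
        (trans (cong (λ z → par z xor par (sumℕ (λ k → ι (Q (τ k false))))) (sym same))
            (xor-same (par (sumℕ (λ k → ι (Q (τ k false))))))))) λ ()
    where
    parQ : ∀ {n} (P : Fin n → Bool) → sumB P ≡ par (sumℕ (λ k → ι (P k)))
    parQ P = trans (sumB-cong (λ k → sym (par-ι (P k)))) (sym (par-sum (λ k → ι (P k))))
    equal : ∀ k → Q (τ k false) ≡ Q (τ k true)
    equal k = xor-cancel _ _ (trans (sym (a k)) (VecP.lookup-replicate k false))
      where
      xor-cancel : ∀ x y → x xor y ≡ false → x ≡ y
      xor-cancel true  true  e = refl
      xor-cancel false false e = refl
    same : sumℕ (λ k → ι (Q (τ k false))) ≡ sumℕ (λ l → ι (Q l))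
    same = double-injective _ _ (begin
      sumℕ (λ k → ι (Q (τ k false))) + sumℕ (λ k → ι (Q (τ k false)))
        ≡⟨ cong (λ z → sumℕ (λ k → ι (Q (τ k false))) + z) (sumℕ-cong (λ k → cong ι (equal k))) ⟩
      sumℕ (λ k → ι (Q (τ k false))) + sumℕ (λ k → ι (Q (τ k true)))
        ≡⟨ cong₂ _+_ (sumℕ-pull (λ k → τ k false) (λ l → ι (Q l))) (sumℕ-pull (λ k → τ k true) (λ l → ι (Q l))) ⟩
      _ ≡⟨ cong₂ _+_ (sumℕ-cong (λ l → sumℕ-const-if (λ k → τ k false == l) (ι (Q l))))
          (sumℕ-cong (λ l → sumℕ-const-if (λ k → τ k true == l) (ι (Q l)))) ⟩
      _ ≡⟨ sumℕ-distrib (λ l → sumℕ (λ k → ι (τ k false == l)) * ι (Q l)) (λ l → sumℕ (λ k → ι (τ k true == l)) * ι (Q l)) ⟨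
      sumℕ (λ l → sumℕ (λ k → ι (τ k false == l)) * ι (Q l) + sumℕ (λ k → ι (τ k true == l)) * ι (Q l))
        ≡⟨ sumℕ-cong (λ l → trans (sym (ℕP.*-distribʳ-+ (ι (Q l)) (sumℕ (λ k → ι (τ k false == l))) _))
             (trans (cong (_* ι (Q l)) (trans (sym (sumℕ-distrib (λ k → ι (τ k false == l)) _)) (twice l)))
               (cong (ι (Q l) +_) (ℕP.+-identityʳ _)))) ⟩
      sumℕ (λ l → ι (Q l) + ι (Q l)) ≡⟨ sumℕ-distrib (λ l → ι (Q l)) (λ l → ι (Q l)) ⟩
      sumℕ (λ l → ι (Q l)) + sumℕ (λ l → ι (Q l)) ∎)
      where open ≡-Reasoning

  solution : ∃ λ x → All (Solves x) (map row (allFin q))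
  solution with fredholm Dual (λ {u} {r} {v} {s} → Dual-add {u} {r} {v} {s}) (map row (allFin q))
      (AllP.map⁺ (All.tabulate (λ {l} _ → Dual-row l)))
  ... | inj₁ s = s
  ... | inj₂ d = ⊥-elim (¬Dual d)

  pick : Fin q → Bool
  pick k = lookup (proj₁ solution) k

  hits : (Fin q → Bool) → Fin q → ℕ
  hits g l = sumℕ (λ k → ι (τ k (g k) == l))

  hits-sum : ∀ l → hits pick l + hits (λ k → not (pick k)) l ≡ 2
  hits-sum l = trans (sym (sumℕ-distrib (λ k → ι (τ k (pick k) == l)) _))
      (trans (sumℕ-cong (λ k → both (pick k) (λ b → ι (τ k b == l)))) (twice l))
    where
    both : ∀ b (h : Bool → ℕ) → h b + h (not b) ≡ h false + h true
    both false h = refl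
    both true  h = ℕP.+-comm (h true) (h false)

  hits-odd : ∀ l → par (hits pick l) ≡ true
  hits-odd l = trans (par-sum (λ k → ι (τ k (pick k) == l)))
      (trans (sumB-cong (λ k → trans (par-ι _) (split (pick k) (λ b → τ k b == l))))
      (trans (sumB-distrib (λ k → τ k false == l) (λ k → ((τ k false == l) xor (τ k true == l)) ∧ pick k))
          (trans (cong (sumB (λ k → τ k false == l) xor_) solved)
        (xor-not (sumB (λ k → τ k false == l))))))
    where
    xor-not : ∀ a → a xor (true xor a) ≡ true
    xor-not true  = refl
    xor-not false = refl
    split : ∀ b (h : Bool → Bool) → h b ≡ h false xor ((h false xor h true) ∧ b)
    split true  h = trans (trans (X.solve 2 (λ a b → b := (a :+ a) :+ b) refl (h false) (h true))
        (xor-assoc (h false) (h false) _))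
      (cong (h false xor_) (∧-comm true _))
    split false h = trans (sym (xor-identityʳ _)) (cong (h false xor_) (sym (∧-zeroʳ _)))
    solved : sumB (λ k → ((τ k false == l) xor (τ k true == l)) ∧ pick k) ≡ true xor sumB (λ k → τ k false == l)
    solved = trans (sumB-cong (λ k → cong (_∧ pick k) (sym (VecP.lookup∘tabulate _ k))))
      (trans (sym (dot-lookup (proj₁ (row l)) (proj₁ solution))) (All.lookup (AllP.map⁻ (proj₂ solution)) (∈-allFin l)))

  -- The linear system controls only the parity; as the hits of a choice and of its complement add
  -- up to 2, odd means one.
  hits-pick : ∀ l → hits pick l ≡ 1
  hits-pick l = odd≤2 _ _ (hits-sum l) (hits-odd l)
    where
    odd≤2 : ∀ a b → a + b ≡ 2 → par a ≡ true → a ≡ 1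
    odd≤2 (suc zero) b e p = refl
    odd≤2 (suc (suc (suc a))) b () p

  hits-complement : ∀ l → hits (λ k → not (pick k)) l ≡ 1
  hits-complement l = ℕP.suc-injective (trans (cong (_+ hits (λ k → not (pick k)) l) (sym (hits-pick l))) (hits-sum l))


next : Fin 3 → Fin 3
next zero = suc zero
next (suc zero) = suc (suc zero)
next (suc (suc zero)) = zero

sumℕ-rotate : ∀ (g : Fin 3 → ℕ) j → sumℕ g ≡ g j + (g (next j) + g (next (next j)))
sumℕ-rotate g zero = cong (λ z → g zero + (g (suc zero) + z)) (ℕP.+-identityʳ _)
sumℕ-rotate g (suc zero) = N.solve 3 (λ a b c → a :⊞ (b :⊞ (c :⊞ N.con 0)) :≡ b :⊞ (c :⊞ a)) refl (g zero)
    (g (suc zero)) (g (suc (suc zero)))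
sumℕ-rotate g (suc (suc zero)) = N.solve 3 (λ a b c → a :⊞ (b :⊞ (c :⊞ N.con 0)) :≡ c :⊞ (a :⊞ b)) refl (g zero)
    (g (suc zero)) (g (suc (suc zero)))

sumB-rotate : ∀ (g : Fin 3 → Bool) j → sumB g ≡ g j xor (g (next j) xor g (next (next j)))
sumB-rotate g zero = cong (λ z → g zero xor (g (suc zero) xor z)) (xor-identityʳ _)
sumB-rotate g (suc zero) = X.solve 3 (λ a b c → a :+ (b :+ (c :+ X.con false)) := b :+ (c :+ a)) refl (g zero)
    (g (suc zero)) (g (suc (suc zero)))
sumB-rotate g (suc (suc zero)) = X.solve 3 (λ a b c → a :+ (b :+ (c :+ X.con false)) := c :+ (a :+ b)) refl (g zero)
    (g (suc zero)) (g (suc (suc zero)))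


xor-equal : ∀ a b → a xor b ≡ false → a ≡ b
xor-equal true true e = refl
xor-equal false false e = refl

-- Configurations in a cubic graph

-- The dart (f , i) is the i-th edge end at the vertex f; op exchanges the two ends of an edge.
module CubicGraph {m : ℕ} (op : Fin m × Fin 3 → Fin m × Fin 3)
    (op-op : ∀ d → op (op d) ≡ d) (op-vertex : ∀ d → proj₁ (op d) ≢ proj₁ d) where

  V : Set
  V = Fin m

  Dart : Set
  Dart = V × Fin 3

  Chain : Set
  Chain = Dart → Bool

  _==ᵈ_ : Dart → Dart → Bool
  (f , i) ==ᵈ (g , j) = (f == g) ∧ (i == j)

  ==ᵈ-refl : ∀ d → (d ==ᵈ d) ≡ true
  ==ᵈ-refl (f , i) = cong₂ _∧_ (==-refl f) (==-refl i)

  ==ᵈ-sound : ∀ d e → (d ==ᵈ e) ≡ true → d ≡ e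
  ==ᵈ-sound (f , i) (g , j) p with f ≟ g | i ≟ j
  ... | yes refl | yes refl = refl
  ... | yes _ | no _ = contradiction p λ ()
  ... | no _ | _ = contradiction p λ ()

  bool-ext : ∀ {a b} → (a ≡ true → b ≡ true) → (b ≡ true → a ≡ true) → a ≡ b
  bool-ext {true}  {true}  p q = refl
  bool-ext {false} {false} p q = refl
  bool-ext {true}  {false} p q = sym (p refl)
  bool-ext {false} {true}  p q = q refl

  ==ᵈ-op : ∀ c d → (c ==ᵈ op d) ≡ (op c ==ᵈ d)
  ==ᵈ-op c d = bool-ext
    (λ p → subst (λ z → (op c ==ᵈ z) ≡ true) (trans (cong op (==ᵈ-sound c (op d) p)) (op-op d)) (==ᵈ-refl (op c)))
    (λ p → subst (λ z → (c ==ᵈ z) ≡ true) (trans (sym (op-op c)) (cong op (==ᵈ-sound (op c) d p))) (==ᵈ-refl c))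

  ⟦_⟧ : List Dart → Chain
  ⟦ [] ⟧ d = false
  ⟦ t ∷ ts ⟧ d = (t ==ᵈ d) xor ⟦ ts ⟧ d

  ⟦++⟧ : ∀ ts us d → ⟦ ts ++ us ⟧ d ≡ ⟦ ts ⟧ d xor ⟦ us ⟧ d
  ⟦++⟧ [] us d = refl
  ⟦++⟧ (t ∷ ts) us d = trans (cong ((t ==ᵈ d) xor_) (⟦++⟧ ts us d)) (sym (xor-assoc (t ==ᵈ d) (⟦ ts ⟧ d) (⟦ us ⟧ d)))

  parity : Chain → V → Bool
  parity y f = sumB (λ i → y (f , i))

  bad : Chain → V → Bool
  bad y f = y (f , zero) ∧ (y (f , suc zero) ∧ y (f , suc (suc zero)))

  parity-cong : ∀ (y z : Chain) f → (∀ i → y (f , i) ≡ z (f , i)) → parity y f ≡ parity z f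
  parity-cong y z f e = sumB-cong e

  bad-cong : ∀ (y z : Chain) f → (∀ i → y (f , i) ≡ z (f , i)) → bad y f ≡ bad z f
  bad-cong y z f e = cong₂ _∧_ (e zero) (cong₂ _∧_ (e (suc zero)) (e (suc (suc zero))))

  _⊕_ : Chain → Chain → Chain
  (y ⊕ z) d = y d xor z d

  -- Vertex sets are multiplicity functions, so that unions are sums; a configuration is only
  -- constrained at vertices of multiplicity one.
  VSet : Set
  VSet = V → ℕ

  _∈_ : V → VSet → Set
  f ∈ K = 1 ≤ K f

  _⊎ᵛ_ : VSet → VSet → VSet
  (K ⊎ᵛ L) f = K f + L f

  ⁅_⁆ : V → VSet
  ⁅ s ⁆ f = ι (s == f)

  ∈-split : ∀ K L {f} → f ∈ (K ⊎ᵛ L) → f ∈ K ⊎ f ∈ L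
  ∈-split K L {f} p with K f
  ... | zero  = inj₂ p
  ... | suc _ = inj₁ (s≤s z≤n)

  ∈-left : ∀ K L {f} → f ∈ K → f ∈ (K ⊎ᵛ L)
  ∈-left K L {f} p = ℕP.≤-trans p (ℕP.m≤m+n (K f) (L f))

  ∈-right : ∀ K L {f} → f ∈ L → f ∈ (K ⊎ᵛ L)
  ∈-right K L {f} p = ℕP.≤-trans p (ℕP.m≤n+m (L f) (K f))

  ∈-self : ∀ s → s ∈ ⁅ s ⁆
  ∈-self s = subst (λ b → 1 ≤ ι b) (sym (==-refl s)) (s≤s z≤n)

  ∈⁅⁆ : ∀ s {f} → f ∈ ⁅ s ⁆ → s ≡ f
  ∈⁅⁆ s {f} p with s ≟ f
  ... | yes e = e
  ... | no _ = contradiction p λ ()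

  -- The flag is the cost: `false` allows no vertex of degree 3, `true` allows one. Costs are added
  -- by `_∨_` under the condition `a ∧ b ≡ false`.
  Few : Bool → VSet → (V → Bool) → Set
  Few false K p = ∀ f → K f ≡ 1 → p f ≡ false
  Few true  K p = ∀ f g → K f ≡ 1 → K g ≡ 1 → p f ≡ true → p g ≡ true → f ≡ g

  -- A relation invariant under permutations of its three darts, each on one of two sides, needs
  -- four cases instead of eight.
  by-sides : ∀ {P Q : Dart → Set} {R : Dart → Dart → Dart → Set} →
    (∀ {t u v} → R t u v → R u t v) → (∀ {t u v} → R t u v → R t v u) →
    (∀ t u v → P t → P u → P v → R t u v) → (∀ t u v → P t → P u → Q v → R t u v) →
    (∀ t u v → P t → Q u → Q v → R t u v) → (∀ t u v → Q t → Q u → Q v → R t u v) →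
    ∀ t u v → P t ⊎ Q t → P u ⊎ Q u → P v ⊎ Q v → R t u v
  by-sides s₁ s₂ ppp ppq pqq qqq t u v (inj₁ p) (inj₁ q) (inj₁ r) = ppp t u v p q r
  by-sides s₁ s₂ ppp ppq pqq qqq t u v (inj₁ p) (inj₁ q) (inj₂ r) = ppq t u v p q r
  by-sides s₁ s₂ ppp ppq pqq qqq t u v (inj₁ p) (inj₂ q) (inj₁ r) = s₂ (ppq t v u p r q)
  by-sides s₁ s₂ ppp ppq pqq qqq t u v (inj₂ p) (inj₁ q) (inj₁ r) = s₁ (s₂ (ppq u v t q r p))
  by-sides s₁ s₂ ppp ppq pqq qqq t u v (inj₁ p) (inj₂ q) (inj₂ r) = pqq t u v p q r
  by-sides s₁ s₂ ppp ppq pqq qqq t u v (inj₂ p) (inj₁ q) (inj₂ r) = s₁ (pqq u t v q p r)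
  by-sides s₁ s₂ ppp ppq pqq qqq t u v (inj₂ p) (inj₂ q) (inj₁ r) = s₂ (s₁ (pqq v t u r p q))
  by-sides s₁ s₂ ppp ppq pqq qqq t u v (inj₂ p) (inj₂ q) (inj₂ r) = qqq t u v p q r

  module Configurations (α : Chain) (β : V → Bool) where

    -- A sum over all darts meets every edge twice, so `α` takes the value `α d xor α (op d)` on the
    -- edge of `d`. Where this is the difference of a potential `β`, the functional vanishes on all
    -- cycles.
    Balanced : Dart → Set
    Balanced d = α d xor α (op d) ≡ β (proj₁ d) xor β (proj₁ (op d))

    Balanced-op : ∀ {d} → Balanced d → Balanced (op d)
    Balanced-op {d} e = trans (cong (α (op d) xor_) (cong α (op-op d))) (trans (xor-comm (α (op d)) (α d)) (trans e
      (trans (xor-comm (β (proj₁ d)) _) (cong (β (proj₁ (op d)) xor_) (sym (cong (β ∘ proj₁) (op-op d)))))))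

    -- A set of edges of which those inside K are balanced and those leaving K (counted with
    -- multiplicity mod 2) are ts, having odd degree at every vertex of K; if b is false, all
    -- these degrees are 1, otherwise at most one of them is 3.
    record Conf (K : VSet) (ts : List Dart) (b : Bool) : Set where
      field
        y    : Chain
        out  : ∀ f i → K f ≡ 0 → y (f , i) ≡ false
        odd  : ∀ f → K f ≡ 1 → parity y f ≡ true
        few  : Few b K (bad y)
        symm : ∀ d → y (op d) xor ⟦ ts ⟧ (op d) ≡ y d xor ⟦ ts ⟧ d
        cons : ∀ d → y d xor ⟦ ts ⟧ d ≡ true → proj₁ d ∈ K × Balanced d

    open Conf

    Conf-resp : ∀ {K L ts us b} → (∀ f → K f ≡ L f) → (∀ d → ⟦ ts ⟧ d ≡ ⟦ us ⟧ d) → Conf K ts b → Conf L us b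
    Conf-resp {K} {L} {ts} {us} {b} e t C = record
      { y = y C ; out = λ f i p → out C f i (trans (e f) p) ; odd = λ f p → odd C f (trans (e f) p) ; few = go b (few C)
      ; symm = λ d → subst₂ (λ p q → y C (op d) xor p ≡ y C d xor q) (t (op d)) (t d) (symm C d)
      ; cons = λ d p → let (q , r) = cons C d (trans (cong (y C d xor_) (t d)) p) in subst (1 ≤_) (e _) q , r }
      where
      go : ∀ b → Few b K (bad (y C)) → Few b L (bad (y C))
      go false h f p = h f (trans (e f) p)
      go true  h f g p q = h f g (trans (e f) p) (trans (e g) q)

    weaken : ∀ {K ts} b → Conf K ts b → Conf K ts true
    weaken true  C = C
    weaken false C = record { y = y C ; out = out C ; odd = odd C ; symm = symm C ; cons = cons C
      ; few = λ f g p q r s → contradiction (trans (sym r) (few C f p)) λ () }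

    -- `K` and `L` may overlap. At a vertex of multiplicity one in the union only one of them is
    -- present, and the chain of the other vanishes there by `out`.
    glue : ∀ {K L ts us a b} → Conf K ts a → Conf L us b → a ∧ b ≡ false → Conf (K ⊎ᵛ L) (ts ++ us) (a ∨ b)
    glue {K} {L} {ts} {us} {a} {b} C D ab = record
      { y = y C ⊕ y D
      ; out = λ f i p → cong₂ _xor_ (out C f i (ℕP.m+n≡0⇒m≡0 (K f) p)) (out D f i (ℕP.m+n≡0⇒n≡0 (K f) p))
      ; odd = λ f p → odd′ f (one-of f p)
      ; few = few′ a b ab (few C) (few D)
      ; symm = λ d → trans (mix (op d)) (trans (cong₂ _xor_ (symm C d) (symm D d)) (sym (mix d)))
      ; cons = λ d p → cons′ d (xor-true _ _ (trans (sym (mix d)) p)) }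
      where
      one-of : ∀ f → K f + L f ≡ 1 → (K f ≡ 1 × L f ≡ 0) ⊎ (K f ≡ 0 × L f ≡ 1)
      one-of f p with K f | L f
      ... | zero     | _    = inj₂ (refl , p)
      ... | suc zero | zero = inj₁ (refl , refl)
      onK : ∀ f → L f ≡ 0 → ∀ i → (y C ⊕ y D) (f , i) ≡ y C (f , i)
      onK f p i = trans (cong (y C (f , i) xor_) (out D f i p)) (xor-identityʳ _)
      onL : ∀ f → K f ≡ 0 → ∀ i → (y C ⊕ y D) (f , i) ≡ y D (f , i)
      onL f p i = cong (_xor y D (f , i)) (out C f i p)
      odd′ : ∀ f → (K f ≡ 1 × L f ≡ 0) ⊎ (K f ≡ 0 × L f ≡ 1) → parity (y C ⊕ y D) f ≡ true
      odd′ f (inj₁ (p , q)) = trans (parity-cong (y C ⊕ y D) (y C) f (onK f q)) (odd C f p)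
      odd′ f (inj₂ (p , q)) = trans (parity-cong (y C ⊕ y D) (y D) f (onL f p)) (odd D f q)
      BadC : ∀ f → Set
      BadC f = K f ≡ 1 × bad (y C) f ≡ true
      BadD : ∀ f → Set
      BadD f = L f ≡ 1 × bad (y D) f ≡ true
      which : ∀ f → K f + L f ≡ 1 → bad (y C ⊕ y D) f ≡ true → BadC f ⊎ BadD f
      which f p r with one-of f p
      ... | inj₁ (s , t) = inj₁ (s , trans (sym (bad-cong (y C ⊕ y D) (y C) f (onK f t))) r)
      ... | inj₂ (s , t) = inj₂ (t , trans (sym (bad-cong (y C ⊕ y D) (y D) f (onL f s))) r)
      clash : ∀ {z : Bool} → z ≡ false → z ≡ true → ⊥
      clash refl ()
      few′ : ∀ a b → a ∧ b ≡ false → Few a K (bad (y C)) → Few b L (bad (y D)) → Few (a ∨ b) (K ⊎ᵛ L) (bad (y C ⊕ y D))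
      few′ false false _ h k f p with one-of f p
      ... | inj₁ (s , t) = trans (bad-cong (y C ⊕ y D) (y C) f (onK f t)) (h f s)
      ... | inj₂ (s , t) = trans (bad-cong (y C ⊕ y D) (y D) f (onL f s)) (k f t)
      few′ true false _ h k f g p q r s with which f p r | which g q s
      ... | inj₁ (u , v) | inj₁ (w , x) = h f g u w v x
      ... | inj₂ (u , v) | _ = ⊥-elim (clash (k f u) v)
      ... | inj₁ _ | inj₂ (w , x) = ⊥-elim (clash (k g w) x)
      few′ false true _ h k f g p q r s with which f p r | which g q s
      ... | inj₂ (u , v) | inj₂ (w , x) = k f g u w v x
      ... | inj₁ (u , v) | _ = ⊥-elim (clash (h f u) v)
      ... | inj₂ _ | inj₁ (w , x) = ⊥-elim (clash (h g w) x)
      mix : ∀ d → (y C ⊕ y D) d xor ⟦ ts ++ us ⟧ d ≡ (y C d xor ⟦ ts ⟧ d) xor (y D d xor ⟦ us ⟧ d)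
      mix d = trans (cong ((y C ⊕ y D) d xor_) (⟦++⟧ ts us d)) (xor-interchange (y C d) (y D d) (⟦ ts ⟧ d) (⟦ us ⟧ d))
      cons′ : ∀ d → (y C d xor ⟦ ts ⟧ d ≡ true) ⊎ (y D d xor ⟦ us ⟧ d ≡ true) → proj₁ d ∈ (K ⊎ᵛ L) × Balanced d
      cons′ d (inj₁ p) = let (q , r) = cons C d p in ∈-left K L q , r
      cons′ d (inj₂ p) = let (q , r) = cons D d p in ∈-right K L q , r

    -- The chain stays the same. Two leaving darts that form one edge are booked as an inner edge,
    -- which therefore has to be balanced.
    absorb : ∀ {K c c′ ts b} → op c ≡ c′ → proj₁ c ∈ K → proj₁ c′ ∈ K → Balanced c → Conf K (c ∷ c′ ∷ ts) b → Conf K ts b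
    absorb {K} {c} {_} {ts} {b} refl p p′ bal C = record
      { y = y C ; out = out C ; odd = odd C ; few = few C
      ; symm = λ d → trans (move (op d)) (trans (cong₂ _xor_ (symm C d) (flip d)) (sym (move d)))
      ; cons = λ d q → cons′ d (xor-true _ _ (trans (sym (move d)) q)) }
      where
      e : Chain
      e d = (c ==ᵈ d) xor (op c ==ᵈ d)
      move : ∀ d → y C d xor ⟦ ts ⟧ d ≡ (y C d xor ⟦ c ∷ op c ∷ ts ⟧ d) xor e d
      move d = sym (trans (X.solve 4 (λ y c c′ t → (y :+ (c :+ (c′ :+ t))) :+ (c :+ c′) := (y :+ t) :+
          ((c :+ c) :+ (c′ :+ c′))) refl (y C d) (c ==ᵈ d) (op c ==ᵈ d) (⟦ ts ⟧ d))
        (trans (cong ((y C d xor ⟦ ts ⟧ d) xor_) (cong₂ _xor_ (xor-same (c ==ᵈ d)) (xor-same (op c ==ᵈ d)))) (xor-identityʳ _)))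
      flip : ∀ d → e (op d) ≡ e d
      flip d = trans (xor-comm (c ==ᵈ op d) _) (cong₂ _xor_ (trans (==ᵈ-op (op c) d) (cong (_==ᵈ d) (op-op c))) (==ᵈ-op c d))
      cons′ : ∀ d → (y C d xor ⟦ c ∷ op c ∷ ts ⟧ d ≡ true) ⊎ (e d ≡ true) → proj₁ d ∈ K × Balanced d
      cons′ d (inj₁ q) = cons C d q
      cons′ d (inj₂ q) with xor-true _ _ q
      ... | inj₁ r rewrite sym (==ᵈ-sound c d r) = p , bal
      ... | inj₂ r rewrite sym (==ᵈ-sound (op c) d r) = p′ , Balanced-op bal

    reorder : ∀ {K ts us b} → (∀ d → ⟦ ts ⟧ d ≡ ⟦ us ⟧ d) → Conf K ts b → Conf K us b
    reorder = Conf-resp (λ _ → refl)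

    swap₀ : ∀ {K s t ts b} → Conf K (s ∷ t ∷ ts) b → Conf K (t ∷ s ∷ ts) b
    swap₀ {s = s} {t} {ts} = reorder (λ d → X.solve 3 (λ a b c → a :+ (b :+ c) := b :+ (a :+ c)) refl (s ==ᵈ d)
        (t ==ᵈ d) (⟦ ts ⟧ d))

    swap₁ : ∀ {K r s t ts b} → Conf K (r ∷ s ∷ t ∷ ts) b → Conf K (r ∷ t ∷ s ∷ ts) b
    swap₁ {r = r} {s} {t} {ts} = reorder (λ d → X.solve 4
        (λ z a b c → z :+ (a :+ (b :+ c)) := z :+ (b :+ (a :+ c))) refl (r ==ᵈ d) (s ==ᵈ d) (t ==ᵈ d) (⟦ ts ⟧ d))

    swap₂ : ∀ {K q r s t ts b} → Conf K (q ∷ r ∷ s ∷ t ∷ ts) b → Conf K (q ∷ r ∷ t ∷ s ∷ ts) b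
    swap₂ {q = q} {r} {s} {t} {ts} = reorder
        (λ d → X.solve 5 (λ w z a b c → w :+ (z :+ (a :+ (b :+ c))) := w :+ (z :+ (b :+ (a :+ c)))) refl (q ==ᵈ d)
        (r ==ᵈ d) (s ==ᵈ d) (t ==ᵈ d) (⟦ ts ⟧ d))

    bond : ∀ {K L c c′ ts us a b} → op c ≡ c′ → Balanced c → proj₁ c ∈ K → proj₁ c′ ∈ L →
      Conf K (c ∷ ts) a → Conf L (c′ ∷ us) b → a ∧ b ≡ false → Conf (K ⊎ᵛ L) (ts ++ us) (a ∨ b)
    bond {K} {L} {c} {c′} {ts} {us} e bal p q C D ab =
      absorb e (∈-left K L p) (∈-right K L q) bal (reorder shift (glue C D ab))
      where
      shift : ∀ d → ⟦ (c ∷ ts) ++ (c′ ∷ us) ⟧ d ≡ ⟦ c ∷ c′ ∷ ts ++ us ⟧ d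
      shift d = trans (cong ((c ==ᵈ d) xor_) (⟦++⟧ ts (c′ ∷ us) d)) (trans
        (X.solve 4 (λ a b t u → a :+ (t :+ (b :+ u)) := a :+ (b :+ (t :+ u))) refl (c ==ᵈ d) (c′ ==ᵈ d) (⟦ ts ⟧ d) (⟦ us ⟧ d))
        (sym (cong (λ z → (c ==ᵈ d) xor ((c′ ==ᵈ d) xor z)) (⟦++⟧ ts us d))))

    -- `O` says where a leaving dart may start: anywhere in a blob, but only at outer vertices of a
    -- tree. The field `one` is factor-criticality. Darts leave only formally: their other ends may
    -- lie in `K`, and two of them may coincide or form an edge, which is how an unbalanced edge is
    -- later put to use.
    record Piece (K : VSet) (O : V → Set) : Set where
      field
        one   : ∀ t → O (proj₁ t) → Conf K (t ∷ []) false
        three : ∀ t u v → O (proj₁ t) → O (proj₁ u) → O (proj₁ v) → Conf K (t ∷ u ∷ v ∷ []) true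

    open Piece

    Blob : VSet → Set
    Blob K = Piece K (_∈ K)

    One : VSet → Dart → Dart → Dart → Set
    One Y l r t =
      (Conf Y (l ∷ t ∷ []) false × Conf Y (r ∷ t ∷ []) true) ⊎
      (Conf Y (l ∷ t ∷ []) true × Conf Y (r ∷ t ∷ []) false)

    Two : VSet → Dart → Dart → Dart → Dart → Set
    Two Y l r t u =
      Conf Y (t ∷ u ∷ []) false ⊎
      (Conf Y (t ∷ u ∷ []) true × Conf Y (l ∷ r ∷ t ∷ u ∷ []) true) ⊎
      Conf Y (l ∷ r ∷ t ∷ u ∷ []) false

    -- Two costs with sum at most 3 cannot both exceed 1.
    Three : VSet → Dart → Dart → Dart → Dart → Dart → Set
    Three Y l r t u v = Conf Y (l ∷ t ∷ u ∷ v ∷ []) true ⊎ Conf Y (r ∷ t ∷ u ∷ v ∷ []) true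

    -- What an even chain of blobs can do when some of its two ends l, r and k other darts leave it:
    -- each parity-admissible choice of ends has a cost (the number of vertices of degree 3), and the
    -- costs of the two choices add up to at most k.
    record EvenChain (Y : VSet) (l r : Dart) : Set where
      field
        closed : Conf Y [] false
        open′  : Conf Y (l ∷ r ∷ []) false
        one    : ∀ t → proj₁ t ∈ Y → One Y l r t
        two    : ∀ t u → proj₁ t ∈ Y → proj₁ u ∈ Y → Two Y l r t u
        three  : ∀ t u v → proj₁ t ∈ Y → proj₁ u ∈ Y → proj₁ v ∈ Y → Three Y l r t u v

    module EC = EvenChain

    swapTwo : ∀ {Y l r t u} → Two Y l r t u → Two Y l r u t
    swapTwo (inj₁ C) = inj₁ (swap₀ C)
    swapTwo (inj₂ (inj₁ (C , D))) = inj₂ (inj₁ (swap₀ C , swap₂ D))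
    swapTwo (inj₂ (inj₂ D)) = inj₂ (inj₂ (swap₂ D))

    swapThree₁ : ∀ {Y l r t u v} → Three Y l r t u v → Three Y l r u t v
    swapThree₁ (inj₁ C) = inj₁ (swap₁ C)
    swapThree₁ (inj₂ C) = inj₂ (swap₁ C)

    swapThree₂ : ∀ {Y l r t u v} → Three Y l r t u v → Three Y l r t v u
    swapThree₂ (inj₁ C) = inj₁ (swap₂ C)
    swapThree₂ (inj₂ C) = inj₂ (swap₂ C)

    front₃ : ∀ {K t u v r b} → Conf K (t ∷ u ∷ v ∷ r ∷ []) b → Conf K (r ∷ t ∷ u ∷ v ∷ []) b
    front₃ C = swap₀ (swap₁ (swap₂ C))

    front₂ : ∀ {K t u r ts b} → Conf K (t ∷ u ∷ r ∷ ts) b → Conf K (r ∷ t ∷ u ∷ ts) b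
    front₂ C = swap₀ (swap₁ C)

    -- The chain is the list of leaving darts itself. Equal darts cancel in pairs, so the degree
    -- stays odd, and `s` is the only vertex where it can be 3.
    singleton : ∀ s → Blob ⁅ s ⁆
    singleton s = record
      { one   = λ t p → build (t ∷ []) (∈⁅⁆ s p , tt) refl (λ f _ → one-dart (proj₂ t) (proj₁ t == f))
      ; three = λ t u v p q r → build (t ∷ u ∷ v ∷ []) (∈⁅⁆ s p , ∈⁅⁆ s q , ∈⁅⁆ s r , tt) refl
          (λ f g e e′ _ _ → trans (sym (single f e)) (single g e′)) }
      where
      single : ∀ f → ⁅ s ⁆ f ≡ 1 → s ≡ f
      single f e = ∈⁅⁆ s (subst (1 ≤_) (sym e) (s≤s z≤n))
      hit : ∀ j → sumB (λ i → (s , j) ==ᵈ (s , i)) ≡ true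
      hit j = trans (sumB-cong {3} (λ i → trans (cong (_∧ (j == i)) (==-refl s)) (if-true (j == i)))) (BS.sum-== j (λ _ → true))
      AtS : List Dart → Set
      AtS [] = ⊤
      AtS (t ∷ ts) = s ≡ proj₁ t × AtS ts
      parity-⟦⟧ : ∀ ts → AtS ts → parity ⟦ ts ⟧ s ≡ par (length ts)
      parity-⟦⟧ [] a = refl
      parity-⟦⟧ ((_ , j) ∷ ts) (refl , a) =
        trans (sumB-distrib {3} (λ i → (s , j) ==ᵈ (s , i)) (λ i → ⟦ ts ⟧ (s , i))) (cong₂ _xor_ (hit j) (parity-⟦⟧ ts a))
      ι-zero : ∀ b → ι b ≡ 0 → b ≡ false
      ι-zero false e = refl
      vanish : ∀ ts → AtS ts → ∀ f i → ⁅ s ⁆ f ≡ 0 → ⟦ ts ⟧ (f , i) ≡ false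
      vanish [] a f i e = refl
      vanish ((_ , j) ∷ ts) (refl , a) f i e = cong₂ _xor_ (cong (_∧ (j == i)) (ι-zero (s == f) e)) (vanish ts a f i e)
      one-dart : ∀ (i : Fin 3) b → ((b ∧ (i == zero)) xor false) ∧
          (((b ∧ (i == suc zero)) xor false) ∧ ((b ∧ (i == suc (suc zero))) xor false)) ≡ false
      one-dart zero false = refl
      one-dart zero true = refl
      one-dart (suc zero) false = refl
      one-dart (suc zero) true = refl
      one-dart (suc (suc zero)) false = refl
      one-dart (suc (suc zero)) true = refl
      build : ∀ ts {b} → AtS ts → par (length ts) ≡ true → Few b ⁅ s ⁆ (bad ⟦ ts ⟧) → Conf ⁅ s ⁆ ts b
      build ts a o few = record { y = ⟦ ts ⟧ ; out = vanish ts a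
        ; odd = λ f p → subst (λ g → parity ⟦ ts ⟧ g ≡ true) (single f p) (trans (parity-⟦⟧ ts a) o) ; few = few
        ; symm = λ d → trans (xor-same (⟦ ts ⟧ (op d))) (sym (xor-same (⟦ ts ⟧ d)))
        ; cons = λ d p → contradiction (trans (sym p) (xor-same (⟦ ts ⟧ d))) λ () }

    flipChain : ∀ {Y l r} → EvenChain Y l r → EvenChain Y r l
    flipChain {Y} {l} {r} E = record
      { closed = EC.closed E ; open′ = swap₀ (EC.open′ E)
      ; one = λ t p → one′ (EC.one E t p) ; two = λ t u p q → two′ (EC.two E t u p q) ; three = λ t u v p q r → three′
          (EC.three E t u v p q r) }
      where
      one′ : ∀ {t} → One Y l r t → One Y r l t
      one′ (inj₁ (C , D)) = inj₂ (D , C)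
      one′ (inj₂ (C , D)) = inj₁ (D , C)
      two′ : ∀ {t u} → Two Y l r t u → Two Y r l t u
      two′ (inj₁ C) = inj₁ C
      two′ (inj₂ (inj₁ (C , D))) = inj₂ (inj₁ (C , swap₀ D))
      two′ (inj₂ (inj₂ D)) = inj₂ (inj₂ (swap₀ D))
      three′ : ∀ {t u v} → Three Y l r t u v → Three Y r l t u v
      three′ (inj₁ C) = inj₂ C
      three′ (inj₂ C) = inj₁ C

  -- Joining blobs into chains, rings and trees.

  module Surgery (α : Chain) (β : V → Bool) where
    open Configurations α β
    open Piece

    -- Each blob has to emit an odd number of darts. The edge `c` and the ends `l`, `r` correct the
    -- parity, and a blob that emits three darts pays at most one vertex of degree 3.
    pair : ∀ {K L l r c c′} → op c ≡ c′ → Balanced c → proj₁ c ∈ K → proj₁ c′ ∈ L → proj₁ l ∈ K → proj₁ r ∈ L →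
      Blob K → Blob L → EvenChain (K ⊎ᵛ L) l r
    pair {K} {L} {l} {r} {c} {c′} e bal p p′ lK rL A B = record
      { closed = bd (one A c p) (one B c′ p′) refl
      ; open′  = glue (one A l lK) (one B r rL) refl
      ; one    = λ t q → one′ t (∈-split K L q)
      ; two    = λ t u q q′ → two′ t u (∈-split K L q) (∈-split K L q′)
      ; three  = λ t u v q q′ q″ → by-sides {λ t → proj₁ t ∈ K} {λ t → proj₁ t ∈ L} {Three Y l r} swapThree₁ swapThree₂
          KKK KKL KLL LLL t u v (∈-split K L q) (∈-split K L q′) (∈-split K L q″) }
      where
      Y : VSet
      Y = K ⊎ᵛ L
      bd : ∀ {ts us a b} → Conf K (c ∷ ts) a → Conf L (c′ ∷ us) b → a ∧ b ≡ false → Conf Y (ts ++ us) (a ∨ b)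
      bd = bond e bal p p′
      one′ : ∀ t → proj₁ t ∈ K ⊎ proj₁ t ∈ L → One Y l r t
      one′ t (inj₁ q) = inj₂ (bd (three A c l t p lK q) (one B c′ p′) refl , swap₀ (glue (one A t q) (one B r rL) refl))
      one′ t (inj₂ q) = inj₁ (glue (one A l lK) (one B t q) refl , bd (one A c p) (three B c′ r t p′ rL q) refl)
      two′ : ∀ t u → proj₁ t ∈ K ⊎ proj₁ t ∈ L → proj₁ u ∈ K ⊎ proj₁ u ∈ L → Two Y l r t u
      two′ t u (inj₁ q) (inj₁ q′) = inj₂ (inj₁ (bd (three A c t u p q q′) (one B c′ p′) refl ,
        swap₁ (swap₂ (glue (three A l t u lK q q′) (one B r rL) refl))))
      two′ t u (inj₁ q) (inj₂ q′) = inj₁ (glue (one A t q) (one B u q′) refl)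
      two′ t u (inj₂ q) (inj₁ q′) = inj₁ (swap₀ (glue (one A u q′) (one B t q) refl))
      two′ t u (inj₂ q) (inj₂ q′) = inj₂ (inj₁ (bd (one A c p) (three B c′ t u p′ q q′) refl ,
        glue (one A l lK) (three B r t u rL q q′) refl))
      KKL : ∀ t u v → proj₁ t ∈ K → proj₁ u ∈ K → proj₁ v ∈ L → Three Y l r t u v
      KKL t u v q q′ q″ = inj₁ (glue (three A l t u lK q q′) (one B v q″) refl)
      KLL : ∀ t u v → proj₁ t ∈ K → proj₁ u ∈ L → proj₁ v ∈ L → Three Y l r t u v
      KLL t u v q q′ q″ = inj₂ (swap₀ (glue (one A t q) (three B r u v rL q′ q″) refl))
      KKK : ∀ t u v → proj₁ t ∈ K → proj₁ u ∈ K → proj₁ v ∈ K → Three Y l r t u v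
      KKK t u v q q′ q″ = inj₂ (front₃ (glue (three A t u v q q′ q″) (one B r rL) refl))
      LLL : ∀ t u v → proj₁ t ∈ L → proj₁ u ∈ L → proj₁ v ∈ L → Three Y l r t u v
      LLL t u v q q′ q″ = inj₁ (glue (one A l lK) (three B t u v q q′ q″) refl)

    -- A choice of ends for the whole chain determines by parity whether the edge `c` is used, hence
    -- a choice of ends in each half. The two choices for the whole induce opposite choices in both
    -- halves, so the cost bounds of the halves add.
    concatenate : ∀ {Y Z l c c′ r} → op c ≡ c′ → Balanced c → proj₁ c ∈ Y → proj₁ c′ ∈ Z →
      EvenChain Y l c → EvenChain Z c′ r → EvenChain (Y ⊎ᵛ Z) l r
    concatenate {Y} {Z} {l} {c} {c′} {r} e bal p p′ A B = record
      { closed = glue (EC.closed A) (EC.closed B) refl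
      ; open′  = bd cl (EC.open′ B) refl
      ; one    = λ t q → one′ t (∈-split Y Z q)
      ; two    = λ t u q q′ → two′ t u (∈-split Y Z q) (∈-split Y Z q′)
      ; three  = λ t u v q q′ q″ → by-sides {λ t → proj₁ t ∈ Y} {λ t → proj₁ t ∈ Z} {Three W l r} swapThree₁ swapThree₂
          YYY YYZ YZZ ZZZ t u v (∈-split Y Z q) (∈-split Y Z q′) (∈-split Y Z q″) }
      where
      W : VSet
      W = Y ⊎ᵛ Z
      bd : ∀ {ts us a b} → Conf Y (c ∷ ts) a → Conf Z (c′ ∷ us) b → a ∧ b ≡ false → Conf W (ts ++ us) (a ∨ b)
      bd = bond e bal p p′
      cl : Conf Y (c ∷ l ∷ []) false
      cl = swap₀ (EC.open′ A)
      ∅Y : Conf Y [] false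
      ∅Y = EC.closed A
      ∅Z : Conf Z [] false
      ∅Z = EC.closed B
      c′r : Conf Z (c′ ∷ r ∷ []) false
      c′r = EC.open′ B
      one′ : ∀ t → proj₁ t ∈ Y ⊎ proj₁ t ∈ Z → One W l r t
      one′ t (inj₁ q) with EC.one A t q
      ... | inj₁ (C , D) = inj₁ (glue C ∅Z refl , swap₀ (bd D c′r refl))
      ... | inj₂ (C , D) = inj₂ (glue C ∅Z refl , swap₀ (bd D c′r refl))
      one′ t (inj₂ q) with EC.one B t q
      ... | inj₁ (C , D) = inj₁ (bd cl C refl , glue ∅Y D refl)
      ... | inj₂ (C , D) = inj₂ (bd cl C refl , glue ∅Y D refl)
      YZ : ∀ t u → proj₁ t ∈ Y → proj₁ u ∈ Z → Two W l r t u
      YZ t u q q′ with EC.one A t q | EC.one B u q′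
      ... | inj₁ (C , D) | inj₁ (C′ , D′) = inj₂ (inj₁ (bd D C′ refl , swap₁ (glue C D′ refl)))
      ... | inj₁ (C , D) | inj₂ (C′ , D′) = inj₂ (inj₂ (swap₁ (glue C D′ refl)))
      ... | inj₂ (C , D) | inj₁ (C′ , D′) = inj₁ (bd D C′ refl)
      ... | inj₂ (C , D) | inj₂ (C′ , D′) = inj₂ (inj₁ (bd D C′ refl , swap₁ (glue C D′ refl)))
      two′ : ∀ t u → proj₁ t ∈ Y ⊎ proj₁ t ∈ Z → proj₁ u ∈ Y ⊎ proj₁ u ∈ Z → Two W l r t u
      two′ t u (inj₁ q) (inj₁ q′) with EC.two A t u q q′
      ... | inj₁ C = inj₁ (glue C ∅Z refl)
      ... | inj₂ (inj₁ (C , D)) = inj₂ (inj₁ (glue C ∅Z refl , swap₁ (swap₂ (bd (swap₀ D) c′r refl))))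
      ... | inj₂ (inj₂ D) = inj₂ (inj₂ (swap₁ (swap₂ (bd (swap₀ D) c′r refl))))
      two′ t u (inj₁ q) (inj₂ q′) = YZ t u q q′
      two′ t u (inj₂ q) (inj₁ q′) = swapTwo (YZ u t q′ q)
      two′ t u (inj₂ q) (inj₂ q′) with EC.two B t u q q′
      ... | inj₁ C = inj₁ (glue ∅Y C refl)
      ... | inj₂ (inj₁ (C , D)) = inj₂ (inj₁ (glue ∅Y C refl , bd cl D refl))
      ... | inj₂ (inj₂ D) = inj₂ (inj₂ (bd cl D refl))
      YYZ : ∀ t u v → proj₁ t ∈ Y → proj₁ u ∈ Y → proj₁ v ∈ Z → Three W l r t u v
      YYZ t u v q q′ q″ with EC.two A t u q q′ | EC.one B v q″
      ... | inj₁ C | inj₁ (_ , D) = inj₂ (front₂ (glue C D refl))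
      ... | inj₁ C | inj₂ (_ , D) = inj₂ (front₂ (glue C (weaken false D) refl))
      ... | inj₂ (inj₁ (_ , C)) | inj₁ (D , _) = inj₁ (bd (swap₀ C) D refl)
      ... | inj₂ (inj₁ (C , _)) | inj₂ (_ , D) = inj₂ (front₂ (glue C D refl))
      ... | inj₂ (inj₂ C) | inj₁ (D , _) = inj₁ (bd (swap₀ C) (weaken false D) refl)
      ... | inj₂ (inj₂ C) | inj₂ (D , _) = inj₁ (bd (swap₀ C) D refl)
      YZZ : ∀ t u v → proj₁ t ∈ Y → proj₁ u ∈ Z → proj₁ v ∈ Z → Three W l r t u v
      YZZ t u v q q′ q″ with EC.one A t q | EC.two B u v q′ q″
      ... | inj₁ (C , _) | inj₁ D = inj₁ (glue (weaken false C) D refl)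
      ... | inj₂ (C , _) | inj₁ D = inj₁ (glue C D refl)
      ... | inj₁ (C , _) | inj₂ (inj₁ (D , _)) = inj₁ (glue C D refl)
      ... | inj₂ (_ , C) | inj₂ (inj₁ (_ , D)) = inj₂ (swap₀ (bd C D refl))
      ... | inj₁ (_ , C) | inj₂ (inj₂ D) = inj₂ (swap₀ (bd C D refl))
      ... | inj₂ (_ , C) | inj₂ (inj₂ D) = inj₂ (swap₀ (bd (weaken false C) D refl))
      YYY : ∀ t u v → proj₁ t ∈ Y → proj₁ u ∈ Y → proj₁ v ∈ Y → Three W l r t u v
      YYY t u v q q′ q″ with EC.three A t u v q q′ q″
      ... | inj₁ C = inj₁ (glue C ∅Z refl)
      ... | inj₂ C = inj₂ (front₃ (bd C c′r refl))
      ZZZ : ∀ t u v → proj₁ t ∈ Z → proj₁ u ∈ Z → proj₁ v ∈ Z → Three W l r t u v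
      ZZZ t u v q q′ q″ with EC.three B t u v q q′ q″
      ... | inj₁ C = inj₁ (bd cl C refl)
      ... | inj₂ C = inj₂ (glue ∅Y C refl)

    -- Contracting a blossom.
    ring : ∀ {K Y l r} → Blob K → EvenChain Y l r → proj₁ l ∈ Y → proj₁ r ∈ Y → proj₁ (op l) ∈ K → proj₁ (op r) ∈ K →
      Balanced l → Balanced r → Blob (K ⊎ᵛ Y)
    ring {K} {Y} {l} {r} A E lY rY lK rK bl br = record
      { one = λ t q → one′ t (∈-split K Y q)
      ; three = λ t u v q q′ q″ → by-sides {λ t → proj₁ t ∈ K} {λ t → proj₁ t ∈ Y} {λ t u v → Conf W
          (t ∷ u ∷ v ∷ []) true} swap₀ swap₁
          (λ t u v q q′ q″ → glue (three A t u v q q′ q″) (EC.closed E) refl) KKY KYY YYY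
          t u v (∈-split K Y q) (∈-split K Y q′) (∈-split K Y q″) }
      where
      W : VSet
      W = K ⊎ᵛ Y
      bl′ : ∀ {ts us a b} → Conf K (op l ∷ ts) a → Conf Y (l ∷ us) b → a ∧ b ≡ false → Conf W (ts ++ us) (a ∨ b)
      bl′ = bond (op-op l) (Balanced-op bl) lK lY
      br′ : ∀ {ts us a b} → Conf K (op r ∷ ts) a → Conf Y (r ∷ us) b → a ∧ b ≡ false → Conf W (ts ++ us) (a ∨ b)
      br′ = bond (op-op r) (Balanced-op br) rK rY
      one′ : ∀ t → proj₁ t ∈ K ⊎ proj₁ t ∈ Y → Conf W (t ∷ []) false
      one′ t (inj₁ q) = glue (one A t q) (EC.closed E) refl
      one′ t (inj₂ q) with EC.one E t q
      ... | inj₁ (C , _) = bl′ (one A (op l) lK) C refl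
      ... | inj₂ (_ , C) = br′ (one A (op r) rK) C refl
      KKY : ∀ t u v → proj₁ t ∈ K → proj₁ u ∈ K → proj₁ v ∈ Y → Conf W (t ∷ u ∷ v ∷ []) true
      KKY t u v q q′ q″ with EC.one E v q″
      ... | inj₁ (C , _) = bl′ (three A (op l) t u lK q q′) C refl
      ... | inj₂ (_ , C) = br′ (three A (op r) t u rK q q′) C refl
      KYY : ∀ t u v → proj₁ t ∈ K → proj₁ u ∈ Y → proj₁ v ∈ Y → Conf W (t ∷ u ∷ v ∷ []) true
      KYY t u v q q′ q″ with EC.two E u v q′ q″
      ... | inj₁ C = weaken false (glue (one A t q) C refl)
      ... | inj₂ (inj₁ (C , _)) = glue (one A t q) C refl
      -- Here the chain is free of cost only if both ends are used: `K` then emits three darts and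
      -- pays. `bl′` joins the two sets along `l`, after which both darts of the edge at `r` leave
      -- the union and are absorbed.
      ... | inj₂ (inj₂ C) = absorb (op-op r) (∈-left K Y rK) (∈-right K Y rY) (Balanced-op br)
            (swap₁ (bl′ (three A (op l) (op r) t lK rK q) C refl))
      YYY : ∀ t u v → proj₁ t ∈ Y → proj₁ u ∈ Y → proj₁ v ∈ Y → Conf W (t ∷ u ∷ v ∷ []) true
      YYY t u v q q′ q″ with EC.three E t u v q q′ q″
      ... | inj₁ C = bl′ (one A (op l) lK) C refl
      ... | inj₂ C = br′ (one A (op r) rK) C refl

    -- The link `s` is matched to the side that would otherwise emit an even number of darts: to
    -- `X′` by its dart `j`, or to `X` by its dart `i`. At most one of the two pieces then emits
    -- three darts.
    join : ∀ {X X′ O O′} s i j → Piece X O → Piece X′ O′ → (∀ {f} → O f → f ∈ X) → (∀ {f} → O′ f → f ∈ X′) →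
      O (proj₁ (op (s , i))) → O′ (proj₁ (op (s , j))) → Balanced (s , i) → Balanced (s , j) →
      Piece (X ⊎ᵛ (⁅ s ⁆ ⊎ᵛ X′)) (λ f → O f ⊎ O′ f)
    join {X} {X′} {O} {O′} s i j A B inX inX′ Oc Oc′ bal bal′ = record
      { one = one′
      ; three = by-sides {λ t → O (proj₁ t)} {λ t → O′ (proj₁ t)} {λ t u v → Conf W (t ∷ u ∷ v ∷ []) true} swap₀ swap₁
          (λ t u v q q′ q″ → glue (three A t u v q q′ q″) Z₀ refl) XXX′ XX′X′ X′X′X′ }
      where
      Z : VSet
      Z = ⁅ s ⁆ ⊎ᵛ X′
      W : VSet
      W = X ⊎ᵛ Z
      c c′ a a′ : Dart
      c  = s , i
      c′ = s , j
      a  = op c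
      a′ = op c′
      S : Blob ⁅ s ⁆
      S = singleton s
      bd : ∀ {ts us b b′} → Conf X (a ∷ ts) b → Conf Z (c ∷ us) b′ → b ∧ b′ ≡ false → Conf W (ts ++ us) (b ∨ b′)
      bd = bond (op-op c) (Balanced-op bal) (inX Oc) (∈-left ⁅ s ⁆ X′ (∈-self s))
      bd′ : ∀ {ts us b b′} → Conf ⁅ s ⁆ (c′ ∷ ts) b → Conf X′ (a′ ∷ us) b′ → b ∧ b′ ≡ false → Conf Z (ts ++ us) (b ∨ b′)
      bd′ = bond refl bal′ (∈-self s) (inX′ Oc′)
      Z₀ : Conf Z [] false
      Z₀ = bd′ (one S c′ (∈-self s)) (one B a′ Oc′) refl
      Z₁ : ∀ t → O′ (proj₁ t) → Conf Z (c ∷ t ∷ []) false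
      Z₁ t q = glue (one S c (∈-self s)) (one B t q) refl
      one′ : ∀ t → O (proj₁ t) ⊎ O′ (proj₁ t) → Conf W (t ∷ []) false
      one′ t (inj₁ q) = glue (one A t q) Z₀ refl
      one′ t (inj₂ q) = bd (one A a Oc) (Z₁ t q) refl
      XXX′ : ∀ t u v → O (proj₁ t) → O (proj₁ u) → O′ (proj₁ v) → Conf W (t ∷ u ∷ v ∷ []) true
      XXX′ t u v q q′ q″ = bd (three A a t u Oc q q′) (Z₁ v q″) refl
      XX′X′ : ∀ t u v → O (proj₁ t) → O′ (proj₁ u) → O′ (proj₁ v) → Conf W (t ∷ u ∷ v ∷ []) true
      XX′X′ t u v q q′ q″ = glue (one A t q) (bd′ (one S c′ (∈-self s)) (three B a′ u v Oc′ q′ q″) refl) refl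
      X′X′X′ : ∀ t u v → O′ (proj₁ t) → O′ (proj₁ u) → O′ (proj₁ v) → Conf W (t ∷ u ∷ v ∷ []) true
      X′X′X′ t u v q q′ q″ = bd (one A a Oc) (glue (one S c (∈-self s)) (three B t u v q q′ q″) refl) refl

  -- Alternating trees

  data Forest : Set

  -- A blob together with the links hanging from it; the link  branch s i j t  is the vertex s, joined
  -- to the parent blob by its dart i and to the root blob of t by its dart j.
  data Tree : Set where
    node : VSet → Forest → Tree

  data Forest where
    ∅      : Forest
    branch : V → Fin 3 → Fin 3 → Tree → Forest → Forest

  root : Tree → VSet
  root (node K F) = K

  occF : Forest → VSet

  occ : Tree → VSet
  occ (node K F) = K ⊎ᵛ occF F

  occF ∅ f = 0
  occF (branch s i j t F) f = (⁅ s ⁆ f + occ t f) + occF F f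

  #blobsF : Forest → ℕ

  #blobs : Tree → ℕ
  #blobs (node K F) = suc (#blobsF F)

  #blobsF ∅ = 0
  #blobsF (branch s i j t F) = #blobs t + #blobsF F

  _⊙_ : Forest → Forest → Forest
  ∅ ⊙ G = G
  branch s i j t F ⊙ G = branch s i j t (F ⊙ G)

  occ-⊙ : ∀ F G f → occF (F ⊙ G) f ≡ occF F f + occF G f
  occ-⊙ ∅ G f = refl
  occ-⊙ (branch s i j t F) G f = trans (cong ((⁅ s ⁆ f + occ t f) +_) (occ-⊙ F G f)) (sym (ℕP.+-assoc (⁅ s ⁆ f + occ t f) _ _))

  #blobs-⊙ : ∀ F G → #blobsF (F ⊙ G) ≡ #blobsF F + #blobsF G
  #blobs-⊙ ∅ G = refl
  #blobs-⊙ (branch s i j t F) G = trans (cong (#blobs t +_) (#blobs-⊙ F G)) (sym (ℕP.+-assoc (#blobs t) _ _))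

  data OuterF (f : V) : Forest → Set

  -- The even vertices of an alternating tree: those in a blob, as opposed to the links.
  data Outer (f : V) : Tree → Set where
    here  : ∀ {K F} → f ∈ K → Outer f (node K F)
    below : ∀ {K F} → OuterF f F → Outer f (node K F)

  data OuterF f where
    this : ∀ {s i j t F} → Outer f t → OuterF f (branch s i j t F)
    that : ∀ {s i j t F} → OuterF f F → OuterF f (branch s i j t F)

  Outer⇒occ : ∀ {f t} → Outer f t → f ∈ occ t

  OuterF⇒occ : ∀ {f F} → OuterF f F → f ∈ occF F
  OuterF⇒occ {f} {branch s i j t F} (this p) = ∈-left (⁅ s ⁆ ⊎ᵛ occ t) (occF F) (∈-right ⁅ s ⁆ (occ t) (Outer⇒occ p))
  OuterF⇒occ {f} {branch s i j t F} (that p) = ∈-right (⁅ s ⁆ ⊎ᵛ occ t) (occF F) (OuterF⇒occ p)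

  Outer⇒occ {f} {node K F} (here p) = ∈-left K (occF F) p
  Outer⇒occ {f} {node K F} (below p) = ∈-right K (occF F) (OuterF⇒occ p)

  outerF? : ∀ f F → Dec (OuterF f F)

  outer? : ∀ f t → Dec (Outer f t)
  outer? f (node K F) with 1 ℕP.≤? K f | outerF? f F
  ... | yes p | _ = yes (here p)
  ... | no p | yes q = yes (below q)
  ... | no p | no q = no λ { (here r) → p r ; (below r) → q r }

  outerF? f ∅ = no λ ()
  outerF? f (branch s i j t F) with outer? f t | outerF? f F
  ... | yes p | _ = yes (this p)
  ... | no p | yes q = yes (that q)
  ... | no p | no q = no λ { (this r) → p r ; (that r) → q r }

  root-outer : ∀ t {f} → f ∈ root t → Outer f t
  root-outer (node K F) p = here p

  data SameBlobF (f g : V) : Forest → Set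

  data SameBlob (f g : V) : Tree → Set where
    here  : ∀ {K F} → f ∈ K → g ∈ K → SameBlob f g (node K F)
    below : ∀ {K F} → SameBlobF f g F → SameBlob f g (node K F)

  data SameBlobF f g where
    this : ∀ {s i j t F} → SameBlob f g t → SameBlobF f g (branch s i j t F)
    that : ∀ {s i j t F} → SameBlobF f g F → SameBlobF f g (branch s i j t F)

  module Search (α : Chain) (β : V → Bool) where
    open Configurations α β
    open Surgery α β

    data ValidF (K : VSet) : Forest → Set

    data Valid : Tree → Set where
      valid : ∀ {K F} → Blob K → ValidF K F → Valid (node K F)

    data ValidF K where
      ∅      : ValidF K ∅
      branch : ∀ {s i j t F} → proj₁ (op (s , i)) ∈ K → Balanced (s , i) →
               proj₁ (op (s , j)) ∈ root t → Balanced (s , j) → Valid t → ValidF K F → ValidF K (branch s i j t F)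

    ValidF-mono : ∀ {K L F} → (∀ f → f ∈ K → f ∈ L) → ValidF K F → ValidF L F
    ValidF-mono h ∅ = ∅
    ValidF-mono h (branch a b c d e v) = branch (h _ a) b c d e (ValidF-mono h v)

    ValidF-⊙ : ∀ {K F G} → ValidF K F → ValidF K G → ValidF K (F ⊙ G)
    ValidF-⊙ ∅ w = w
    ValidF-⊙ (branch a b c d e v) w = branch a b c d e (ValidF-⊙ v w)

    piece-resp : ∀ {K L O P} → (∀ f → K f ≡ L f) → (∀ f → P f → O f) → Piece K O → Piece L P
    piece-resp e h A = record { one = λ t p → Conf-resp e (λ _ → refl) (Piece.one A t (h _ p))
      ; three = λ t u v p q r → Conf-resp e (λ _ → refl) (Piece.three A t u v (h _ p) (h _ q) (h _ r)) }

    -- With respect to its outer vertices a whole tree behaves like a blob. This replaces exchanging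
    -- along explicit alternating paths.
    treePiece : ∀ {t} → Valid t → Piece (occ t) (λ f → Outer f t)

    forestPiece : ∀ {K F X O} → ValidF K F → Piece X O → (∀ f → O f → f ∈ X) → (∀ f → f ∈ K → O f) →
      Piece (X ⊎ᵛ occF F) (λ f → O f ⊎ OuterF f F)
    forestPiece {F = ∅} ∅ A inX KO = piece-resp (λ f → sym (ℕP.+-identityʳ _)) (λ { f (inj₁ p) → p ; f (inj₂ ()) }) A
    forestPiece {F = branch s i j t F} {X} {O} (branch a b c d e v) A inX KO =
      piece-resp (λ f → ℕP.+-assoc (X f) _ (occF F f)) sortO
        (forestPiece v (join s i j A (treePiece e) (inX _) Outer⇒occ (KO _ a) (root-outer t c) b d) inX′
            (λ f p → inj₁ (KO f p)))
      where
      inX′ : ∀ f → O f ⊎ Outer f t → f ∈ (X ⊎ᵛ (⁅ s ⁆ ⊎ᵛ occ t))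
      inX′ f (inj₁ p) = ∈-left X (⁅ s ⁆ ⊎ᵛ occ t) (inX f p)
      inX′ f (inj₂ p) = ∈-right X (⁅ s ⁆ ⊎ᵛ occ t) (∈-right ⁅ s ⁆ (occ t) (Outer⇒occ p))
      sortO : ∀ f → O f ⊎ OuterF f (branch s i j t F) → (O f ⊎ Outer f t) ⊎ OuterF f F
      sortO f (inj₁ p) = inj₁ (inj₁ p)
      sortO f (inj₂ (this p)) = inj₁ (inj₂ p)
      sortO f (inj₂ (that p)) = inj₂ p

    treePiece {node K F} (valid A v) = piece-resp (λ _ → refl) (λ { f (here p) → inj₁ p ; f (below p) → inj₂ p })
      (forestPiece v A (λ f p → p) (λ f p → p))

    -- A chain of blobs and links hanging from K by its end l and ending in the blob of the vertex
    -- of e, cut out of the forest F; what is left of F hangs from K and the chain.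
    record Branchlet (K : VSet) (F : Forest) (e : Dart) : Set where
      field
        {l}   : Dart
        {Y}   : VSet
        {G}   : Forest
        chain : EvenChain Y l e
        l∈Y   : proj₁ l ∈ Y
        e∈Y   : proj₁ e ∈ Y
        l↑    : proj₁ (op l) ∈ K
        l-bal : Balanced l
        rest  : ValidF (K ⊎ᵛ Y) G
        same  : ∀ f → Y f + occF G f ≡ occF F f
        less  : #blobsF G < #blobsF F

    -- Each level on the way down contributes one `pair`, the link as a singleton blob and the blob
    -- below it, which makes the chain even. The branches passed on the way hang from the chain or
    -- from `K`, and are kept in `G`.
    cut : ∀ {K F e} → ValidF K F → OuterF (proj₁ e) F → Branchlet K F e
    cut {K} {branch s i j (node L H) F} {e} (branch a b c d (valid A v) w) (this (here p)) = record
      { chain = pair refl d (∈-self s) c (∈-self s) p (singleton s) A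
      ; l∈Y = ∈-left ⁅ s ⁆ L (∈-self s) ; e∈Y = ∈-right ⁅ s ⁆ L p ; l↑ = a ; l-bal = b
      ; rest = ValidF-⊙ (ValidF-mono (λ f q → ∈-right K (⁅ s ⁆ ⊎ᵛ L) (∈-right ⁅ s ⁆ L q)) v)
                        (ValidF-mono (λ f q → ∈-left K (⁅ s ⁆ ⊎ᵛ L) q) w)
      ; same = λ f → trans (cong (⁅ s ⁆ f + L f +_) (occ-⊙ H F f))
          (N.solve 4 (λ s l h g → (s :⊞ l) :⊞ (h :⊞ g) :≡ (s :⊞ (l :⊞ h)) :⊞ g) refl (⁅ s ⁆ f) (L f) (occF H f) (occF F f))
      ; less = s≤s (ℕP.≤-reflexive (#blobs-⊙ H F)) }
    cut {K} {branch s i j (node L H) F} {e} (branch a b c d (valid A v) w) (this (below p)) = record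
      { chain = concatenate (op-op B.l) (Balanced-op B.l-bal) (∈-right ⁅ s ⁆ L B.l↑) B.l∈Y
          (pair refl d (∈-self s) c (∈-self s) B.l↑ (singleton s) A) B.chain
      ; l∈Y = ∈-left Y₀ B.Y (∈-left ⁅ s ⁆ L (∈-self s)) ; e∈Y = ∈-right Y₀ B.Y B.e∈Y ; l↑ = a ; l-bal = b
      ; rest = ValidF-⊙ (ValidF-mono (λ f q → ∈-right K (Y₀ ⊎ᵛ B.Y) (inY f q)) B.rest)
                        (ValidF-mono (λ f q → ∈-left K (Y₀ ⊎ᵛ B.Y) q) w)
      ; same = λ f → trans (cong ((⁅ s ⁆ f + L f + B.Y f) +_) (occ-⊙ B.G F f))
          (trans (N.solve 5 (λ s l y g h → ((s :⊞ l) :⊞ y) :⊞ (g :⊞ h) :≡ (s :⊞ (l :⊞ (y :⊞ g))) :⊞ h) refl (⁅ s ⁆ f)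
              (L f) (B.Y f) (occF B.G f) (occF F f))
            (cong (λ z → (⁅ s ⁆ f + (L f + z)) + occF F f) (B.same f)))
      ; less = ℕP.≤-trans (s≤s (ℕP.≤-reflexive (#blobs-⊙ B.G F))) (ℕP.+-monoˡ-≤ (#blobsF F) (ℕP.≤-trans B.less (ℕP.n≤1+n _))) }
      where
      module B = Branchlet (cut v p)
      Y₀ : VSet
      Y₀ = ⁅ s ⁆ ⊎ᵛ L
      inY : ∀ f → f ∈ (L ⊎ᵛ B.Y) → f ∈ (Y₀ ⊎ᵛ B.Y)
      inY f q with ∈-split L B.Y q
      ... | inj₁ r = ∈-left Y₀ B.Y (∈-right ⁅ s ⁆ L r)
      ... | inj₂ r = ∈-right Y₀ B.Y r
    cut {K} {branch s i j t F} {e} (branch a b c d u w) (that p) = record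
      { chain = B.chain ; l∈Y = B.l∈Y ; e∈Y = B.e∈Y ; l↑ = B.l↑ ; l-bal = B.l-bal
      ; rest = branch (∈-left K B.Y a) b c d u B.rest
      ; same = λ f → trans (N.solve 3 (λ y t g → y :⊞ (t :⊞ g) :≡ t :⊞ (y :⊞ g)) refl (B.Y f) (⁅ s ⁆ f + occ t f) (occF B.G f))
          (cong ((⁅ s ⁆ f + occ t f) +_) (B.same f))
      ; less = ℕP.≤-trans (ℕP.≤-reflexive (sym (ℕP.+-suc (#blobs t) (#blobsF B.G)))) (ℕP.+-monoʳ-≤ (#blobs t) B.less) }
      where module B = Branchlet (cut w p)

    record Contraction (t : Tree) : Set where
      field
        {t′}  : Tree
        valid′ : Valid t′
        same  : ∀ f → occ t′ f ≡ occ t f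
        less  : #blobs t′ < #blobs t
        roots : ∀ f → f ∈ root t → f ∈ root t′

    -- In the case `ear` the ends of `d` lie in different branches, so the cycle runs through `K`,
    -- which is not part of the forest; the contraction is left to the level above.
    data MergeF (K : VSet) (F : Forest) (d : Dart) : Set where
      same   : SameBlobF (proj₁ d) (proj₁ (op d)) F → MergeF K F d
      inside : ∀ {F′} → ValidF K F′ → (∀ f → occF F′ f ≡ occF F f) → #blobsF F′ < #blobsF F → MergeF K F d
      ear    : ∀ {Y G l r} → EvenChain Y l r → proj₁ l ∈ Y → proj₁ r ∈ Y → proj₁ (op l) ∈ K → proj₁ (op r) ∈ K →
               Balanced l → Balanced r → ValidF (K ⊎ᵛ Y) G → (∀ f → Y f + occF G f ≡ occF F f) → #blobsF G < #blobsF F →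
                   MergeF K F d

    contract : ∀ {K F Y G l r} → Blob K → EvenChain Y l r → proj₁ l ∈ Y → proj₁ r ∈ Y → proj₁ (op l) ∈ K → proj₁ (op r) ∈ K →
      Balanced l → Balanced r → ValidF (K ⊎ᵛ Y) G → (∀ f → Y f + occF G f ≡ occF F f) → #blobsF G < #blobsF F →
          Contraction (node K F)
    contract {K} {F} {Y} {G} A E lY rY lK rK bl br v e n = record
      { valid′ = valid (ring A E lY rY lK rK bl br) v
      ; same = λ f → trans (ℕP.+-assoc (K f) (Y f) (occF G f)) (cong (K f +_) (e f))
      ; less = s≤s n ; roots = λ f p → ∈-left K Y p }

    -- The blossom is closed at the lowest blob whose subtree contains both ends of `d`. It consists
    -- of that blob and an even chain with both ends attached to it, so `ring` applies.
    merge : ∀ {t d} → Valid t → Balanced d → Outer (proj₁ d) t → Outer (proj₁ (op d)) t →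
      SameBlob (proj₁ d) (proj₁ (op d)) t ⊎ Contraction t

    mergeF : ∀ {K F d} → ValidF K F → Balanced d → OuterF (proj₁ d) F → OuterF (proj₁ (op d)) F → MergeF K F d

    ears : ∀ {K s i j t F d} → ValidF K (branch s i j t F) → Balanced d → Outer (proj₁ d) t → OuterF (proj₁ (op d)) F →
      MergeF K (branch s i j t F) d
    ears {K} {s} {i} {j} {t} {F} {d} (branch a b c x u w) bal p q =
      ear (concatenate refl bal B.e∈Y C.e∈Y B.chain (flipChain C.chain)) (∈-left B.Y C.Y B.l∈Y) (∈-right B.Y C.Y C.l∈Y)
        B.l↑ C.l↑ B.l-bal C.l-bal
        (ValidF-⊙ (ValidF-mono left B.rest) (ValidF-mono right C.rest)) same′
        (ℕP.≤-trans (s≤s (ℕP.≤-reflexive (#blobs-⊙ B.G C.G)))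
          (ℕP.+-mono-≤ (ℕP.≤-trans B.less (ℕP.≤-reflexive (ℕP.+-identityʳ _))) (ℕP.<⇒≤ C.less)))
      where
      -- The first chain is cut from the forest consisting of `t` alone, so that the two chains and
      -- their remainders come from separate forests.
      module B = Branchlet (cut {K} {branch s i j t ∅} {d} (branch a b c x u ∅) (this p))
      module C = Branchlet (cut {K} {F} {op d} w q)
      left : ∀ f → f ∈ (K ⊎ᵛ B.Y) → f ∈ (K ⊎ᵛ (B.Y ⊎ᵛ C.Y))
      left f r with ∈-split K B.Y r
      ... | inj₁ k = ∈-left K (B.Y ⊎ᵛ C.Y) k
      ... | inj₂ k = ∈-right K (B.Y ⊎ᵛ C.Y) (∈-left B.Y C.Y k)
      right : ∀ f → f ∈ (K ⊎ᵛ C.Y) → f ∈ (K ⊎ᵛ (B.Y ⊎ᵛ C.Y))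
      right f r with ∈-split K C.Y r
      ... | inj₁ k = ∈-left K (B.Y ⊎ᵛ C.Y) k
      ... | inj₂ k = ∈-right K (B.Y ⊎ᵛ C.Y) (∈-right B.Y C.Y k)
      same′ : ∀ f → (B.Y f + C.Y f) + occF (B.G ⊙ C.G) f ≡ (⁅ s ⁆ f + occ t f) + occF F f
      same′ f = trans (cong ((B.Y f + C.Y f) +_) (occ-⊙ B.G C.G f))
        (trans (N.solve 4 (λ a b c d → (a :⊞ b) :⊞ (c :⊞ d) :≡ (a :⊞ c) :⊞ (b :⊞ d)) refl (B.Y f) (C.Y f) (occF B.G f)
            (occF C.G f))
          (cong₂ _+_ (trans (B.same f) (ℕP.+-identityʳ _)) (C.same f)))

    MergeF-op : ∀ {K F d} → MergeF K F (op d) → MergeF K F d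
    MergeF-op {d = d} (same p) = same (subst (λ z → SameBlobF z (proj₁ (op d)) _) (cong proj₁ (op-op d)) (flipF p))
      where
      flip : ∀ {f g t} → SameBlob f g t → SameBlob g f t
      flipF : ∀ {f g F} → SameBlobF f g F → SameBlobF g f F
      flip (here p q) = here q p
      flip (below p) = below (flipF p)
      flipF (this p) = this (flip p)
      flipF (that p) = that (flipF p)
    MergeF-op (inside v e n) = inside v e n
    MergeF-op (ear E a b c x y z v e n) = ear E a b c x y z v e n

    mergeF {K} {branch s i j t F} {d} (branch a b c x u w) bal (this p) (this q) with merge u bal p q
    ... | inj₁ S = same (this S)
    ... | inj₂ C = inside (branch a b (Contraction.roots C _ c) x (Contraction.valid′ C) w)
          (λ f → cong (λ z → (⁅ s ⁆ f + z) + occF F f) (Contraction.same C f)) (ℕP.+-monoˡ-≤ (#blobsF F) (Contraction.less C))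
    mergeF {d = d} v bal (this p) (that q) = ears v bal p q
    mergeF {d = d} v bal (that p) (this q) = MergeF-op
        (ears {d = op d} v (Balanced-op bal) q (subst (λ e → OuterF (proj₁ e) _) (sym (op-op d)) p))
    mergeF {K} {branch s i j t F} {d} (branch a b c x u w) bal (that p) (that q) with mergeF w bal p q
    ... | same S = same (that S)
    ... | inside v e n = inside (branch a b c x u v) (λ f → cong ((⁅ s ⁆ f + occ t f) +_) (e f)) (ℕP.+-monoʳ-< (#blobs t) n)
    ... | ear {Y} {G} E lY rY lK rK bl br v e n = ear E lY rY lK rK bl br (branch (∈-left K Y a) b c x u v)
          (λ f → trans (N.solve 3 (λ y t g → y :⊞ (t :⊞ g) :≡ t :⊞ (y :⊞ g)) refl (Y f) (⁅ s ⁆ f + occ t f) (occF G f))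
            (cong ((⁅ s ⁆ f + occ t f) +_) (e f))) (ℕP.+-monoʳ-< (#blobs t) n)

    merge (valid A v) bal (here p) (here q) = inj₁ (here p q)
    merge {node K F} {d} (valid A v) bal (here p) (below q) =
      inj₂ (contract A B.chain B.l∈Y B.e∈Y B.l↑ (subst (λ e → proj₁ e ∈ K) (sym (op-op d)) p) B.l-bal
          (Balanced-op bal) B.rest B.same B.less)
      where module B = Branchlet (cut {e = op d} v q)
    merge {node K F} {d} (valid A v) bal (below p) (here q) =
      inj₂ (contract A B.chain B.l∈Y B.e∈Y B.l↑ q B.l-bal bal B.rest B.same B.less)
      where module B = Branchlet (cut {e = d} v p)
    merge {node K F} (valid A v) bal (below p) (below q) with mergeF v bal p q
    ... | same S = inj₁ (below S)
    ... | inside w e n = inj₂ (record { valid′ = valid A w ; same = λ f → cong (K f +_) (e f) ; less = s≤s n ; roots =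
        λ f r → r })
    ... | ear E lY rY lK rK bl br w e n = inj₂ (contract A E lY rY lK rK bl br w e n)

  attachF : ∀ {f F} → OuterF f F → V → Fin 3 → Fin 3 → V → Forest

  attach : ∀ {f t} → Outer f t → V → Fin 3 → Fin 3 → V → Tree
  attach {t = node K F} (here p) w i j x = node K (branch w i j (node ⁅ x ⁆ ∅) F)
  attach {t = node K F} (below p) w i j x = node K (attachF p w i j x)

  attachF {F = branch s a b t F} (this p) w i j x = branch s a b (attach p w i j x) F
  attachF {F = branch s a b t F} (that p) w i j x = branch s a b t (attachF p w i j x)

  occ-attachF : ∀ {f F} (p : OuterF f F) w i j x g → occF (attachF p w i j x) g ≡ occF F g + (⁅ w ⁆ g + ⁅ x ⁆ g)

  occ-attach : ∀ {f t} (p : Outer f t) w i j x g → occ (attach p w i j x) g ≡ occ t g + (⁅ w ⁆ g + ⁅ x ⁆ g)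
  occ-attach {t = node K F} (here p) w i j x g = N.solve 4
      (λ k w x f → k :⊞ ((w :⊞ (x :⊞ N.con 0)) :⊞ f) :≡ (k :⊞ f) :⊞ (w :⊞ x)) refl (K g) (⁅ w ⁆ g) (⁅ x ⁆ g) (occF F g)
  occ-attach {t = node K F} (below p) w i j x g = trans (cong (K g +_) (occ-attachF p w i j x g))
      (sym (ℕP.+-assoc (K g) (occF F g) _))

  occ-attachF {F = branch s a b t F} (this p) w i j x g = trans (cong (λ z → (⁅ s ⁆ g + z) + occF F g) (occ-attach p w i j x g))
    (N.solve 4 (λ s t f e → (s :⊞ (t :⊞ e)) :⊞ f :≡ ((s :⊞ t) :⊞ f) :⊞ e) refl (⁅ s ⁆ g) (occ t g) (occF F g)
        (⁅ w ⁆ g + ⁅ x ⁆ g))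
  occ-attachF {F = branch s a b t F} (that p) w i j x g = trans (cong ((⁅ s ⁆ g + occ t g) +_) (occ-attachF p w i j x g))
    (sym (ℕP.+-assoc (⁅ s ⁆ g + occ t g) (occF F g) _))

  #blobs-attachF : ∀ {f F} (p : OuterF f F) w i j x → #blobsF (attachF p w i j x) ≡ suc (#blobsF F)

  #blobs-attach : ∀ {f t} (p : Outer f t) w i j x → #blobs (attach p w i j x) ≡ suc (#blobs t)
  #blobs-attach {t = node K F} (here p) w i j x = refl
  #blobs-attach {t = node K F} (below p) w i j x = cong suc (#blobs-attachF p w i j x)

  #blobs-attachF {F = branch s a b t F} (this p) w i j x = cong (_+ #blobsF F) (#blobs-attach p w i j x)
  #blobs-attachF {F = branch s a b t F} (that p) w i j x = trans (cong (#blobs t +_) (#blobs-attachF p w i j x))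
      (ℕP.+-suc (#blobs t) _)

  root-attach : ∀ {f t} (p : Outer f t) w i j x → root (attach p w i j x) ≡ root t
  root-attach {t = node K F} (here p) w i j x = refl
  root-attach {t = node K F} (below p) w i j x = refl

  module Growth (α : Chain) where
    open Configurations α using (Balanced; Conf)
    open Search α using (Valid; ValidF; valid; ∅; branch)

    module _ {β β′ : V → Bool} where

      balanced-β : ∀ {d} → β (proj₁ d) ≡ β′ (proj₁ d) → β (proj₁ (op d)) ≡ β′ (proj₁ (op d)) → Balanced β d → Balanced β′ d
      balanced-β p q b = trans b (cong₂ _xor_ p q)

      conf-β : ∀ {K ts b} → (∀ f → f ∈ K → β f ≡ β′ f) → Conf β K ts b → Conf β′ K ts b
      conf-β h C = record { y = C.y ; out = C.out ; odd = C.odd ; few = C.few ; symm = C.symm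
        -- Being balanced involves both ends of `d`; that the other end lies in `K` follows from
        -- `cons` at `op d`, by `symm`.
        ; cons = λ d p → let (q , r) = C.cons d p in q ,
            balanced-β (h _ q) (h _ (proj₁ (C.cons (op d) (trans (C.symm d) p)))) r }
        where module C = Configurations.Conf C

      -- Validity depends on the potential only at the vertices of the tree, so the potential at
      -- vertices still to be added can be chosen when they are added.
      valid-β : ∀ {t} → (∀ f → f ∈ occ t → β f ≡ β′ f) → Valid β t → Valid β′ t

      validF-β : ∀ {K F} → (∀ f → f ∈ K → β f ≡ β′ f) → (∀ f → f ∈ occF F → β f ≡ β′ f) → ValidF β K F → ValidF β′ K F
      validF-β h k ∅ = ∅
      validF-β {K} {branch s i j t F} h k (branch a b c x u v) = branch a (balanced-β (k s s∈) (h _ a) b)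
          c (balanced-β (k s s∈) (t∈ _ (root-in t c)) x) (valid-β t∈ u)
          (validF-β h (λ f p → k f (∈-right (⁅ s ⁆ ⊎ᵛ occ t) (occF F) p)) v)
        where
        s∈ : s ∈ occF (branch s i j t F)
        s∈ = ∈-left (⁅ s ⁆ ⊎ᵛ occ t) (occF F) (∈-left ⁅ s ⁆ (occ t) (∈-self s))
        t∈ : ∀ f → f ∈ occ t → β f ≡ β′ f
        t∈ f p = k f (∈-left (⁅ s ⁆ ⊎ᵛ occ t) (occF F) (∈-right ⁅ s ⁆ (occ t) p))
        root-in : ∀ t {f} → f ∈ root t → f ∈ occ t
        root-in (node K F) p = ∈-left K (occF F) p

      valid-β {node K F} h (valid A v) = valid
        (record { one = λ t p → conf-β hK (Configurations.Piece.one A t p)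
                ; three = λ t u v p q r → conf-β hK (Configurations.Piece.three A t u v p q r) })
        (validF-β hK (λ f p → h f (∈-right K (occF F) p)) v)
        where
        hK : ∀ f → f ∈ K → β f ≡ β′ f
        hK f p = h f (∈-left K (occF F) p)

    module _ {β : V → Bool} where

      attachF-valid : ∀ {K F f w i j x} (p : OuterF f F) → f ≡ proj₁ (op (w , i)) → x ≡ proj₁ (op (w , j)) →
        Balanced β (w , i) → Balanced β (w , j) → ValidF β K F → ValidF β K (attachF p w i j x)

      attach-valid : ∀ {t f w i j x} (p : Outer f t) → f ≡ proj₁ (op (w , i)) → x ≡ proj₁ (op (w , j)) →
        Balanced β (w , i) → Balanced β (w , j) → Valid β t → Valid β (attach p w i j x)
      attach-valid {node K F} {x = x} (here p) refl refl b b′ (valid A v) =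
        valid A (branch p b (∈-self x) b′ (valid (Configurations.singleton α β x) ∅) v)
      attach-valid {node K F} (below p) e e′ b b′ (valid A v) = valid A (attachF-valid p e e′ b b′ v)

      attachF-valid {F = branch s a b t F} {w = w} {i} {j} {x} (this p) e e′ bl bl′ (branch c d g k u v) =
        branch c d (subst (_ ∈_) (sym (root-attach p w i j x)) g) k (attach-valid p e e′ bl bl′ u) v
      attachF-valid {F = branch s a b t F} (that p) e e′ bl bl′ (branch c d g k u v) = branch c d g k u
          (attachF-valid p e e′ bl bl′ v)

  odd-has : ∀ (y : Chain) f → parity y f ≡ true → ∃ λ i → y (f , i) ≡ true
  odd-has y f p with y (f , zero) in e₀ | y (f , suc zero) in e₁ | y (f , suc (suc zero)) in e₂
  ... | true  | _ | _ = zero , e₀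
  ... | false | true | _ = suc zero , e₁
  ... | false | false | true = suc (suc zero) , e₂

  only-dart : ∀ (y : Chain) f j → parity y f ≡ true → bad y f ≡ false → y (f , j) ≡ true → ∀ i → y (f , i) ≡ (j == i)
  only-dart y f j p b t i = trans (sym (pick-of i))
      (table j i (y (f , zero)) (y (f , suc zero)) (y (f , suc (suc zero))) p b (trans (pick-of j) t))
    where
    pick : Fin 3 → Bool → Bool → Bool → Bool
    pick zero a b c = a
    pick (suc zero) a b c = b
    pick (suc (suc zero)) a b c = c
    pick-of : ∀ i → pick i (y (f , zero)) (y (f , suc zero)) (y (f , suc (suc zero))) ≡ y (f , i)
    pick-of zero = refl
    pick-of (suc zero) = refl
    pick-of (suc (suc zero)) = refl
    table : ∀ j i a b c → a xor (b xor (c xor false)) ≡ true → a ∧ (b ∧ c) ≡ false → pick j a b c ≡ true →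
        pick i a b c ≡ (j == i)
    table zero zero a b c p q r = r
    table zero (suc zero) true false c p q r = refl
    table zero (suc zero) true true false () q r
    table zero (suc zero) true true true p () r
    table zero (suc (suc zero)) true b false p q r = refl
    table zero (suc (suc zero)) true false true () q r
    table zero (suc (suc zero)) true true true p () r
    table (suc zero) zero false b c p q r = refl
    table (suc zero) zero true true false () q r
    table (suc zero) zero true true true p () r
    table (suc zero) (suc zero) a b c p q r = r
    table (suc zero) (suc (suc zero)) a b false p q r = refl
    table (suc zero) (suc (suc zero)) false true true () q r
    table (suc zero) (suc (suc zero)) true true true p () r
    table (suc (suc zero)) zero false b c p q r = refl
    table (suc (suc zero)) zero true false true () q r
    table (suc (suc zero)) zero true true true p () r
    table (suc (suc zero)) (suc zero) a false c p q r = refl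
    table (suc (suc zero)) (suc zero) false true true () q r
    table (suc (suc zero)) (suc zero) true true true p () r
    table (suc (suc zero)) (suc (suc zero)) a b c p q r = r

  Matched : Chain → V → Set
  Matched y f = parity y f ≡ true × bad y f ≡ false

  -- The part of the matching that the search has not yet used. It is empty on `X` and on the
  -- blocked vertices `U`, so any configuration on `X` can be added to it.
  record Outside (X : VSet) (U : V → Bool) (y : Chain) : Set where
    field
      off     : ∀ f i → f ∈ X → y (f , i) ≡ false
      blocked : ∀ f i → U f ≡ true → y (f , i) ≡ false
      apart   : ∀ f → U f ≡ true → X f ≡ 0
      matched : ∀ f → X f ≡ 0 → U f ≡ false → Matched y f
      symm    : ∀ d → y (op d) ≡ y d

  edge : Dart → Chain
  edge c d = (c ==ᵈ d) xor (op c ==ᵈ d)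

  edge-op : ∀ c d → edge c (op d) ≡ edge c d
  edge-op c d = trans (xor-comm (c ==ᵈ op d) _) (cong₂ _xor_ (trans (==ᵈ-op (op c) d) (cong (_==ᵈ d) (op-op c))) (==ᵈ-op c d))

  ==ᵈ-vertex : ∀ c f i → proj₁ c ≢ f → (c ==ᵈ (f , i)) ≡ false
  ==ᵈ-vertex (g , j) f i n = cong (_∧ (j == i)) (==-≢ n)

  edge-vertex : ∀ c f i → proj₁ c ≢ f → proj₁ (op c) ≢ f → edge c (f , i) ≡ false
  edge-vertex c f i n n′ = cong₂ _xor_ (==ᵈ-vertex c f i n) (==ᵈ-vertex (op c) f i n′)

  edge-reverse : ∀ c d → edge (op c) d ≡ edge c d
  edge-reverse c d = trans (cong ((op c ==ᵈ d) xor_) (cong (_==ᵈ d) (op-op c))) (xor-comm (op c ==ᵈ d) (c ==ᵈ d))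

  matched-cong : ∀ y z f → (∀ i → y (f , i) ≡ z (f , i)) → Matched z f → Matched y f
  matched-cong y z f e (p , b) = trans (parity-cong y z f e) p , trans (bad-cong y z f e) b

  unmatch : ∀ y c → Matched y (proj₁ c) → y c ≡ true → ∀ k → (y ⊕ edge c) (proj₁ c , k) ≡ false
  unmatch y c (p , b) yc k = trans (cong₂ _xor_ (only-dart y (proj₁ c) (proj₂ c) p b yc k)
      (trans (cong₂ _xor_ (cong (_∧ (proj₂ c == k)) (==-refl (proj₁ c))) (==ᵈ-vertex (op c) (proj₁ c) k (op-vertex c)))
          (xor-identityʳ _)))
    (xor-same (proj₂ c == k))

  unmatch-op : ∀ y c → Matched y (proj₁ (op c)) → y (op c) ≡ true → ∀ k → (y ⊕ edge c) (proj₁ (op c) , k) ≡ false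
  unmatch-op y c m yc k = trans (cong (y (proj₁ (op c) , k) xor_) (sym (edge-reverse c (proj₁ (op c) , k))))
      (unmatch y (op c) m yc k)

  search-fin : ∀ {n} {A : Fin n → Set} {B : Set} → (∀ i → A i ⊎ B) → (∀ i → A i) ⊎ B
  search-fin {zero} h = inj₁ λ ()
  search-fin {suc n} {A} h with h zero | search-fin {A = λ i → A (suc i)} (λ i → h (suc i))
  ... | inj₂ b | _ = inj₂ b
  ... | inj₁ _ | inj₂ b = inj₂ b
  ... | inj₁ a | inj₁ as = inj₁ λ { zero → a ; (suc i) → as i }

  search-dart : ∀ {A : Dart → Set} {B : Set} → (∀ d → A d ⊎ B) → (∀ d → A d) ⊎ B
  search-dart {A} h with search-fin {A = λ f → ∀ i → A (f , i)} (λ f → search-fin (λ i → h (f , i)))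
  ... | inj₁ k = inj₁ λ { (f , i) → k f i }
  ... | inj₂ b = inj₂ b

  sumℕ-mono : ∀ {n} {f g : Fin n → ℕ} → (∀ i → f i ≤ g i) → sumℕ f ≤ sumℕ g
  sumℕ-mono {zero} h = z≤n
  sumℕ-mono {suc n} h = ℕP.+-mono-≤ (h zero) (sumℕ-mono (λ i → h (suc i)))

  sum-⁅⁆ : ∀ s → sumℕ ⁅ s ⁆ ≡ 1
  sum-⁅⁆ s = ℕS.sum-== s (λ _ → 1)

  ⁅⁆-≢ : ∀ {s f} → s ≢ f → ⁅ s ⁆ f ≡ 0
  ⁅⁆-≢ n = cong ι (==-≢ n)

  ∉⇒0 : ∀ {K : VSet} {f} → ¬ (f ∈ K) → K f ≡ 0
  ∉⇒0 {K} {f} n with K f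
  ... | zero = refl
  ... | suc k = contradiction (s≤s z≤n) n

  -- The blossom algorithm

  module Engine (α : Chain) (U : V → Bool) (h : V) where
    open Configurations α using (Balanced; Conf; Balanced-op)
    open Search α using (Valid; merge; Contraction)
    open Growth α

    -- `neutral` serves the run with `α` zero: the potential then stays zero, and no edge can be
    -- inconsistent.
    record State : Set where
      field
        β       : V → Bool
        t       : Tree
        val     : Valid β t
        simple  : ∀ f → occ t f ≤ 1
        anchor  : h ∈ root t
        neutral : (∀ d → α d ≡ false) → ∀ f → β f ≡ false
        y       : Chain
        outside : Outside (occ t) U y

    module _ (S : State) where
      open State S

      Settled : Dart → Set
      Settled d = Outer (proj₁ d) t →
        (Balanced β d × SameBlob (proj₁ d) (proj₁ (op d)) t) ⊎
        (proj₁ (op d) ∈ occ t × ¬ Outer (proj₁ (op d)) t) ⊎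
        U (proj₁ (op d)) ≡ true

      Inconsistent : Set
      Inconsistent = ∃ λ d → Outer (proj₁ d) t × Outer (proj₁ (op d)) t × ¬ Balanced β d

      -- Growing adds one blob but uses up two free vertices; contracting loses blobs and keeps the
      -- vertices.
      size : ℕ
      size = #blobs t + sumℕ (λ f → 1 ∸ occ t f)

    Smaller : State → Set
    Smaller S = ∃ λ S′ → size S′ < size S

    contractState : ∀ S → Contraction (State.β S) (State.t S) → Smaller S
    contractState S C = record { β = β ; t = C.t′ ; val = C.valid′ ; simple = λ f → subst (_≤ 1) (sym (C.same f)) (simple f)
        ; anchor = C.roots h anchor ; neutral = neutral ; y = y
        ; outside = record
            { off = λ f i p → O.off f i (subst (1 ≤_) (C.same f) p)
            ; blocked = O.blocked
            ; apart = λ f u → trans (C.same f) (O.apart f u)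
            ; matched = λ f e u → O.matched f (trans (sym (C.same f)) e) u
            ; symm = O.symm } } ,
        ℕP.+-mono-<-≤ C.less (ℕP.≤-reflexive (sumℕ-cong (λ f → cong (1 ∸_) (C.same f))))
      where
      open State S
      module C = Contraction β C
      module O = Outside outside

    growState : ∀ S d → Outer (proj₁ d) (State.t S) → occ (State.t S) (proj₁ (op d)) ≡ 0 → U (proj₁ (op d)) ≡ false → Smaller S
    growState S d p w∉ wU = record { β = β′ ; t = t′
        ; val = attach-valid p (cong proj₁ (sym (op-op d))) refl bal bal′ (valid-β agree val)
        ; simple = simple′ ; anchor = subst (h ∈_) (sym (root-attach p w i j x)) anchor ; neutral = neutral′ ; y =
            y′ ; outside = outside′ } , smaller
      where
      open State S
      module O = Outside outside
      w x : V
      w = proj₁ (op d)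
      i : Fin 3
      i = proj₂ (op d)
      found : ∃ λ j → y (w , j) ≡ true
      found = odd-has y w (proj₁ (O.matched w w∉ wU))
      j : Fin 3
      j = proj₁ found
      c : Dart
      c = w , j
      x = proj₁ (op c)
      yc : y (op c) ≡ true
      yc = trans (O.symm c) (proj₂ found)
      true≢false : ∀ {b} → b ≡ true → b ≡ false → ⊥
      true≢false refl ()
      x∉ : occ t x ≡ 0
      x∉ = ∉⇒0 {occ t} (λ q → true≢false yc (O.off x _ q))
      xU : U x ≡ false
      xU with U x in e
      ... | false = refl
      ... | true  = ⊥-elim (true≢false yc (O.blocked x _ e))
      w≢x : w ≢ x
      w≢x e = op-vertex c (sym e)
      t′ : Tree
      t′ = attach p w i j x
      occ′ : ∀ f → occ t′ f ≡ occ t f + (⁅ w ⁆ f + ⁅ x ⁆ f)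
      occ′ = occ-attach p w i j x
      -- The two new tree edges have to be balanced: the first determines the potential at `w`, and
      -- the matching edge `c` then determines it at `x`.
      b₁ : Bool
      b₁ = (α (op d) xor α (op (op d))) xor β (proj₁ (op (op d)))
      β′ : V → Bool
      β′ f = if w == f then b₁ else (if x == f then (α c xor α (op c)) xor b₁ else β f)
      ∈≢ : ∀ {f g} → f ∈ occ t → occ t g ≡ 0 → g ≢ f
      ∈≢ {f} q e refl = contradiction (subst (1 ≤_) e q) λ ()
      agree : ∀ f → f ∈ occ t → β f ≡ β′ f
      agree f q rewrite ==-≢ (∈≢ q w∉) | ==-≢ (∈≢ q x∉) = refl
      β′w : β′ w ≡ b₁
      β′w rewrite ==-refl w = refl
      β′x : β′ x ≡ (α c xor α (op c)) xor b₁
      β′x rewrite ==-≢ w≢x | ==-refl x = refl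
      neutral′ : (∀ d → α d ≡ false) → ∀ f → β′ f ≡ false
      neutral′ z f = go (w == f) (x == f)
        where
        b₁-false : b₁ ≡ false
        b₁-false = cong₂ _xor_ (cong₂ _xor_ (z (op d)) (z (op (op d)))) (neutral z _)
        go : ∀ p q → (if p then b₁ else (if q then (α c xor α (op c)) xor b₁ else β f)) ≡ false
        go true  q     = b₁-false
        go false true  = cong₂ _xor_ (cong₂ _xor_ (z c) (z (op c))) b₁-false
        go false false = neutral z f
      bal : Balanced β′ (w , i)
      bal = trans (xor-undo (α (op d) xor α (op (op d))) (β (proj₁ (op (op d))))) (cong₂ _xor_ (sym β′w)
          (agree _ (subst (λ e → proj₁ e ∈ occ t) (sym (op-op d)) (Outer⇒occ p))))
      bal′ : Balanced β′ (w , j)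
      bal′ = trans (trans (xor-undo (α c xor α (op c)) b₁) (xor-comm _ b₁)) (cong₂ _xor_ (sym β′w) (sym β′x))
      two : ∀ f → ⁅ w ⁆ f + ⁅ x ⁆ f ≤ 1
      two f with w ≟ f
      ... | yes refl = ℕP.≤-reflexive (cong suc (⁅⁆-≢ (w≢x ∘ sym)))
      ... | no _ = ι≤1 (x == f)
      none : ∀ f → f ∈ occ t → ⁅ w ⁆ f + ⁅ x ⁆ f ≡ 0
      none f q = cong₂ _+_ (⁅⁆-≢ (∈≢ q w∉)) (⁅⁆-≢ (∈≢ q x∉))
      total : ∀ f → occ t f + (⁅ w ⁆ f + ⁅ x ⁆ f) ≤ 1
      total f with 1 ℕP.≤? occ t f
      ... | yes q = subst (_≤ 1) (sym (trans (cong (occ t f +_) (none f q)) (ℕP.+-identityʳ _))) (simple f)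
      ... | no q = subst (λ z → z + (⁅ w ⁆ f + ⁅ x ⁆ f) ≤ 1) (sym (∉⇒0 {occ t} q)) (two f)
      simple′ : ∀ f → occ t′ f ≤ 1
      simple′ f = subst (_≤ 1) (sym (occ′ f)) (total f)
      y′ : Chain
      y′ = y ⊕ edge c
      away : ∀ f k → w ≢ f → x ≢ f → y′ (f , k) ≡ y (f , k)
      away f k n n′ = trans (cong (y (f , k) xor_) (edge-vertex c f k n n′)) (xor-identityʳ _)
      gone-w : ∀ k → y′ (w , k) ≡ false
      gone-w = unmatch y c (O.matched w w∉ wU) (proj₂ found)
      gone-x : ∀ k → y′ (x , k) ≡ false
      gone-x = unmatch-op y c (O.matched x x∉ xU) yc
      off′ : ∀ f k → f ∈ occ t′ → y′ (f , k) ≡ false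
      off′ f k q = go (w ≟ f) (x ≟ f)
        where
        go : Dec (w ≡ f) → Dec (x ≡ f) → y′ (f , k) ≡ false
        go (yes e) _ = subst (λ g → y′ (g , k) ≡ false) e (gone-w k)
        go (no _) (yes e) = subst (λ g → y′ (g , k) ≡ false) e (gone-x k)
        go (no n) (no n′) = trans (away f k n n′)
            (O.off f k (subst (1 ≤_) (trans (occ′ f)
            (trans (cong (occ t f +_) (cong₂ _+_ (⁅⁆-≢ n) (⁅⁆-≢ n′))) (ℕP.+-identityʳ _))) q))
      U≢ : ∀ {f g} → U f ≡ true → U g ≡ false → g ≢ f
      U≢ a b refl = true≢false a b
      outside′ : Outside (occ t′) U y′
      outside′ = record
        { off = off′
        ; blocked = λ f k u → trans (away f k (U≢ u wU) (U≢ u xU)) (O.blocked f k u)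
        ; apart = λ f u → trans (occ′ f) (cong₂ _+_ (O.apart f u) (cong₂ _+_ (⁅⁆-≢ (U≢ u wU)) (⁅⁆-≢ (U≢ u xU))))
        ; matched = matched′
        ; symm = λ e → cong₂ _xor_ (O.symm e) (edge-op c e) }
        where
        matched′ : ∀ f → occ t′ f ≡ 0 → U f ≡ false → Matched y′ f
        matched′ f e u = matched-cong y′ y f same (O.matched f (ℕP.m+n≡0⇒m≡0 (occ t f) e′) u)
          where
          e′ : occ t f + (⁅ w ⁆ f + ⁅ x ⁆ f) ≡ 0
          e′ = trans (sym (occ′ f)) e
          zeros′ : ⁅ w ⁆ f + ⁅ x ⁆ f ≡ 0
          zeros′ = ℕP.m+n≡0⇒n≡0 (occ t f) e′
          apart-from : ∀ s → ⁅ s ⁆ f ≡ 0 → s ≢ f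
          apart-from s z refl = contradiction (subst (1 ≤_) z (∈-self s)) λ ()
          same : ∀ k → y′ (f , k) ≡ y (f , k)
          same k = away f k (apart-from w (ℕP.m+n≡0⇒m≡0 (⁅ w ⁆ f) zeros′)) (apart-from x (ℕP.m+n≡0⇒n≡0 (⁅ w ⁆ f) zeros′))
      free : ∀ f → (1 ∸ occ t′ f) + (⁅ w ⁆ f + ⁅ x ⁆ f) ≡ 1 ∸ occ t f
      free f = trans (cong (λ z → (1 ∸ z) + (⁅ w ⁆ f + ⁅ x ⁆ f)) (occ′ f)) (small (occ t f) _ (total f))
        where
        small : ∀ o s → o + s ≤ 1 → (1 ∸ (o + s)) + s ≡ 1 ∸ o
        small zero zero q = refl
        small zero (suc zero) q = refl
        small zero (suc (suc s)) (s≤s ())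
        small (suc zero) zero q = refl
        small (suc zero) (suc s) (s≤s ())
        small (suc (suc o)) s (s≤s ())
      smaller : #blobs t′ + sumℕ (λ f → 1 ∸ occ t′ f) < #blobs t + sumℕ (λ f → 1 ∸ occ t f)
      smaller = ℕP.≤-reflexive (trans (cong (λ z → suc (z + sumℕ (λ f → 1 ∸ occ t′ f))) (#blobs-attach p w i j x))
        (trans (sym (trans (ℕP.+-suc (#blobs t) _) (cong suc (ℕP.+-suc (#blobs t) _))))
          (cong (#blobs t +_) (trans (cong (_+ sumℕ (λ f → 1 ∸ occ t′ f)) (sym two′))
              (trans (ℕP.+-comm (sumℕ (λ f → ⁅ w ⁆ f + ⁅ x ⁆ f)) _)
            (trans (sym (sumℕ-distrib (λ f → 1 ∸ occ t′ f) (λ f → ⁅ w ⁆ f + ⁅ x ⁆ f))) (sumℕ-cong free)))))))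
        where
        two′ : sumℕ (λ f → ⁅ w ⁆ f + ⁅ x ⁆ f) ≡ 2
        two′ = trans (sumℕ-distrib ⁅ w ⁆ ⁅ x ⁆) (cong₂ _+_ (sum-⁅⁆ w) (sum-⁅⁆ x))

    step : ∀ S d → Settled S d ⊎ (Inconsistent S ⊎ Smaller S)
    step S d with outer? (proj₁ d) (State.t S)
    ... | no ¬p = inj₁ λ p → contradiction p ¬p
    ... | yes p with outer? (proj₁ (op d)) (State.t S)
    ...   | yes q with (α d xor α (op d)) Data.Bool.≟ (State.β S (proj₁ d) xor State.β S (proj₁ (op d)))
    ...     | no ¬b = inj₂ (inj₁ (d , p , q , ¬b))
    ...     | yes b with merge (State.β S) (State.val S) b p q
    ...       | inj₁ s = inj₁ λ _ → inj₁ (b , s)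
    ...       | inj₂ C = inj₂ (inj₂ (contractState S C))
    step S d | yes p | no ¬q with 1 ℕP.≤? occ (State.t S) (proj₁ (op d))
    ...   | yes r = inj₁ λ _ → inj₂ (inj₁ (r , ¬q))
    ...   | no ¬r = grow-or-blocked (U (proj₁ (op d))) refl
      where
      grow-or-blocked : ∀ b → U (proj₁ (op d)) ≡ b → Settled S d ⊎ (Inconsistent S ⊎ Smaller S)
      grow-or-blocked true  u = inj₁ λ _ → inj₂ (inj₂ u)
      grow-or-blocked false u = inj₂ (inj₂ (growState S d p (∉⇒0 {occ (State.t S)} ¬r) u))

    Terminal : Set
    Terminal = ∃ λ S → Inconsistent S ⊎ (∀ d → Settled S d)

    run : ∀ n S → size S ≤ n → Terminal
    run n S le with search-dart (step S)
    ... | inj₁ s = S , inj₂ s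
    ... | inj₂ (inj₁ i) = S , inj₁ i
    run zero S le | inj₂ (inj₂ (S′ , l)) = contradiction (ℕP.≤-trans l le) λ ()
    run (suc n) S le | inj₂ (inj₂ (S′ , l)) = run n S′ (ℕP.≤-pred (ℕP.≤-trans l le))

    start : ∀ y → Outside ⁅ h ⁆ U y → Terminal
    start y o = run (size S₀) S₀ ℕP.≤-refl
      where
      plus0 : ∀ f → ⁅ h ⁆ f + 0 ≡ ⁅ h ⁆ f
      plus0 f = ℕP.+-identityʳ (⁅ h ⁆ f)
      S₀ : State
      S₀ = record { β = λ _ → false ; t = node ⁅ h ⁆ ∅ ; val = Search.valid (Configurations.singleton α _ h) Search.∅
        ; simple = λ f → subst (_≤ 1) (sym (plus0 f)) (ι≤1 (h == f)) ; anchor = ∈-self h ; neutral = λ _ _ → refl ; y = y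
        ; outside = record
            { off = λ f i p → Outside.off o f i (subst (1 ≤_) (plus0 f) p) ; blocked = Outside.blocked o
            ; apart = λ f u → trans (plus0 f) (Outside.apart o f u)
            ; matched = λ f e u → Outside.matched o f (trans (sym (plus0 f)) e) u ; symm = Outside.symm o } }

  -- Parity and counting

  ∧-sumB : ∀ {n} b (g : Fin n → Bool) → sumB (λ i → b ∧ g i) ≡ b ∧ sumB g
  ∧-sumB true  g = refl
  ∧-sumB {n} false g = sumB-zero n

  -- The darts of each edge are told apart by comparing their codes.
  involution-sum : ∀ (g : Chain) → (∀ d → g (op d) ≡ g d) → BS.Σ² g ≡ false
  involution-sum g inv = trans (BS.Σ²-cong split) (trans (BS.Σ²-distrib low (λ d → low (op d)))
      (trans (cong (BS.Σ² low xor_) (BS.Σ²-reindex op op-op low)) (xor-same (BS.Σ² low))))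
    where
    code : Dart → ℕ
    code (f , i) = toℕ (combine f i)
    code-injective : ∀ d e → code d ≡ code e → d ≡ e
    code-injective (f , i) (g , j) p with FP.combine-injective f i g j (FP.toℕ-injective p)
    ... | refl , refl = refl
    low : Chain
    low d = g d ∧ does (code d ℕP.<? code (op d))
    one-lower : ∀ a b → a ≢ b → does (a ℕP.<? b) xor does (b ℕP.<? a) ≡ true
    one-lower a b n with ℕP.<-cmp a b
    ... | tri< l _ l′ = cong₂ _xor_ (dec-true (a ℕP.<? b) l) (dec-false (b ℕP.<? a) l′)
    ... | tri≈ _ e _ = contradiction e n
    ... | tri> l _ l′ = cong₂ _xor_ (dec-false (a ℕP.<? b) l) (dec-true (b ℕP.<? a) l′)
    split : ∀ d → g d ≡ low d xor low (op d)
    split d rewrite inv d | op-op d =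
      sym (trans (sym (∧-distribˡ-xor (g d) (does (code d ℕP.<? code (op d))) (does (code (op d) ℕP.<? code d))))
        (trans (cong (g d ∧_) (one-lower (code d) (code (op d))
            (λ e → op-vertex d (cong proj₁ (sym (code-injective d (op d) e)))))) (∧-identityʳ (g d))))

  pairing : Chain → Chain → Bool
  pairing α z = BS.Σ² (λ d → α d ∧ z d)

  pairing-⊕ : ∀ α y z → pairing α (y ⊕ z) ≡ pairing α y xor pairing α z
  pairing-⊕ α y z = trans (BS.Σ²-cong (λ d → ∧-distribˡ-xor (α d) (y d) (z d)))
      (BS.Σ²-distrib (λ d → α d ∧ y d) (λ d → α d ∧ z d))

  pairing-cong : ∀ α {y z} → (∀ d → y d ≡ z d) → pairing α y ≡ pairing α z
  pairing-cong α e = BS.Σ²-cong (λ d → cong (α d ∧_) (e d))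

  pairing-dart : ∀ α c → pairing α (c ==ᵈ_) ≡ α c
  pairing-dart α (f , i) = trans (sumB-cong
      (λ g → trans (sumB-cong (λ j → shuffle (f == g) (i == j) (α (g , j))))
      (trans (∧-sumB {3} (f == g) (λ j → if i == j then α (g , j) else false)) (∧-if (f == g) _))))
      (trans (BS.sum-== f (λ g → sumB (λ j → if i == j then α (g , j) else false))) (BS.sum-== i (λ j → α (f , j))))
    where
    shuffle : ∀ a b c → c ∧ (a ∧ b) ≡ a ∧ (if b then c else false)
    shuffle true true c = ∧-comm c true
    shuffle true false c = ∧-zeroʳ c
    shuffle false b c = ∧-zeroʳ c

  module _ (α : Chain) (β : V → Bool) where
    open Configurations α β using (Balanced; Conf; Piece; Blob)

    -- Summation by parts: on balanced edges `α` is the coboundary of `β`, so the two sides differ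
    -- by a sum over darts of an `op`-invariant function, which is zero.
    pairing-balanced : ∀ z → (∀ d → z (op d) ≡ z d) → (∀ d → z d ≡ true → Balanced d) →
      pairing α z ≡ sumB (λ f → β f ∧ parity z f)
    pairing-balanced z s b = xor-eq _ _ (trans
        (trans (cong (pairing α z xor_) (sumB-cong (λ f → sym (∧-sumB (β f) (λ i → z (f , i))))))
        (sym (BS.Σ²-distrib (λ d → α d ∧ z d) (λ d → β (proj₁ d) ∧ z d)))) (involution-sum _ sym′))
      where
      xor-eq : ∀ a b → a xor b ≡ false → a ≡ b
      xor-eq true true e = refl
      xor-eq false false e = refl
      rebalance : ∀ a b a′ b′ → a xor a′ ≡ b xor b′ → a′ xor b′ ≡ a xor b
      rebalance false false false false e = refl
      rebalance false false true true e = refl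
      rebalance false true true false e = refl
      rebalance false true false true e = refl
      rebalance true true false false e = refl
      rebalance true true true true e = refl
      rebalance true false false true e = refl
      rebalance true false true false e = refl
      factor : ∀ a b z → (a ∧ z) xor (b ∧ z) ≡ (a xor b) ∧ z
      factor a b z = sym (∧-distribʳ-xor z a b)
      sym′ : ∀ d → (α (op d) ∧ z (op d)) xor (β (proj₁ (op d)) ∧ z (op d)) ≡ (α d ∧ z d) xor (β (proj₁ d) ∧ z d)
      sym′ d rewrite s d with z d in e
      ... | true  = trans (factor (α (op d)) (β (proj₁ (op d))) true)
          (trans (cong (_∧ true) (rebalance (α d) (β (proj₁ d)) (α (op d)) _ (b d e))) (sym (factor (α d) (β (proj₁ d)) true)))
      ... | false = trans (factor (α (op d)) (β (proj₁ (op d))) false)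
          (trans (∧-zeroʳ _) (sym (trans (factor (α d) (β (proj₁ d)) false) (∧-zeroʳ _))))

  has : VSet → V → Bool
  has K f = does (1 ℕP.≤? K f)

  has-true : ∀ K {f} → f ∈ K → has K f ≡ true
  has-true K {f} p = dec-true (1 ℕP.≤? K f) p

  has-sound : ∀ K {f} → has K f ≡ true → f ∈ K
  has-sound K {f} e with K f
  ... | suc _ = s≤s z≤n

  ι-has : ∀ K {f} → ι (has K f) ≤ K f
  ι-has K {f} with K f
  ... | zero  = z≤n
  ... | suc _ = s≤s z≤n

  -- The handshake lemma for the configuration with one leaving dart: all degrees are odd, every
  -- inner edge counts twice and the leaving dart once.
  odd-order : ∀ {α β K} t → Configurations.Blob α β K → proj₁ t ∈ K → (∀ f → K f ≤ 1) → sumB (has K) ≡ true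
  odd-order {α} {β} {K} t B t∈ simple = trans (sumB-cong (λ f → sym (same f (K f) refl (simple f))))
      (trans split (cong₂ _xor_ (involution-sum w C.symm) (hit t)))
    where
    module C = Configurations.Conf (Configurations.Piece.one B t t∈)
    w : Chain
    w = C.y ⊕ ⟦ t ∷ [] ⟧
    same : ∀ f k → K f ≡ k → k ≤ 1 → parity C.y f ≡ has K f
    same f zero e _ = trans (sumB-cong {3} (λ i → C.out f i e))
        (sym (dec-false (1 ℕP.≤? K f) (λ p → contradiction (subst (1 ≤_) e p) λ ())))
    same f (suc zero) e _ = trans (C.odd f e) (sym (has-true K (ℕP.≤-reflexive (sym e))))
    same f (suc (suc k)) e (s≤s ())
    split : BS.Σ² C.y ≡ BS.Σ² w xor BS.Σ² ⟦ t ∷ [] ⟧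
    split = trans (BS.Σ²-cong {m} {3} {C.y} {w ⊕ ⟦ t ∷ [] ⟧} (λ d → xor-undo (C.y d) (⟦ t ∷ [] ⟧ d)))
      (BS.Σ²-distrib w ⟦ t ∷ [] ⟧)
    hit : ∀ t → BS.Σ² ⟦ t ∷ [] ⟧ ≡ true
    hit t = trans (BS.Σ²-cong {m} {3} {⟦ t ∷ [] ⟧} {t ==ᵈ_} (λ d → xor-identityʳ _)) (pairing-dart (λ _ → true) t)

  -- A blob other than the root, with the dart by which its link is joined to it. As blobs and links
  -- come in pairs, there is one link fewer than blobs by construction.
  Node : Set
  Node = VSet × Dart

  nodesF : Forest → List Node

  nodes : Tree → List Node
  nodes (node K F) = nodesF F

  nodesF ∅ = []
  nodesF (branch s i j t F) = (root t , s , j) ∷ nodes t ++ nodesF F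

  weight : List Node → VSet
  weight [] f = 0
  weight ((K , c) ∷ ns) f = (K f + ⁅ proj₁ c ⁆ f) + weight ns f

  weight-++ : ∀ ns ms f → weight (ns ++ ms) f ≡ weight ns f + weight ms f
  weight-++ [] ms f = refl
  weight-++ ((K , c) ∷ ns) ms f = trans (cong ((K f + ⁅ proj₁ c ⁆ f) +_) (weight-++ ns ms f))
      (sym (ℕP.+-assoc (K f + ⁅ proj₁ c ⁆ f) _ _))

  occF-weight : ∀ F f → occF F f ≡ weight (nodesF F) f

  occ-weight : ∀ t f → occ t f ≡ root t f + weight (nodes t) f
  occ-weight (node K F) f = cong (K f +_) (occF-weight F f)

  occF-weight ∅ f = refl
  occF-weight (branch s i j t F) f = trans (cong₂ (λ a b → (⁅ s ⁆ f + a) + b) (occ-weight t f) (occF-weight F f))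
    (trans (N.solve 4 (λ s r n g → (s :⊞ (r :⊞ n)) :⊞ g :≡ (r :⊞ s) :⊞ (n :⊞ g)) refl (⁅ s ⁆ f) (root t f)
        (weight (nodes t) f) (weight (nodesF F) f))
      (cong ((root t f + ⁅ s ⁆ f) +_) (sym (weight-++ (nodes t) (nodesF F) f))))

  all-outer : ∀ t → All (λ n → ∀ f → f ∈ proj₁ n → Outer f t) (nodes t)

  all-outerF : ∀ F → All (λ n → ∀ f → f ∈ proj₁ n → OuterF f F) (nodesF F)
  all-outerF ∅ = []
  all-outerF (branch s i j t@(node K G) F) = (λ f p → this (here p)) ∷ AllP.++⁺
      (All.map (λ h f p → this (h f p)) (all-outer t)) (All.map (λ h f p → that (h f p)) (all-outerF F))

  all-outer (node K F) = All.map (λ h f p → below (h f p)) (all-outerF F)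

  same-node : ∀ {f g} t → SameBlob f g t → (f ∈ root t × g ∈ root t) ⊎ Any (λ n → f ∈ proj₁ n × g ∈ proj₁ n) (nodes t)

  same-nodeF : ∀ {f g} F → SameBlobF f g F → Any (λ n → f ∈ proj₁ n × g ∈ proj₁ n) (nodesF F)
  same-nodeF (branch s i j t F) (this p) with same-node t p
  ... | inj₁ q = here q
  ... | inj₂ q = there (AnyP.++⁺ˡ q)
  same-nodeF (branch s i j t F) (that p) = there (AnyP.++⁺ʳ (nodes t) (same-nodeF F p))

  same-node (node K F) (here p q) = inj₁ (p , q)
  same-node (node K F) (below p) = inj₂ (same-nodeF F p)

  module _ {α : Chain} {β : V → Bool} where
    open Search α β

    GoodNode : Node → Set
    GoodNode (K , c) = Configurations.Blob α β K × proj₁ (op c) ∈ K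

    root-blob : ∀ {t} → Valid t → Configurations.Blob α β (root t)
    root-blob (valid A v) = A

    good-nodes : ∀ {t} → Valid t → All GoodNode (nodes t)

    good-nodesF : ∀ {K F} → ValidF K F → All GoodNode (nodesF F)
    good-nodesF ∅ = []
    good-nodesF (branch a b c d u v) = (root-blob u , c) ∷ AllP.++⁺ (good-nodes u) (good-nodesF v)

    good-nodes (valid A v) = good-nodesF v

  weight-split : ∀ ns {f} → f ∈ weight ns → Any (λ n → f ∈ proj₁ n) ns ⊎ Any (λ n → proj₁ (proj₂ n) ≡ f) ns
  weight-split ((K , c) ∷ ns) p with ∈-split (K ⊎ᵛ ⁅ proj₁ c ⁆) (weight ns) p
  ... | inj₁ q with ∈-split K ⁅ proj₁ c ⁆ q
  ...   | inj₁ r = inj₁ (here r)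
  ...   | inj₂ r = inj₂ (here (∈⁅⁆ (proj₁ c) r))
  weight-split ((K , c) ∷ ns) p | inj₂ q with weight-split ns q
  ... | inj₁ r = inj₁ (there r)
  ... | inj₂ r = inj₂ (there r)

  link-node : ∀ t {f} → f ∈ occ t → ¬ Outer f t → Any (λ n → proj₁ (proj₂ n) ≡ f) (nodes t)
  link-node t {f} p n with ∈-split (root t) (weight (nodes t)) (subst (1 ≤_) (occ-weight t f) p)
  ... | inj₁ q = contradiction (root-outer t q) n
  ... | inj₂ q with weight-split (nodes t) q
  ...   | inj₂ r = r
  ...   | inj₁ r = contradiction (All.lookupAny (all-outer t) r) λ { (h , q) → n (h _ q) }

  -- Links absorb the darts leaving the blobs.
  module Counting (cut : ∀ (χ : V → Bool) → sumB χ ≡ true → 3 ≤ ℕS.Σ² (λ d → ι (not (χ (proj₁ d)) ∧ χ (proj₁ (op d)))))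
      {p r : ℕ} (K : Fin p → VSet) (s : Fin r → V)
      (odd : ∀ l → sumB (has (K l)) ≡ true)
      (disjoint : ∀ f → sumℕ (λ l → K l f) ≤ 1)
      (closed : ∀ l d → proj₁ d ∈ K l → proj₁ (op d) ∈ K l ⊎ ∃ λ k → s k ≡ proj₁ (op d)) where

    hit : Fin r → Fin 3 → Fin p → Bool
    hit k i l = has (K l) (proj₁ (op (s k , i)))

    -- By `closed` every edge leaving a blob ends at a link, so counting these edges at their outer
    -- ends counts darts of links.
    leaving : ∀ l → 3 ≤ sumℕ (λ k → sumℕ (λ i → ι (hit k i l)))
    leaving l = ℕP.≤-trans (cut (has (K l)) (odd l))
        (ℕP.≤-trans (sumℕ-mono (λ f → sumℕ-mono (λ i → bound (f , i)))) (ℕP.≤-reflexive (begin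
        sumℕ (λ f → sumℕ (λ i → sumℕ (λ k → at k (f , i)))) ≡⟨ sumℕ-cong (λ f → sumℕ-comm {3} {r} (λ i k → at k (f , i))) ⟩
        sumℕ (λ f → sumℕ (λ k → sumℕ (λ i → at k (f , i)))) ≡⟨ sumℕ-comm {m} {r} (λ f k → sumℕ (λ i → at k (f , i))) ⟩
        sumℕ (λ k → sumℕ (λ f → sumℕ (λ i → at k (f , i)))) ≡⟨ sumℕ-cong
            (λ k → trans (sumℕ-cong (λ f → if-out (s k == f) (λ i → ι (has (K l) (proj₁ (op (f , i)))))))
                  (ℕS.sum-== (s k) (λ f → sumℕ (λ i → ι (has (K l) (proj₁ (op (f , i)))))))) ⟩
        sumℕ (λ k → sumℕ (λ i → ι (hit k i l))) ∎)))
      where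
      open ≡-Reasoning
      at : Fin r → Dart → ℕ
      at k d = if s k == proj₁ d then ι (has (K l) (proj₁ (op d))) else 0
      if-out : ∀ b (g : Fin 3 → ℕ) → sumℕ (λ i → if b then g i else 0) ≡ (if b then sumℕ g else 0)
      if-out true  g = refl
      if-out false g = refl
      bound : ∀ d → ι (not (has (K l) (proj₁ d)) ∧ has (K l) (proj₁ (op d))) ≤ sumℕ (λ k → at k d)
      bound d with has (K l) (proj₁ d) in e | has (K l) (proj₁ (op d)) in e′
      ... | true  | _     = z≤n
      ... | false | false = z≤n
      ... | false | true  with closed l (op d) (has-sound (K l) e′)
      ...   | inj₁ q = contradiction (trans (sym e) (has-true (K l) (subst (λ x → proj₁ x ∈ K l) (op-op d) q))) λ ()
      ...   | inj₂ (k , q) = ℕP.≤-trans (ℕP.≤-reflexive (sym one)) (term≤sum (λ k → if s k == proj₁ d then 1 else 0) k)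
        where
        one : (if s k == proj₁ d then 1 else 0) ≡ 1
        one = cong (λ b → if b then 1 else 0) (trans (cong (s k ==_) (sym (trans q (cong proj₁ (op-op d))))) (==-refl (s k)))

    absorbed : ∀ k i → sumℕ (λ l → ι (hit k i l)) ≤ 1
    absorbed k i = ℕP.≤-trans (sumℕ-mono (λ l → ι-has (K l))) (disjoint _)

    swap-sums : sumℕ (λ l → sumℕ (λ k → sumℕ (λ i → ι (hit k i l)))) ≡ sumℕ (λ k → sumℕ (λ i → sumℕ (λ l → ι (hit k i l))))
    swap-sums = trans (sumℕ-comm {p} {r} (λ l k → sumℕ (λ i → ι (hit k i l))))
        (sumℕ-cong (λ k → sumℕ-comm {p} {3} (λ l i → ι (hit k i l))))

  sumℕ-constant : ∀ n c → sumℕ {n} (λ _ → c) ≡ n * c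
  sumℕ-constant zero c = refl
  sumℕ-constant (suc n) c = cong (c +_) (sumℕ-constant n c)

  sumℕ-tight : ∀ {n} (f g : Fin n → ℕ) → (∀ i → f i ≤ g i) → sumℕ g ≤ sumℕ f → ∀ i → f i ≡ g i
  sumℕ-tight {suc n} f g h le zero = ℕP.≤-antisym (h zero) (ℕP.+-cancelʳ-≤ (sumℕ (λ i → f (suc i))) _ _
    (ℕP.≤-trans (ℕP.+-monoʳ-≤ (g zero) (sumℕ-mono (λ i → h (suc i)))) le))
  sumℕ-tight {suc n} f g h le (suc i) = sumℕ-tight (λ i → f (suc i)) (λ i → g (suc i)) (λ i → h (suc i))
    (ℕP.+-cancelˡ-≤ (f zero) _ _ (ℕP.≤-trans (ℕP.+-monoˡ-≤ _ (h zero)) le)) i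

  -- Completing a configuration on the tree to the whole graph.

  module Assembly {α : Chain} {β : V → Bool} {X : VSet} {U : V → Bool} {yₒ : Chain} {ts : List Dart} {b : Bool}
      (outside : Outside X U yₒ) (C : Configurations.Conf α β X ts b) (c : Dart) (Uc : U (proj₁ c) ≡ true) where
    module O = Outside outside
    module C = Configurations.Conf C

    -- Only the single dart `c` is added, for the blocked vertex. In the applications its partner
    -- `op c` is a leaving dart of `C` and thus already accounted for in `C.y`; this is what
    -- `symmetric` requires of `ts`.
    Y : Chain
    Y = (C.y ⊕ yₒ) ⊕ (c ==ᵈ_)

    Xc : X (proj₁ c) ≡ 0
    Xc = O.apart _ Uc

    at-X : ∀ f → X f ≡ 1 → ∀ i → Y (f , i) ≡ C.y (f , i)
    at-X f e i = trans (cong₂ _xor_ (cong (C.y (f , i) xor_) (O.off f i (ℕP.≤-reflexive (sym e))))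
        (==ᵈ-vertex c f i (λ { refl → contradiction (trans (sym e) Xc) λ () })))
      (trans (xor-identityʳ _) (xor-identityʳ _))

    at-c : ∀ i → Y (proj₁ c , i) ≡ (proj₂ c == i)
    at-c i = trans (cong₂ _xor_ (cong₂ _xor_ (C.out _ i Xc) (O.blocked _ i Uc))
        (cong (_∧ (proj₂ c == i)) (==-refl (proj₁ c)))) refl

    at-U : ∀ f → U f ≡ true → proj₁ c ≢ f → ∀ i → Y (f , i) ≡ false
    at-U f u n i = cong₂ _xor_ (cong₂ _xor_ (C.out _ i (O.apart f u)) (O.blocked _ i u)) (==ᵈ-vertex c f i n)

    elsewhere : ∀ f → X f ≡ 0 → U f ≡ false → ∀ i → Y (f , i) ≡ yₒ (f , i)
    elsewhere f e u i = trans (cong₂ _xor_ (cong (_xor yₒ (f , i)) (C.out _ i e))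
        (==ᵈ-vertex c f i λ { refl → contradiction (trans (sym Uc) u) λ () })) (xor-identityʳ _)

    parity-c : parity Y (proj₁ c) ≡ true
    parity-c = trans (sumB-cong {3} at-c) (go (proj₂ c))
      where
      go : ∀ (j : Fin 3) → sumB (j ==_) ≡ true
      go zero = refl
      go (suc zero) = refl
      go (suc (suc zero)) = refl

    bad-c : bad Y (proj₁ c) ≡ false
    bad-c = trans (cong₂ _∧_ (at-c zero) (cong₂ _∧_ (at-c (suc zero)) (at-c (suc (suc zero))))) (go (proj₂ c))
      where
      go : ∀ (j : Fin 3) → (j == zero) ∧ ((j == suc zero) ∧ (j == suc (suc zero))) ≡ false
      go zero = refl
      go (suc zero) = refl
      go (suc (suc zero)) = refl

    matched-c : Matched Y (proj₁ c)
    matched-c = parity-c , bad-c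

    symmetric : (∀ d → ⟦ c ∷ ts ⟧ (op d) ≡ ⟦ c ∷ ts ⟧ d) → ∀ d → Y (op d) ≡ Y d
    symmetric e d = trans (rearrange (C.y (op d)) (yₒ (op d)) (c ==ᵈ op d) (⟦ ts ⟧ (op d)))
      (trans (cong₂ _xor_ (cong₂ _xor_ (C.symm d) (e d)) (O.symm d)) (sym (rearrange (C.y d) (yₒ d) (c ==ᵈ d) (⟦ ts ⟧ d))))
      where
      rearrange : ∀ y o c t → (y xor o) xor c ≡ ((y xor t) xor (c xor t)) xor o
      rearrange y o c t = sym (trans (X.solve 4
          (λ y o c t → ((y :+ t) :+ (c :+ t)) :+ o := ((y :+ o) :+ c) :+ (t :+ t)) refl y o c t)
        (trans (cong (((y xor o) xor c) xor_) (xor-same t)) (xor-identityʳ _)))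

  record Perfect (y : Chain) : Set where
    field
      symm : ∀ d → y (op d) ≡ y d
      odd  : ∀ f → parity y f ≡ true
      good : ∀ f → bad y f ≡ false

  record Solution (α : Chain) : Set where
    field
      y    : Chain
      symm : ∀ d → y (op d) ≡ y d
      odd  : ∀ f → parity y f ≡ true
      few  : ∀ f g → bad y f ≡ true → bad y g ≡ true → f ≡ g
      zero-class : pairing α (λ d → true xor y d) ≡ false

  unique-index : ∀ {n} (a : Fin n → ℕ) → sumℕ a ≤ 1 → ∀ k l → 1 ≤ a k → 1 ≤ a l → k ≡ l
  unique-index a le zero zero p q = refl
  unique-index a le zero (suc l) p q = contradiction
      (ℕP.≤-trans (ℕP.+-mono-≤ p (ℕP.≤-trans q (term≤sum (λ i → a (suc i)) l))) le) λ { (s≤s ()) }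
  unique-index a le (suc k) zero p q = sym (unique-index a le zero (suc k) q p)
  unique-index a le (suc k) (suc l) p q = cong suc (unique-index (λ i → a (suc i)) (ℕP.≤-trans (ℕP.m≤n+m _ _) le) k l p q)

  weight-lookup : ∀ ns f → weight ns f ≡ sumℕ (λ k → proj₁ (List.lookup ns k) f + ⁅ proj₁ (proj₂ (List.lookup ns k)) ⁆ f)
  weight-lookup [] f = refl
  weight-lookup (n ∷ ns) f = cong (_ +_) (weight-lookup ns f)

  module Settled (α : Chain) (U : V → Bool) (h : V) (S : Engine.State α U h) (settled : ∀ d → Engine.Settled α U h S d) where
    open Engine.State S public
    open Configurations α β using (Balanced; Blob)

    r : ℕ
    r = length (nodes t)

    K : Fin (suc r) → VSet
    K zero    = root t
    K (suc k) = proj₁ (List.lookup (nodes t) k)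

    up : Fin r → Dart
    up k = proj₂ (List.lookup (nodes t) k)

    total : ∀ f → occ t f ≡ root t f + sumℕ (λ k → K (suc k) f + ⁅ proj₁ (up k) ⁆ f)
    total f = trans (occ-weight t f) (cong (root t f +_) (weight-lookup (nodes t) f))

    disjoint : ∀ f → sumℕ (λ l → K l f) ≤ 1
    disjoint f = ℕP.≤-trans (ℕP.+-monoʳ-≤ (root t f) (sumℕ-mono {r} {λ k → K (suc k) f} (λ k → ℕP.m≤m+n _ _)))
        (subst (_≤ 1) (total f) (simple f))

    up∈ : ∀ k → proj₁ (op (up k)) ∈ K (suc k)
    up∈ k = proj₂ (All.lookup (good-nodes val) (∈-lookup k))

    blob : ∀ l → Blob (K l)
    blob zero = root-blob val
    blob (suc k) = proj₁ (All.lookup (good-nodes val) (∈-lookup k))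

    outer : ∀ l {f} → f ∈ K l → Outer f t
    outer zero p = root-outer t p
    outer (suc k) p = All.lookup (all-outer t) (∈-lookup k) _ p

    nonempty : ∀ l → ∃ λ (d : Dart) → proj₁ d ∈ K l
    nonempty zero = (h , zero) , anchor
    nonempty (suc k) = op (up k) , up∈ k

    odd : ∀ l → sumB (has (K l)) ≡ true
    odd l = odd-order (proj₁ (nonempty l)) (blob l) (proj₂ (nonempty l))
        (λ f → ℕP.≤-trans (term≤sum (λ l → K l f) l) (disjoint f))

    closed : ∀ l d → proj₁ d ∈ K l → (Balanced d × proj₁ (op d) ∈ K l) ⊎ (∃ λ k → proj₁ (up k) ≡ proj₁ (op d)) ⊎ U
        (proj₁ (op d)) ≡ true
    closed l d p with settled d (outer l p)
    ... | inj₂ (inj₂ u) = inj₂ (inj₂ u)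
    ... | inj₂ (inj₁ (q , n)) = let a = link-node t q n in inj₂ (inj₁ (Any.index a , AnyP.lookup-index a))
    ... | inj₁ (b , s) = inj₁ (b , both (same-node t s))
      where
      stay : ∀ k → proj₁ d ∈ K k → proj₁ (op d) ∈ K k → proj₁ (op d) ∈ K l
      stay k q q′ = subst (λ i → proj₁ (op d) ∈ K i) (unique-index (λ i → K i (proj₁ d)) (disjoint _) k l q p) q′
      both : (proj₁ d ∈ root t × proj₁ (op d) ∈ root t) ⊎ Any (λ n → proj₁ d ∈ proj₁ n × proj₁ (op d) ∈ proj₁ n)
          (nodes t) → proj₁ (op d) ∈ K l
      both (inj₁ (q , q′)) = stay zero q q′
      both (inj₂ a) = stay (suc (Any.index a)) (proj₁ (AnyP.lookup-index a)) (proj₂ (AnyP.lookup-index a))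

  -- In a cubic graph the cut around an odd vertex set is odd, so the bound 3 just excludes cuts of
  -- one edge.
  Bridgeless : Set
  Bridgeless = ∀ (χ : V → Bool) → sumB χ ≡ true → 3 ≤ ℕS.Σ² (λ d → ι (not (χ (proj₁ d)) ∧ χ (proj₁ (op d))))

  -- Perfect matchings

  module Petersen (bridgeless : Bridgeless) where

    record Partial : Set where
      field
        y       : Chain
        free    : V → Bool
        symm    : ∀ d → y (op d) ≡ y d
        exposed : ∀ f i → free f ≡ true → y (f , i) ≡ false
        covered : ∀ f → free f ≡ false → Matched y f

    #free : Partial → ℕ
    #free M = sumℕ (λ f → ι (Partial.free M f))

    -- The search is run with `α` zero from the exposed vertex `h`, all other exposed vertices being
    -- blocked. An edge from an outer vertex to a blocked one completes a larger matching, as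
    -- `treePiece` lets any outer vertex be the one matched outside the tree.
    augment : ∀ M h → Partial.free M h ≡ true → ∃ λ M′ → #free M′ < #free M
    augment M h fh = go (proj₁ end) (proj₂ end)
      where
      open Partial M
      U : V → Bool
      U f = free f ∧ not (h == f)
      α₀ : Chain
      α₀ _ = false
      module E = Engine α₀ U h
      U⇒ : ∀ {f} → U f ≡ true → free f ≡ true × h ≢ f
      U⇒ {f} e with free f | h ≟ f
      ... | true | no n = refl , n
      ... | true | yes _ = contradiction e λ ()
      ¬U⇒ : ∀ {f} → U f ≡ false → h ≢ f → free f ≡ false
      ¬U⇒ {f} e n with free f | h ≟ f
      ... | false | _ = refl
      ... | true | yes p = contradiction p n
      out₀ : Outside ⁅ h ⁆ U y
      out₀ = record { off = λ f i p → exposed f i (subst (λ g → free g ≡ true) (∈⁅⁆ h p) fh)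
        ; blocked = λ f i u → exposed f i (proj₁ (U⇒ u)) ; apart = λ f u → ⁅⁆-≢ (proj₂ (U⇒ u))
        ; matched = λ f e u → covered f (¬U⇒ u (λ { refl → contradiction (subst (1 ≤_) e (∈-self h)) λ () })) ; symm = symm }
      end : E.Terminal
      end = E.start y out₀
      grown : ∀ S d → Outer (proj₁ d) (E.State.t S) → U (proj₁ (op d)) ≡ true → ∃ λ M′ → #free M′ < #free M
      grown S d p Uw = record { y = Y ; free = free′ ; symm = symmetric edge-symm ; exposed = exposed′ ; covered =
          covered′ } , fewer
        where
        open E.State S using (t; β; val; simple; anchor; outside)
        w : V
        w = proj₁ (op d)
        C : Configurations.Conf α₀ β (occ t) (d ∷ []) false
        C = Configurations.Piece.one (Search.treePiece α₀ β val) d p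
        open Assembly outside C (op d) Uw
        free′ : V → Bool
        free′ f = U f ∧ not (w == f)
        edge-symm : ∀ e → ⟦ op d ∷ d ∷ [] ⟧ (op e) ≡ ⟦ op d ∷ d ∷ [] ⟧ e
        edge-symm e = trans (expand (op e)) (trans (edge-op d e) (sym (expand e)))
          where
          expand : ∀ e → ⟦ op d ∷ d ∷ [] ⟧ e ≡ edge d e
          expand e = trans (cong ((op d ==ᵈ e) xor_) (xor-identityʳ _)) (xor-comm (op d ==ᵈ e) (d ==ᵈ e))
        exposed′ : ∀ f i → free′ f ≡ true → Y (f , i) ≡ false
        exposed′ f i e = at-U f (proj₁ (and-not _ _ e))
            (λ { refl → contradiction (trans (sym (==-refl w)) (proj₂ (and-not (U f) _ e))) λ () }) i
          where
          and-not : ∀ a b → a ∧ not b ≡ true → a ≡ true × b ≡ false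
          and-not true false e = refl , refl
        h∈ : h ∈ occ t
        h∈ = subst (1 ≤_) (sym (occ-weight t h)) (∈-left (root t) (weight (nodes t)) anchor)
        covered′ : ∀ f → free′ f ≡ false → Matched Y f
        covered′ f e = cases (occ t f) refl (simple f) (U f) refl (w ≟ f)
          where
          cases : ∀ k → occ t f ≡ k → k ≤ 1 → ∀ u → U f ≡ u → Dec (w ≡ f) → Matched Y f
          cases (suc zero) k _ u _ _ = matched-cong Y C.y f (at-X f k) (C.odd f k , C.few f k)
          cases (suc (suc _)) _ (s≤s ())
          cases zero k _ u _ (yes refl) = matched-c
          cases zero k _ true u (no n) = contradiction (trans (sym (trans (cong₂ (λ a b → a ∧ not b) u (==-≢ n)) refl)) e) λ ()
          cases zero k _ false u (no n) = matched-cong Y (E.State.y S) f (elsewhere f k u) (Outside.matched outside f k u)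
        fewer : sumℕ (λ f → ι (free′ f)) < sumℕ (λ f → ι (free f))
        fewer = ℕP.≤-trans (ℕP.≤-reflexive (cong (_+ sumℕ (λ f → ι (free′ f))) (sym (sum-⁅⁆ h))))
          (ℕP.≤-trans (ℕP.≤-reflexive (sym (sumℕ-distrib ⁅ h ⁆ (λ f → ι (free′ f))))) (sumℕ-mono pointwise))
          where
          pointwise : ∀ f → ⁅ h ⁆ f + ι (free′ f) ≤ ι (free f)
          pointwise f with h ≟ f
          ... | yes refl rewrite fh = ℕP.≤-reflexive refl
          ... | no n with free f | w ≟ f
          ...   | true | yes _ = z≤n
          ...   | true | no _ = s≤s z≤n
          ...   | false | _ = z≤n
      go : ∀ S → E.Inconsistent S ⊎ (∀ d → E.Settled S d) → ∃ λ M′ → #free M′ < #free M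
      go S (inj₁ (d , _ , _ , n)) = contradiction
          (sym (cong₂ _xor_ (E.State.neutral S (λ _ → refl) (proj₁ d)) (E.State.neutral S (λ _ → refl) (proj₁ (op d))))) n
      go S (inj₂ settled) with search-dart {A = λ d → Outer (proj₁ d) (E.State.t S) → U (proj₁ (op d)) ≡ false} find
        where
        find : ∀ d → (Outer (proj₁ d) (E.State.t S) → U (proj₁ (op d)) ≡ false) ⊎ (∃ λ M′ → #free M′ < #free M)
        find d with outer? (proj₁ d) (E.State.t S) | U (proj₁ (op d)) in u
        ... | no n | _ = inj₁ λ p → contradiction p n
        ... | yes p | true = inj₂ (grown S d p u)
        ... | yes p | false = inj₁ λ _ → refl
      ... | inj₂ r = r
      -- The r + 1 blobs would send at least 3(r + 1) edges to r links, which have only 3r darts.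
      ... | inj₁ none = ⊥-elim (too-many
              (ℕP.≤-trans (ℕP.≤-reflexive (sym (sumℕ-constant (suc T.r) 3)))
                  (ℕP.≤-trans (sumℕ-mono leaving) (ℕP.≤-trans (ℕP.≤-reflexive swap-sums)
                (ℕP.≤-trans (sumℕ-mono (λ k → sumℕ-mono (absorbed k))) (ℕP.≤-reflexive (sumℕ-constant T.r 3)))))))
        where
        module T = Settled α₀ U h S settled
        closed : ∀ l d → proj₁ d ∈ T.K l → proj₁ (op d) ∈ T.K l ⊎ ∃ λ k → proj₁ (T.up k) ≡ proj₁ (op d)
        closed l d p with T.closed l d p
        ... | inj₁ (_ , q) = inj₁ q
        ... | inj₂ (inj₁ q) = inj₂ q
        ... | inj₂ (inj₂ u) = contradiction (trans (sym u) (none d (T.outer l p))) λ ()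
        open Counting bridgeless T.K (λ k → proj₁ (T.up k)) T.odd T.disjoint closed
        too-many : ¬ (suc T.r * 3 ≤ T.r * 3)
        too-many le = ℕP.<-irrefl refl (ℕP.≤-trans (s≤s (ℕP.m≤n+m (T.r * 3) 2)) le)

    matching : ∀ n M → #free M ≤ n → ∃ Perfect
    matching n M le with search-fin {A = λ f → Partial.free M f ≡ false} (λ f → decide f (Partial.free M f) refl)
      where
      decide : ∀ f b → Partial.free M f ≡ b → Partial.free M f ≡ false ⊎ ∃ λ h → Partial.free M h ≡ true
      decide f true  e = inj₂ (f , e)
      decide f false e = inj₁ e
    ... | inj₁ none = Partial.y M , record { symm = Partial.symm M ; odd = λ f → proj₁
        (Partial.covered M f (none f)) ; good = λ f → proj₂ (Partial.covered M f (none f)) }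
    ... | inj₂ (h , e) with augment M h e
    matching zero M le | inj₂ (h , e) | M′ , l = contradiction (ℕP.≤-trans l le) λ ()
    matching (suc n) M le | inj₂ (h , e) | M′ , l = matching n M′ (ℕP.≤-pred (ℕP.≤-trans l le))

    petersen : ∃ Perfect
    petersen = matching _ (record { y = λ _ → false ; free = λ _ → true ; symm = λ _ → refl ; exposed = λ _ _ _ →
        refl ; covered = λ _ () }) ℕP.≤-refl

  -- From a perfect matching to a solution of class zero.

  concatF : ∀ {n} → (Fin n → List Dart) → List Dart
  concatF {zero}  ts = []
  concatF {suc n} ts = ts zero ++ concatF (λ k → ts (suc k))

  ⟦concatF⟧ : ∀ {n} (ts : Fin n → List Dart) d → ⟦ concatF ts ⟧ d ≡ sumB (λ k → ⟦ ts k ⟧ d)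
  ⟦concatF⟧ {zero}  ts d = refl
  ⟦concatF⟧ {suc n} ts d = trans (⟦++⟧ (ts zero) _ d) (cong (⟦ ts zero ⟧ d xor_) (⟦concatF⟧ (λ k → ts (suc k)) d))

  conf-sum : ∀ {α β n} (K : Fin n → VSet) (ts : Fin n → List Dart) → (∀ k → Configurations.Conf α β (K k) (ts k) false) →
    Configurations.Conf α β (λ f → sumℕ (λ k → K k f)) (concatF ts) false
  conf-sum {n = zero} K ts C = record { y = λ _ → false ; out = λ _ _ _ → refl ; odd = λ _ () ; few = λ _ () ; symm =
      λ _ → refl ; cons = λ _ () }
  conf-sum {α} {β} {suc n} K ts C = Configurations.glue α β (C zero)
      (conf-sum (λ k → K (suc k)) (λ k → ts (suc k)) (λ k → C (suc k))) refl

  positive-term : ∀ {n} (g : Fin n → Bool) → 1 ≤ sumℕ (λ l → ι (g l)) → ∃ λ l → g l ≡ true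
  positive-term {suc n} g p with g zero in e
  ... | true = zero , e
  ... | false = let (l , q) = positive-term (λ l → g (suc l)) p in suc l , q

  -- Connectedness as an induction principle.
  Reachable : Set₁
  Reachable = ∀ (P : V → Set) → (∀ d → P (proj₁ d) → P (proj₁ (op d))) → ∀ f g → P f → P g

  perfect-solution : ∀ {α y} → Perfect y → pairing α (λ d → true xor y d) ≡ false → Solution α
  perfect-solution {α} {y} P e = record { y = y ; symm = Perfect.symm P ; odd = Perfect.odd P ; zero-class = e
    ; few = λ f g b _ → contradiction (trans (sym b) (Perfect.good P f)) λ () }

  xor-one : ∀ a b → a xor b ≡ true → a ≡ false ⊎ b ≡ false
  xor-one false b e = inj₁ refl
  xor-one true false e = inj₂ refl

  regroup : ∀ a b o k p q r → ((a xor o) xor k) xor ((b xor o) xor k) ≡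
      ((a xor (p xor false)) xor (b xor (p xor (q xor (r xor false))))) xor (q xor r)
  regroup a b o k p q r = trans (xor-interchange (a xor o) k (b xor o) k)
      (trans (cong₂ _xor_ (xor-interchange a o b o) (xor-same k))
      (trans (xor-identityʳ _) (trans (cong ((a xor b) xor_) (xor-same o))
          (trans (cong ((a xor b) xor_) (sym cancelled)) rearranged))))
    where
    cancelled : (p xor p) xor ((q xor q) xor (r xor r)) ≡ false
    cancelled = cong₂ _xor_ (xor-same p) (cong₂ _xor_ (xor-same q) (xor-same r))
    rearranged : (a xor b) xor ((p xor p) xor ((q xor q) xor (r xor r))) ≡
        ((a xor (p xor false)) xor (b xor (p xor (q xor (r xor false))))) xor (q xor r)
    rearranged = X.solve 5 (λ a b p q r → (a :+ b) :+ ((p :+ p) :+ ((q :+ q) :+ (r :+ r))) :=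
        ((a :+ (p :+ X.con false)) :+ (b :+ (p :+ (q :+ (r :+ X.con false))))) :+ (q :+ r)) refl a b p q r

  xor-unequal : ∀ a b → a ≢ b → a xor b ≡ true
  xor-unequal true true n = contradiction refl n
  xor-unequal false false n = contradiction refl n
  xor-unequal true false n = refl
  xor-unequal false true n = refl

  -- Two configurations that differ by the unbalanced edge e (and balanced edges) complete a partial
  -- matching to odd subgraphs of different classes.
  module Unbalanced {α : Chain} {β : V → Bool} {X : VSet} {yₒ : Chain} (c e : Dart)
      (simple : ∀ f → X f ≤ 1) (outside : Outside X (proj₁ c ==_) yₒ)
      (C₁ : Configurations.Conf α β X (op c ∷ []) true) (C₃ : Configurations.Conf α β X (op c ∷ e ∷ op e ∷ []) true)
      (unbalanced : ¬ Configurations.Balanced α β e) where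
    open Configurations α β using (Conf; Balanced)

    module A₁ = Assembly outside C₁ c (==-refl (proj₁ c))
    module A₃ = Assembly outside C₃ c (==-refl (proj₁ c))

    module Completed {ts : List Dart} (C : Conf X ts true) where
      open Assembly outside C c (==-refl (proj₁ c))

      region : ∀ f → (X f ≡ 1) ⊎ (proj₁ c ≡ f) ⊎ (X f ≡ 0 × (proj₁ c == f) ≡ false)
      region f with X f | simple f | proj₁ c ≟ f
      ... | suc zero | _ | _ = inj₁ refl
      ... | suc (suc _) | s≤s () | _
      ... | zero | _ | yes q = inj₂ (inj₁ q)
      ... | zero | _ | no n = inj₂ (inj₂ (refl , refl))

      all-odd : ∀ f → parity Y f ≡ true
      all-odd f = go (region f)
        where
        go : (X f ≡ 1) ⊎ (proj₁ c ≡ f) ⊎ (X f ≡ 0 × (proj₁ c == f) ≡ false) → parity Y f ≡ true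
        go (inj₁ k) = trans (parity-cong Y C.y f (at-X f k)) (C.odd f k)
        go (inj₂ (inj₁ refl)) = parity-c
        go (inj₂ (inj₂ (k , u))) = proj₁ (matched-cong Y yₒ f (elsewhere f k u) (Outside.matched outside f k u))

      bad-in : ∀ f → bad Y f ≡ true → X f ≡ 1 × bad C.y f ≡ true
      bad-in f q = go (region f)
        where
        go : (X f ≡ 1) ⊎ (proj₁ c ≡ f) ⊎ (X f ≡ 0 × (proj₁ c == f) ≡ false) → X f ≡ 1 × bad C.y f ≡ true
        go (inj₁ k) = k , trans (sym (bad-cong Y C.y f (at-X f k))) q
        go (inj₂ (inj₁ refl)) = contradiction (trans (sym q) bad-c) λ ()
        go (inj₂ (inj₂ (k , u))) = contradiction
            (trans (sym q) (proj₂ (matched-cong Y yₒ f (elsewhere f k u) (Outside.matched outside f k u)))) λ ()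

      at-most-one : ∀ f g → bad Y f ≡ true → bad Y g ≡ true → f ≡ g
      at-most-one f g p q = C.few f g (proj₁ (bad-in f p)) (proj₁ (bad-in g q)) (proj₂ (bad-in f p)) (proj₂ (bad-in g q))

    module D₁ = Completed C₁
    module D₃ = Completed C₃

    expand₁ : ∀ d → ⟦ c ∷ op c ∷ [] ⟧ d ≡ edge c d
    expand₁ d = cong ((c ==ᵈ d) xor_) (xor-identityʳ _)

    expand₃ : ∀ d → ⟦ c ∷ op c ∷ e ∷ op e ∷ [] ⟧ d ≡ edge c d xor edge e d
    expand₃ d = trans (sym (xor-assoc (c ==ᵈ d) (op c ==ᵈ d) _))
        (cong (edge c d xor_) (cong ((e ==ᵈ d) xor_) (xor-identityʳ _)))

    symm₁ : ∀ d → A₁.Y (op d) ≡ A₁.Y d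
    symm₁ = A₁.symmetric (λ d → trans (expand₁ (op d)) (trans (edge-op c d) (sym (expand₁ d))))

    symm₃ : ∀ d → A₃.Y (op d) ≡ A₃.Y d
    symm₃ = A₃.symmetric (λ d → trans (expand₃ (op d)) (trans (cong₂ _xor_ (edge-op c d) (edge-op e d)) (sym (expand₃ d))))

    w z : Chain
    w = (A₁.C.y ⊕ ⟦ op c ∷ [] ⟧) ⊕ (A₃.C.y ⊕ ⟦ op c ∷ e ∷ op e ∷ [] ⟧)
    z = A₁.Y ⊕ A₃.Y

    z-split : ∀ d → z d ≡ w d xor edge e d
    z-split d = regroup (A₁.C.y d) (A₃.C.y d) (yₒ d) (c ==ᵈ d) (op c ==ᵈ d) (e ==ᵈ d) (op e ==ᵈ d)

    w-symm : ∀ d → w (op d) ≡ w d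
    w-symm d = cong₂ _xor_ (A₁.C.symm d) (A₃.C.symm d)

    w-balanced : ∀ d → w d ≡ true → Balanced d
    w-balanced d q = go _ _ refl refl q
      where
      go : ∀ a b → A₁.C.y d xor ⟦ op c ∷ [] ⟧ d ≡ a → A₃.C.y d xor ⟦ op c ∷ e ∷ op e ∷ [] ⟧ d ≡ b → a xor b ≡ true → Balanced d
      go true  b    q₁ _  _ = proj₂ (A₁.C.cons d q₁)
      go false true _  q₃ _ = proj₂ (A₃.C.cons d q₃)

    edge-pairing : ∀ γ → pairing γ (edge e) ≡ γ e xor γ (op e)
    edge-pairing γ = trans (pairing-⊕ γ (e ==ᵈ_) (op e ==ᵈ_)) (cong₂ _xor_ (pairing-dart γ e) (pairing-dart γ (op e)))

    γ : Chain
    γ d = β (proj₁ d)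

    as-pairing : ∀ y → sumB (λ f → β f ∧ parity y f) ≡ pairing γ y
    as-pairing y = sumB-cong (λ f → sym (∧-sumB (β f) (λ i → y (f , i))))

    z-even : pairing γ z ≡ false
    z-even = trans (sym (as-pairing z)) (trans
        (sumB-cong (λ f → trans (cong (β f ∧_) (trans (sumB-distrib {3} (λ i → A₁.Y (f , i)) (λ i → A₃.Y (f , i)))
        (cong₂ _xor_ (D₁.all-odd f) (D₃.all-odd f)))) (∧-zeroʳ (β f)))) (sumB-zero m))

    -- Both completions have odd degrees everywhere, so `z` has even ones, and the degrees of `w`
    -- agree mod 2 with those of the edge `e`. Summation by parts on the balanced `w` thus gives the
    -- difference of `β` along `e`, while `e` itself contributes its value under `α`, which is
    -- different.
    w-class : pairing α w ≡ γ e xor γ (op e)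
    w-class = trans (pairing-balanced α β w w-symm w-balanced) (trans (as-pairing w) (xor-equal _ _
      (trans (cong (pairing γ w xor_) (sym (edge-pairing γ))) (trans (sym (pairing-⊕ γ w (edge e)))
        (trans (sym (pairing-cong γ z-split)) z-even)))))

    classes-differ : pairing α z ≡ true
    classes-differ = trans (pairing-cong α z-split) (trans (pairing-⊕ α w (edge e))
      (trans (cong₂ _xor_ w-class (edge-pairing α)) (xor-unequal _ _ (λ q → unbalanced (sym q)))))

    complements-differ : pairing α (λ d → true xor A₁.Y d) xor pairing α (λ d → true xor A₃.Y d) ≡ true
    complements-differ = trans (sym (pairing-⊕ α (λ d → true xor A₁.Y d) (λ d → true xor A₃.Y d)))
      (trans (pairing-cong α (λ d → xor-interchange true (A₁.Y d) true (A₃.Y d))) classes-differ)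

    solution : Solution α
    solution = go (xor-one _ _ complements-differ)
      where
      go : pairing α (λ d → true xor A₁.Y d) ≡ false ⊎ pairing α (λ d → true xor A₃.Y d) ≡ false → Solution α
      go (inj₁ q) = record { y = A₁.Y ; symm = symm₁ ; odd = D₁.all-odd ; few = D₁.at-most-one ; zero-class = q }
      go (inj₂ q) = record { y = A₃.Y ; symm = symm₃ ; odd = D₃.all-odd ; few = D₃.at-most-one ; zero-class = q }

  -- The tree is completed once with the dart `op c` alone and once with both darts of the
  -- unbalanced edge in addition. The second completion is where a vertex of degree 3 may be needed.
  inconsistent-solution : ∀ α c (S : Engine.State α (proj₁ c ==_) (proj₁ (op c))) →
    Engine.Inconsistent α (proj₁ c ==_) (proj₁ (op c)) S → Solution α
  inconsistent-solution α c S (e , p , p′ , n) =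
    Unbalanced.solution c e simple outside (weaken false (Piece.one P (op c) h∈)) (Piece.three P (op c) e (op e) h∈ p p′) n
    where
    open Engine.State S
    open Configurations α β using (Piece; weaken)
    P : Piece (occ t) (λ f → Outer f t)
    P = Search.treePiece α β val
    h∈ : Outer (proj₁ (op c)) t
    h∈ = root-outer t anchor

  module ThreeMatchings (α : Chain) (β : V → Bool) {y₀ y₁ y₂ t₀ t₁ t₂ : Chain} (P₀ : Perfect y₀) (P₁ : Perfect y₁) (P₂ : Perfect y₂)
      (bal₀ : ∀ d → y₀ d xor t₀ d ≡ true → Configurations.Balanced α β d)
      (bal₁ : ∀ d → y₁ d xor t₁ d ≡ true → Configurations.Balanced α β d)
      (bal₂ : ∀ d → y₂ d xor t₂ d ≡ true → Configurations.Balanced α β d)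
      (rest : ∀ d → t₀ d xor (t₁ d xor t₂ d) ≡ false → Configurations.Balanced α β d) where
    open Configurations α β using (Balanced)

    complement : Chain → Chain
    complement y d = true xor y d

    z : Chain
    z = complement y₀ ⊕ (complement y₁ ⊕ complement y₂)

    -- Separates the edges between blobs and links, recorded by the `t`s, from the edges chosen
    -- inside the blobs, which are the `y`s with the `t`s added.
    z-form : ∀ a b c p q r → (true xor a) xor ((true xor b) xor (true xor c)) ≡
      (true xor (p xor (q xor r))) xor ((a xor p) xor ((b xor q) xor (c xor r)))
    z-form a b c p q r = sym (trans (cong₂ _xor_ {true xor (p xor (q xor r))} refl
        (trans (cong ((a xor p) xor_) (xor-interchange b q c r)) (xor-interchange a p (b xor c) (q xor r))))
      (trans (cancel (p xor (q xor r)) (a xor (b xor c))) (three a b c)))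
      where
      cancel : ∀ s t → (true xor s) xor (t xor s) ≡ true xor t
      cancel true true = refl
      cancel true false = refl
      cancel false true = refl
      cancel false false = refl
      three : ∀ a b c → true xor (a xor (b xor c)) ≡ (true xor a) xor ((true xor b) xor (true xor c))
      three = X.solve 3 (λ a b c → X.con true :+ (a :+ (b :+ c)) := (X.con true :+ a) :+
          ((X.con true :+ b) :+ (X.con true :+ c))) refl

    z-balanced : ∀ d → z d ≡ true → Balanced d
    z-balanced d e = go _ _ _ _ refl refl refl refl (trans (sym (z-form (y₀ d) (y₁ d) (y₂ d) (t₀ d) (t₁ d) (t₂ d))) e)
      where
      go : ∀ u v x s → y₀ d xor t₀ d ≡ u → y₁ d xor t₁ d ≡ v → y₂ d xor t₂ d ≡ x → t₀ d xor (t₁ d xor t₂ d) ≡ s →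
        (true xor s) xor (u xor (v xor x)) ≡ true → Balanced d
      go true  v x s p _ _ _ _ = bal₀ d p
      go false true x s _ p _ _ _ = bal₁ d p
      go false false true s _ _ p _ _ = bal₂ d p
      go false false false false _ _ _ p _ = rest d p

    z-symm : ∀ d → z (op d) ≡ z d
    z-symm d = cong₂ (λ a b → (true xor a) xor b) (Perfect.symm P₀ d)
        (cong₂ (λ a b → (true xor a) xor (true xor b)) (Perfect.symm P₁ d) (Perfect.symm P₂ d))

    even-complement : ∀ {y} → Perfect y → ∀ f → parity (complement y) f ≡ false
    even-complement {y} P f = trans (sumB-distrib {3} (λ _ → true) (λ i → y (f , i))) (cong (true xor_) (Perfect.odd P f))

    z-even : ∀ f → parity z f ≡ false
    z-even f = trans (sumB-distrib {3} (λ i → complement y₀ (f , i)) (λ i → (complement y₁ ⊕ complement y₂) (f , i)))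
      (cong₂ _xor_ (even-complement P₀ f) (trans (sumB-distrib {3} (λ i → complement y₁ (f , i)) (λ i → complement y₂ (f , i)))
        (cong₂ _xor_ (even-complement P₁ f) (even-complement P₂ f))))

    z-class : pairing α z ≡ false
    z-class = trans (pairing-balanced α β z z-symm z-balanced)
        (trans (sumB-cong (λ f → trans (cong (β f ∧_) (z-even f)) (∧-zeroʳ (β f)))) (sumB-zero m))

    solution : Solution α
    solution = go _ _ _ refl refl refl (trans (sym (trans (pairing-⊕ α (complement y₀) (complement y₁ ⊕ complement y₂))
        (cong (pairing α (complement y₀) xor_) (pairing-⊕ α (complement y₁) (complement y₂))))) z-class)
      where
      go : ∀ u v x → pairing α (complement y₀) ≡ u → pairing α (complement y₁) ≡ v → pairing α (complement y₂) ≡ x →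
          u xor (v xor x) ≡ false → Solution α
      go false v x e _ _ _ = perfect-solution P₀ e
      go true false x _ e _ _ = perfect-solution P₁ e
      go true true false _ _ e _ = perfect-solution P₂ e
      -- Three bits with sum 0 are not all 1.
      go true true true _ _ _ ()

  -- If the search gets stuck, contracting the blobs gives a connected bipartite cubic graph with the
  -- links (and the vertex left out of the search) on one side.  It splits into three perfect
  -- matchings, and the sum of the complements of the three perfect matchings they induce consists of
  -- balanced edges.
  module Bipartite (bridgeless : Bridgeless) (reachable : Reachable) (α : Chain) (β : V → Bool) {q : ℕ} (k₀ : Fin q)
      (K : Fin q → VSet) (up : Fin q → Dart)
      (blob : ∀ k → Configurations.Blob α β (K k))
      (up∈ : ∀ k → proj₁ (op (up k)) ∈ K k)
      (odd : ∀ k → sumB (has (K k)) ≡ true)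
      (all≤1 : ∀ f → sumℕ (λ k → ⁅ proj₁ (up k) ⁆ f + K k f) ≤ 1)
      (closed : ∀ l d → proj₁ d ∈ K l →
        (Configurations.Balanced α β d × proj₁ (op d) ∈ K l) ⊎ ∃ λ k → proj₁ (up k) ≡ proj₁ (op d)) where
    open Configurations α β using (Conf; Piece; Balanced; glue; Conf-resp)

    s : Fin q → V
    s k = proj₁ (up k)

    j : Fin q → Fin 3
    j k = proj₂ (up k)

    all : VSet
    all f = sumℕ (λ k → ⁅ s k ⁆ f + K k f)

    all-split : ∀ f → all f ≡ sumℕ (λ k → ⁅ s k ⁆ f) + sumℕ (λ k → K k f)
    all-split f = sumℕ-distrib {q} (λ k → ⁅ s k ⁆ f) (λ k → K k f)

    disjoint : ∀ f → sumℕ (λ k → K k f) ≤ 1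
    disjoint f = ℕP.≤-trans (ℕP.m≤n+m _ (sumℕ (λ k → ⁅ s k ⁆ f))) (subst (_≤ 1) (all-split f) (all≤1 f))

    K⇒all : ∀ k {f} → f ∈ K k → f ∈ all
    K⇒all k {f} p = ℕP.≤-trans (ℕP.≤-trans p (ℕP.m≤n+m _ (⁅ s k ⁆ f))) (term≤sum {q} (λ k → ⁅ s k ⁆ f + K k f) k)

    s⇒all : ∀ k → s k ∈ all
    s⇒all k = ℕP.≤-trans (ℕP.≤-trans (∈-self (s k)) (ℕP.m≤m+n _ (K k (s k)))) (term≤sum {q} (λ l → ⁅ s l ⁆ (s k) + K l (s k)) k)

    all⇒ : ∀ {n} (L : Fin n → VSet) (u : Fin n → V) {f} → 1 ≤ sumℕ (λ k → ⁅ u k ⁆ f + L k f) → (∃ λ k → u k ≡ f) ⊎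
        (∃ λ k → f ∈ L k)
    all⇒ {suc n} L u {f} p with ∈-split (⁅ u zero ⁆ ⊎ᵛ L zero) (λ f → sumℕ (λ k → ⁅ u (suc k) ⁆ f + L (suc k) f)) {f} p
    ... | inj₁ x with ∈-split ⁅ u zero ⁆ (L zero) x
    ...   | inj₁ y = inj₁ (zero , ∈⁅⁆ (u zero) y)
    ...   | inj₂ y = inj₂ (zero , y)
    all⇒ {suc n} L u {f} p | inj₂ x with all⇒ (λ k → L (suc k)) (λ k → u (suc k)) x
    ... | inj₁ (k , e) = inj₁ (suc k , e)
    ... | inj₂ (k , e) = inj₂ (suc k , e)

    closed′ : ∀ l d → proj₁ d ∈ K l → proj₁ (op d) ∈ K l ⊎ ∃ λ k → s k ≡ proj₁ (op d)
    closed′ l d p with closed l d p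
    ... | inj₁ (_ , x) = inj₁ x
    ... | inj₂ x = inj₂ x

    open Counting bridgeless K s odd disjoint closed′

    hits-at : Fin q → Fin 3 → ℕ
    hits-at k i = sumℕ (λ l → ι (hit k i l))

    enough : q * 3 ≤ sumℕ (λ k → sumℕ (λ i → hits-at k i))
    enough = ℕP.≤-trans (ℕP.≤-reflexive (sym (sumℕ-constant q 3))) (ℕP.≤-trans (sumℕ-mono leaving) (ℕP.≤-reflexive swap-sums))

    -- Each of the q blobs receives at least 3 of the 3q darts of links, and each dart reaches at
    -- most one blob; so all these bounds are attained.
    absorbed-exactly : ∀ k i → hits-at k i ≡ 1
    absorbed-exactly k = sumℕ-tight {3} (hits-at k) (λ _ → 1) (absorbed k)
        (ℕP.≤-reflexive (sym (sumℕ-tight {q} (λ k → sumℕ (hits-at k)) (λ _ → 3)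
      (λ k → sumℕ-mono {3} (absorbed k)) (ℕP.≤-trans (ℕP.≤-reflexive (sumℕ-constant q 3)) enough) k)))

    leaving-exactly : ∀ l → sumℕ (λ k → sumℕ (λ i → ι (hit k i l))) ≡ 3
    leaving-exactly l = sym (sumℕ-tight {q} (λ _ → 3) (λ l → sumℕ (λ k → sumℕ (λ i → ι (hit k i l)))) leaving
      (ℕP.≤-trans (ℕP.≤-reflexive swap-sums) (ℕP.≤-trans (sumℕ-mono (λ k → sumℕ-mono (absorbed k)))
        (ℕP.≤-reflexive (trans (sumℕ-constant q 3) (sym (sumℕ-constant q 3)))))) l)

    target : ∀ k i → ∃ λ l → hit k i l ≡ true
    target k i = positive-term (hit k i) (ℕP.≤-reflexive (sym (absorbed-exactly k i)))

    τ : Fin q → Fin 3 → Fin q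
    τ k i = proj₁ (target k i)

    τ∈ : ∀ k i → proj₁ (op (s k , i)) ∈ K (τ k i)
    τ∈ k i = has-sound (K (τ k i)) (proj₂ (target k i))

    τ-unique : ∀ k i l → proj₁ (op (s k , i)) ∈ K l → τ k i ≡ l
    τ-unique k i l p = unique-index (λ l → K l (proj₁ (op (s k , i)))) (disjoint _) (τ k i) l (τ∈ k i) p

    hit-τ : ∀ k i l → hit k i l ≡ (τ k i == l)
    hit-τ k i l = bool-ext (λ e → trans (cong (_== l) (τ-unique k i l (has-sound (K l) e))) (==-refl l))
      (λ e → has-true (K l) (subst (λ x → proj₁ (op (s k , i)) ∈ K x) (==-sound (τ k i) l e) (τ∈ k i)))

    -- The tree itself supplies the first matching of the contracted graph, every link with its own
    -- blob. The other two darts of each link form a 2-regular graph, which `Halving` splits.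
    τ-up : ∀ k → τ k (j k) ≡ k
    τ-up k = τ-unique k (j k) k (up∈ k)

    others : Fin q → Bool → Fin 3
    others k false = next (j k)
    others k true  = next (next (j k))

    up-once : ∀ l → sumℕ (λ k → ι (τ k (j k) == l)) ≡ 1
    up-once l = trans (sumℕ-cong (λ k → cong ι (trans (cong (_== l) (τ-up k)) (==-sym k l)))) (sum-⁅⁆-index l)
      where
      sum-⁅⁆-index : ∀ {n} (l : Fin n) → sumℕ (λ k → ι (l == k)) ≡ 1
      sum-⁅⁆-index l = ℕS.sum-== l (λ _ → 1)

    twice : ∀ l → sumℕ (λ k → ι (τ k (others k false) == l) + ι (τ k (others k true) == l)) ≡ 2
    twice l = ℕP.suc-injective (trans (cong (_+ sumℕ
        (λ k → ι (τ k (others k false) == l) + ι (τ k (others k true) == l))) (sym (up-once l)))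
      (trans (sym (sumℕ-distrib {q} (λ k → ι (τ k (j k) == l))
          (λ k → ι (τ k (others k false) == l) + ι (τ k (others k true) == l))))
        (trans (sumℕ-cong {q} (λ k → trans (sym (sumℕ-rotate (λ i → ι (τ k i == l)) (j k)))
            (sumℕ-cong {3} (λ i → cong ι (sym (hit-τ k i l))))))
          (leaving-exactly l))))

    module H = Halving (λ k b → τ k (others k b)) twice

    -- Blobs and links together are closed under adjacency, since every dart of a link now ends in a
    -- blob.
    everywhere : ∀ f → all f ≡ 1
    everywhere f = ℕP.≤-antisym (all≤1 f) (reachable (_∈ all) spread (s k₀) f (s⇒all k₀))
      where
      spread : ∀ d → proj₁ d ∈ all → proj₁ (op d) ∈ all
      spread d p with all⇒ K s p
      ... | inj₁ (k , refl) = K⇒all (τ k (proj₂ d)) (τ∈ k (proj₂ d))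
      ... | inj₂ (l , x) with closed′ l d x
      ...   | inj₁ y = K⇒all l y
      ...   | inj₂ (k , e) = subst (_∈ all) e (s⇒all k)

    -- A perfect matching of the contracted graph extends to the whole graph because every blob
    -- emits exactly one dart and can be matched inside without cost.
    module Selection (σ : Fin q → Fin 3) (once : ∀ l → sumℕ (λ k → ι (τ k (σ k) == l)) ≡ 1) where
      dart : Fin q → Dart
      dart k = s k , σ k

      ends : Fin q → List Dart
      ends k = dart k ∷ op (dart k) ∷ []

      conf : Conf (λ _ → 1) (concatF ends) false
      conf = Conf-resp same (λ _ → refl) (conf-sum (λ k → ⁅ s k ⁆ ⊎ᵛ K (τ k (σ k))) ends
          (λ k → glue (Piece.one (Configurations.singleton α β (s k)) (dart k) (∈-self (s k)))
              (Piece.one (blob (τ k (σ k))) (op (dart k)) (τ∈ k (σ k))) refl))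
        where
        same : ∀ f → sumℕ (λ k → ⁅ s k ⁆ f + K (τ k (σ k)) f) ≡ 1
        same f = trans (sumℕ-distrib {q} (λ k → ⁅ s k ⁆ f) (λ k → K (τ k (σ k)) f))
          (trans (cong (sumℕ (λ k → ⁅ s k ⁆ f) +_) (sumℕ-reindex (λ k → τ k (σ k)) once (λ l → K l f)))
            (trans (sym (all-split f)) (everywhere f)))

      module C = Configurations.Conf conf
      open C public using (y)

      ⟦ends⟧ : ∀ d → ⟦ concatF ends ⟧ d ≡ sumB (λ k → edge (dart k) d)
      ⟦ends⟧ d = trans (⟦concatF⟧ ends d) (sumB-cong {q} (λ k → cong ((dart k ==ᵈ d) xor_) (xor-identityʳ _)))

      w : Chain
      w d = y d xor ⟦ concatF ends ⟧ d

      perfect : Perfect y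
      perfect = record { odd = λ f → C.odd f refl ; good = λ f → C.few f refl
        ; symm = λ d → cancel (C.symm d) (trans (⟦ends⟧ (op d))
            (trans (sumB-cong {q} (λ k → edge-op (dart k) d)) (sym (⟦ends⟧ d)))) }
        where
        cancel : ∀ {a b p q} → a xor p ≡ b xor q → p ≡ q → a ≡ b
        cancel {a} {b} {p} e refl = trans (xor-undo a p) (trans (cong (_xor p) e) (sym (xor-undo b p)))

      w-balanced : ∀ d → w d ≡ true → Balanced d
      w-balanced d e = proj₂ (C.cons d e)

    module S₀ = Selection j up-once
    module S₁ = Selection (λ k → others k (H.pick k)) H.hits-pick
    module S₂ = Selection (λ k → others k (not (H.pick k))) H.hits-complement

    across : Chain
    across d = ⟦ concatF S₀.ends ⟧ d xor (⟦ concatF S₁.ends ⟧ d xor ⟦ concatF S₂.ends ⟧ d)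

    at-links : V → Bool
    at-links f = sumB (λ k → s k == f)

    -- The three selections together use every dart of every link once, so their edges sum to the
    -- stars of the links.
    across-ends : ∀ d → across d ≡ at-links (proj₁ d) xor at-links (proj₁ (op d))
    across-ends d = trans (cong₂ _xor_ (S₀.⟦ends⟧ d) (trans (cong₂ _xor_ (S₁.⟦ends⟧ d) (S₂.⟦ends⟧ d))
        (sym (sumB-distrib {q} (λ k → edge (S₁.dart k) d) (λ k → edge (S₂.dart k) d)))))
      (trans (sym (sumB-distrib {q} (λ k → edge (S₀.dart k) d) (λ k → edge (S₁.dart k) d xor edge (S₂.dart k) d)))
        (trans (sumB-cong {q} (λ k → trans (cong (edge (S₀.dart k) d xor_)
            (both (H.pick k) (λ b → edge (s k , others k b) d)))
            (trans (sym (sumB-rotate (λ i → edge (s k , i) d) (j k))) (star (s k) d))))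
          (sumB-distrib {q} (λ k → s k == proj₁ d) (λ k → s k == proj₁ (op d)))))
      where
      both : ∀ b (g : Bool → Bool) → g b xor g (not b) ≡ g false xor g true
      both false g = refl
      both true g = xor-comm (g true) (g false)
      row : ∀ a (i : Fin 3) → sumB (λ k → a ∧ (k == i)) ≡ a
      row true zero = refl
      row true (suc zero) = refl
      row true (suc (suc zero)) = refl
      row false i = refl
      star : ∀ v d → sumB (λ i → edge (v , i) d) ≡ (v == proj₁ d) xor (v == proj₁ (op d))
      star v d = trans (sumB-distrib {3} (λ i → (v , i) ==ᵈ d) (λ i → op (v , i) ==ᵈ d))
        (cong₂ _xor_ (row (v == proj₁ d) (proj₂ d))
            (trans (sumB-cong {3} (λ i → sym (==ᵈ-op (v , i) d))) (row (v == proj₁ (op d)) (proj₂ (op d)))))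

    at-links-par : ∀ f → at-links f ≡ par (sumℕ (λ k → ⁅ s k ⁆ f))
    at-links-par f = trans (sumB-cong {q} (λ k → sym (par-ι (s k == f)))) (sym (par-sum {q} (λ k → ⁅ s k ⁆ f)))

    link-count : ∀ f → sumℕ (λ k → ⁅ s k ⁆ f) + sumℕ (λ k → K k f) ≡ 1
    link-count f = trans (sym (all-split f)) (everywhere f)

    on-link : ∀ k → at-links (s k) ≡ true
    on-link k = trans (at-links-par (s k)) (cong par
        (ℕP.≤-antisym (ℕP.≤-trans (ℕP.m≤m+n _ _) (ℕP.≤-reflexive (link-count (s k))))
      (ℕP.≤-trans (∈-self (s k)) (term≤sum {q} (λ l → ⁅ s l ⁆ (s k)) k))))

    in-blob : ∀ l {f} → f ∈ K l → at-links f ≡ false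
    in-blob l {f} p = trans (at-links-par f)
        (cong par (vanish _ _ (link-count f) (ℕP.≤-trans p (term≤sum {q} (λ k → K k f) l))))
      where
      vanish : ∀ a b → a + b ≡ 1 → 1 ≤ b → a ≡ 0
      vanish zero b e p = refl
      vanish (suc zero) (suc b) () p
      vanish (suc (suc a)) b () p

    -- No two links are adjacent, so an edge whose ends are alike has both ends in blobs; `closed`
    -- then puts them into the same blob.
    inside-balanced : ∀ d → across d ≡ false → Balanced d
    inside-balanced d e = go (all⇒ K s (ℕP.≤-reflexive (sym (everywhere (proj₁ d)))))
      where
      same : at-links (proj₁ d) ≡ at-links (proj₁ (op d))
      same = xor-equal (at-links (proj₁ d)) (at-links (proj₁ (op d))) (trans (sym (across-ends d)) e)
      differ : ∀ {a b : Bool} → a ≡ b → a ≡ true → b ≡ false → ⊥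
      differ refl refl ()
      from-blob : ∀ l → proj₁ d ∈ K l → (Balanced d × proj₁ (op d) ∈ K l) ⊎ (∃ λ k → s k ≡ proj₁ (op d)) → Balanced d
      from-blob l p (inj₁ (b , _)) = b
      from-blob l p (inj₂ (k , x)) = ⊥-elim (differ (sym same) (subst (λ f → at-links f ≡ true) x (on-link k)) (in-blob l p))
      from-link : ∀ k i → s k ≡ proj₁ d → proj₂ d ≡ i → at-links (proj₁ (op d)) ≡ false
      from-link k i refl refl = in-blob (τ k i) (τ∈ k i)
      go : (∃ λ k → s k ≡ proj₁ d) ⊎ (∃ λ l → proj₁ d ∈ K l) → Balanced d
      go (inj₁ (k , x)) = ⊥-elim (differ same (subst (λ f → at-links f ≡ true) x (on-link k)) (from-link k (proj₂ d) x refl))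
      go (inj₂ (l , p)) = from-blob l p (closed l d p)

    solution : Solution α
    solution = ThreeMatchings.solution α β S₀.perfect S₁.perfect S₂.perfect S₀.w-balanced S₁.w-balanced S₂.w-balanced inside-balanced

  module _ (α : Chain) (c : Dart) (S : Engine.State α (proj₁ c ==_) (proj₁ (op c)))
      (settled : ∀ d → Engine.Settled α (proj₁ c ==_) (proj₁ (op c)) S d) where
    private
      module T = Settled α (proj₁ c ==_) (proj₁ (op c)) S settled

      -- The blocked vertex takes the part of the missing link of the root blob: its dart `c` leads
      -- to the vertex from which the search started. This makes the numbers of links and blobs
      -- equal.
      up : Fin (suc T.r) → Dart
      up zero    = c
      up (suc k) = T.up k

      up∈ : ∀ k → proj₁ (op (up k)) ∈ T.K k
      up∈ zero    = T.anchor
      up∈ (suc k) = T.up∈ k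

      c∉ : occ T.t (proj₁ c) ≡ 0
      c∉ = Outside.apart T.outside (proj₁ c) (==-refl (proj₁ c))

      all-occ : ∀ f → sumℕ (λ k → ⁅ proj₁ (up k) ⁆ f + T.K k f) ≡ ⁅ proj₁ c ⁆ f + occ T.t f
      all-occ f = trans (ℕP.+-assoc (⁅ proj₁ c ⁆ f) (root T.t f) _) (cong (⁅ proj₁ c ⁆ f +_)
        (trans (cong (root T.t f +_) (sumℕ-cong {T.r} (λ k → ℕP.+-comm (⁅ proj₁ (T.up k) ⁆ f) _))) (sym (T.total f))))

      all≤1 : ∀ f → sumℕ (λ k → ⁅ proj₁ (up k) ⁆ f + T.K k f) ≤ 1
      all≤1 f = subst (_≤ 1) (sym (all-occ f)) (go (proj₁ c ≟ f))
        where
        go : Dec (proj₁ c ≡ f) → ⁅ proj₁ c ⁆ f + occ T.t f ≤ 1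
        go (yes refl) = subst (λ z → ⁅ proj₁ c ⁆ (proj₁ c) + z ≤ 1) (sym c∉)
            (subst (_≤ 1) (sym (ℕP.+-identityʳ _)) (ι≤1 (proj₁ c == proj₁ c)))
        go (no n) = subst (λ z → z + occ T.t f ≤ 1) (sym (⁅⁆-≢ n)) (T.simple f)

      closed : ∀ l d → proj₁ d ∈ T.K l →
        (Configurations.Balanced α T.β d × proj₁ (op d) ∈ T.K l) ⊎ ∃ λ k → proj₁ (up k) ≡ proj₁ (op d)
      closed l d p with T.closed l d p
      ... | inj₁ x = inj₁ x
      ... | inj₂ (inj₁ (k , e)) = inj₂ (suc k , e)
      ... | inj₂ (inj₂ u) = inj₂ (zero , ==-sound (proj₁ c) _ u)

    settled-solution : Bridgeless → Reachable → Solution α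
    settled-solution bridgeless reachable =
      Bipartite.solution bridgeless reachable α T.β zero T.K up T.blob up∈ T.odd all≤1 closed

  near-perfect : Bridgeless → Reachable → ∀ α {y} → Perfect y → V → Solution α
  near-perfect bridgeless reachable α {y} P h = conclude (E.start (y ⊕ edge c) out₀)
    where
    module P = Perfect P
    mate : ∃ λ i → y (h , i) ≡ true
    mate = odd-has y h (P.odd h)
    -- The edge at `h` is taken out of the matching. Its end `h` becomes the root of the search, and
    -- the mate of `h` is the blocked vertex.
    c : Dart
    c = op (h , proj₁ mate)
    yc : y c ≡ true
    yc = trans (P.symm _) (proj₂ mate)
    y-opc : y (op c) ≡ true
    y-opc = trans (P.symm c) yc
    U : V → Bool
    U = proj₁ c ==_
    module E = Engine α U (proj₁ (op c))
    gone-c : ∀ k → (y ⊕ edge c) (proj₁ c , k) ≡ false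
    gone-c = unmatch y c (P.odd _ , P.good _) yc
    gone-h : ∀ k → (y ⊕ edge c) (proj₁ (op c) , k) ≡ false
    gone-h = unmatch-op y c (P.odd _ , P.good _) y-opc
    out₀ : Outside ⁅ proj₁ (op c) ⁆ U (y ⊕ edge c)
    out₀ = record
      { off = λ f i p → subst (λ g → (y ⊕ edge c) (g , i) ≡ false) (∈⁅⁆ (proj₁ (op c)) p) (gone-h i)
      ; blocked = λ f i u → subst (λ g → (y ⊕ edge c) (g , i) ≡ false) (==-sound (proj₁ c) f u) (gone-c i)
      ; apart = λ f u → ⁅⁆-≢ (λ e → op-vertex c (trans e (sym (==-sound (proj₁ c) f u))))
      ; matched = λ f e u → matched-cong (y ⊕ edge c) y f
          (away f (λ { refl → contradiction (subst (1 ≤_) e (∈-self f)) λ () })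
              (λ { refl → contradiction (trans (sym u) (==-refl f)) λ () }))
          (P.odd f , P.good f)
      ; symm = λ d → cong₂ _xor_ (P.symm d) (edge-op c d) }
      where
      away : ∀ f → proj₁ (op c) ≢ f → proj₁ c ≢ f → ∀ i → (y ⊕ edge c) (f , i) ≡ y (f , i)
      away f n n′ i = trans (cong (y (f , i) xor_) (edge-vertex c f i n′ n)) (xor-identityʳ _)
    conclude : E.Terminal → Solution α
    conclude (S , inj₁ i) = inconsistent-solution α c S i
    conclude (S , inj₂ s) = settled-solution α c S s bridgeless reachable

-- The dual graph of a triangulation

-- Follows the recursion of `countFin`, so that the list of edges used as equations has exactly the
-- length `edgeCount` in the Euler formula.
collect : ∀ {k} {P : Fin k → Set} {A : Set} → (∀ i → Dec (P i)) → (∀ i → P i → A) → List A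
collect {zero}  P? h = []
collect {suc k} P? h with P? zero
... | yes p = h zero p ∷ collect (λ i → P? (suc i)) (λ i → h (suc i))
... | no _  = collect (λ i → P? (suc i)) (λ i → h (suc i))

length-collect : ∀ {k} {P : Fin k → Set} {A : Set} (P? : ∀ i → Dec (P i)) (h : ∀ i → P i → A) → length
    (collect P? h) ≡ countFin P?
length-collect {zero}  P? h = refl
length-collect {suc k} P? h with P? zero
... | yes p = cong suc (length-collect (λ i → P? (suc i)) (λ i → h (suc i)))
... | no _  = length-collect (λ i → P? (suc i)) (λ i → h (suc i))

∈-collect : ∀ {k} {P : Fin k → Set} {A : Set} (P? : ∀ i → Dec (P i)) (h : ∀ i → P i → A) i → P i → ∃ λ p → h i p ∈ˡ collect P? h
∈-collect {suc k} P? h zero q with P? zero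
... | yes p = p , here refl
... | no n = contradiction q n
∈-collect {suc k} P? h (suc i) q with P? zero | ∈-collect (λ i → P? (suc i)) (λ i → h (suc i)) i q
... | yes _ | p , x = p , there x
... | no _  | p , x = p , x

gather : ∀ {k} {A : Set} → (Fin k → List A) → List A
gather {zero}  h = []
gather {suc k} h = h zero ++ gather (λ i → h (suc i))

length-gather : ∀ {k} {A : Set} (h : Fin k → List A) → length (gather h) ≡ sumFin (λ i → length (h i))
length-gather {zero}  h = refl
length-gather {suc k} h = trans (length-++ (h zero)) (cong (length (h zero) +_) (length-gather (λ i → h (suc i))))

∈-gather : ∀ {k} {A : Set} (h : Fin k → List A) i {x} → x ∈ˡ h i → x ∈ˡ gather h
∈-gather {suc k} h zero p = ∈-++⁺ˡ p
∈-gather {suc k} h (suc i) p = ∈-++⁺ʳ (h zero) (∈-gather (λ i → h (suc i)) i p)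

sumFin-cong : ∀ {k} {g h : Fin k → ℕ} → (∀ i → g i ≡ h i) → sumFin g ≡ sumFin h
sumFin-cong {zero}  e = refl
sumFin-cong {suc k} e = cong₂ _+_ (e zero) (sumFin-cong (λ i → e (suc i)))

next-injective : ∀ i j → next i ≡ next j → i ≡ j
next-injective zero zero e = refl
next-injective zero (suc zero) ()
next-injective zero (suc (suc zero)) ()
next-injective (suc zero) (suc zero) e = refl
next-injective (suc zero) (suc (suc zero)) ()
next-injective (suc (suc zero)) (suc (suc zero)) e = refl

next-≢ : ∀ i → next i ≢ next (next i)
next-≢ zero ()
next-≢ (suc zero) ()
next-≢ (suc (suc zero)) ()

next-apart : ∀ i j → next i ≡ next (next j) → next (next i) ≢ next j
next-apart zero zero ()
next-apart zero (suc zero) ()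
next-apart zero (suc (suc zero)) _ ()
next-apart (suc zero) zero _ ()
next-apart (suc zero) (suc zero) ()
next-apart (suc zero) (suc (suc zero)) ()
next-apart (suc (suc zero)) zero ()
next-apart (suc (suc zero)) (suc zero) _ ()
next-apart (suc (suc zero)) (suc (suc zero)) ()

third : ∀ (p q : Fin 3) → p ≢ q → ∃ λ k → (p ≡ next k × q ≡ next (next k)) ⊎ (p ≡ next (next k) × q ≡ next k)
third zero zero n = contradiction refl n
third zero (suc zero) n = suc (suc zero) , inj₁ (refl , refl)
third zero (suc (suc zero)) n = suc zero , inj₂ (refl , refl)
third (suc zero) zero n = suc (suc zero) , inj₂ (refl , refl)
third (suc zero) (suc zero) n = contradiction refl n
third (suc zero) (suc (suc zero)) n = zero , inj₁ (refl , refl)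
third (suc (suc zero)) zero n = suc zero , inj₁ (refl , refl)
third (suc (suc zero)) (suc zero) n = zero , inj₂ (refl , refl)
third (suc (suc zero)) (suc (suc zero)) n = contradiction refl n

-- The dart (f , i) is the edge of the face f opposite to its corner i.
module Dual (T : FaceData) (S : IsProjectivePlaneTriangulation T) where
  open FaceData T
  open IsProjectivePlaneTriangulation S

  D : Set
  D = Fin m × Fin 3

  a b : D → Fin n
  a (f , i) = face f (next i)
  b (f , i) = face f (next (next i))

  a≢b : ∀ d → a d ≢ b d
  a≢b (f , i) e = next-≢ i (corners-distinct f _ _ e)

  edgeOf : ∀ d → EdgeOf T (proj₁ d) (a d) (b d)
  edgeOf d@(f , i) = a≢b d , (next i , refl) , (next (next i) , refl)

  Ends : Fin n → Fin n → D → Set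
  Ends u v e = (u ≡ a e × v ≡ b e) ⊎ (u ≡ b e × v ≡ a e)

  dart-of : ∀ g {u v} → EdgeOf T g u v → ∃ λ k → Ends u v (g , k)
  dart-of g (n , (p , refl) , (q , refl)) with third p q (λ e → n (cong (face g) e))
  ... | k , inj₁ (refl , refl) = k , inj₁ (refl , refl)
  ... | k , inj₂ (refl , refl) = k , inj₂ (refl , refl)

  ends⇒edgeOf : ∀ {u v} e → Ends u v e → EdgeOf T (proj₁ e) u v
  ends⇒edgeOf e (inj₁ (refl , refl)) = edgeOf e
  ends⇒edgeOf (f , i) (inj₂ (refl , refl)) = (λ e → a≢b (f , i) (sym e)) , (next (next i) , refl) , (next i , refl)

  ends-trans : ∀ {u v d e} → Ends u v d → Ends u v e → Ends (a d) (b d) e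
  ends-trans (inj₁ (refl , refl)) q = q
  ends-trans (inj₂ (refl , refl)) (inj₁ (p , q)) = inj₂ (q , p)
  ends-trans (inj₂ (refl , refl)) (inj₂ (p , q)) = inj₁ (q , p)

  same-face : ∀ f i j → Ends (a (f , i)) (b (f , i)) (f , j) → i ≡ j
  same-face f i j (inj₁ (p , _)) = next-injective i j (corners-distinct f _ _ p)
  same-face f i j (inj₂ (p , q)) = contradiction (corners-distinct f _ _ q) (next-apart i j (corners-distinct f _ _ p))

  opposite : ∀ d → ∃ λ e → proj₁ e ≢ proj₁ d × Ends (a d) (b d) e × (∀ h → EdgeOf T h (a d) (b d) → h ≡ proj₁ d ⊎ h ≡ proj₁ e)
  opposite d with edge-two-faces (proj₁ d) (a d) (b d) (edgeOf d)
  ... | g , g≢ , E , only = let (k , p) = dart-of g E in (g , k) , g≢ , p , only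

  op : D → D
  op d = proj₁ (opposite d)

  op-vertex : ∀ d → proj₁ (op d) ≢ proj₁ d
  op-vertex d = proj₁ (proj₂ (opposite d))

  op-ends : ∀ d → Ends (a d) (b d) (op d)
  op-ends d = proj₁ (proj₂ (proj₂ (opposite d)))

  -- By `edge-two-faces` only two faces contain the edge, and within one face distinct corners make
  -- the opposite edges distinct. That `op` is an involution follows.
  same-edge : ∀ d e → Ends (a d) (b d) e → e ≡ d ⊎ e ≡ op d
  same-edge d (g , k) p with proj₂ (proj₂ (proj₂ (opposite d))) g (ends⇒edgeOf (g , k) p)
  ... | inj₁ refl = inj₁ (cong (g ,_) (sym (same-face g (proj₂ d) k p)))
  ... | inj₂ q = inj₂ (from-op (op d) q (ends-trans (op-ends d) p))
    where
    from-op : ∀ e → g ≡ proj₁ e → Ends (a e) (b e) (g , k) → (g , k) ≡ e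
    from-op (_ , l) refl r = cong (g ,_) (sym (same-face g l k r))

  op-op : ∀ d → op (op d) ≡ d
  op-op d with same-edge (op d) d (ends-trans (op-ends d) (inj₁ (refl , refl)))
  ... | inj₁ e = contradiction (cong proj₁ (sym e)) (op-vertex d)
  ... | inj₂ e = sym e

  -- The coboundary of the indicator of `u`: the edges of the triangulation at `u`.
  inc : Fin n → D → Bool
  inc u d = (u == a d) xor (u == b d)

  inc-op : ∀ u d → inc u (op d) ≡ inc u d
  inc-op u d with op-ends d
  ... | inj₁ (p , q) = sym (cong₂ (λ x y → (u == x) xor (u == y)) p q)
  ... | inj₂ (p , q) = trans (xor-comm (u == a (op d)) _) (sym (cong₂ (λ x y → (u == x) xor (u == y)) p q))

  δ : (Fin n → Bool) → D → Bool
  δ c d = c (a d) xor c (b d)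

  δ-op : ∀ c d → δ c (op d) ≡ δ c d
  δ-op c d with op-ends d
  ... | inj₁ (p , q) = sym (cong₂ (λ x y → c x xor c y) p q)
  ... | inj₂ (p , q) = trans (xor-comm (c (a (op d))) _) (sym (cong₂ (λ x y → c x xor c y) p q))

  corners-even : ∀ (c : Fin 3 → Bool) → sumB (λ i → c (next i) xor c (next (next i))) ≡ false
  corners-even c = trans (sumB-rotate (λ i → c (next i) xor c (next (next i))) zero)
      (go (c zero) (c (suc zero)) (c (suc (suc zero))))
    where
    go : ∀ x y z → (y xor z) xor ((z xor x) xor (x xor y)) ≡ false
    go true true true = refl
    go true true false = refl
    go true false true = refl
    go true false false = refl
    go false true true = refl
    go false true false = refl
    go false false true = refl
    go false false false = refl

-- The induction has to keep the even count of at least 2 as a separate class, which one further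
-- element turns into 3.
unique-or-three : ∀ {n} (p : Fin n → Bool) → sumB p ≡ true →
  (∃ λ i → p i ≡ true × ∀ j → p j ≡ true → j ≡ i) ⊎ 3 ≤ sumℕ (λ i → ι (p i))
unique-or-three {n} p e with classify p
  where
  Class : ∀ {n} → (Fin n → Bool) → Set
  Class p = (∀ i → p i ≡ false) ⊎ (∃ λ i → p i ≡ true × ∀ j → p j ≡ true → j ≡ i) ⊎
      (sumB p ≡ false × 2 ≤ sumℕ (λ i → ι (p i))) ⊎ 3 ≤ sumℕ (λ i → ι (p i))
  sumB-none : ∀ {n} (p : Fin n → Bool) → (∀ i → p i ≡ false) → sumB p ≡ false
  sumB-none {n} p h = trans (sumB-cong h) (sumB-zero n)
  sumB-one : ∀ {n} (p : Fin n → Bool) i → p i ≡ true → (∀ j → p j ≡ true → j ≡ i) → sumB p ≡ true × 1 ≤ sumℕ (λ i → ι (p i))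
  sumB-one p zero e u = cong₂ _xor_ e (sumB-none (λ i → p (suc i)) rest) , subst
      (λ b → 1 ≤ ι b + sumℕ (λ i → ι (p (suc i)))) (sym e) (s≤s z≤n)
    where
    rest : ∀ i → p (suc i) ≡ false
    rest i with p (suc i) in q
    ... | false = refl
    ... | true = contradiction (u (suc i) q) λ ()
  sumB-one p (suc i) e u with p zero in q
  ... | true = contradiction (u zero q) λ ()
  ... | false = sumB-one (λ i → p (suc i)) i e (λ j r → FP.suc-injective (u (suc j) r))
  classify : ∀ {n} (p : Fin n → Bool) → Class p
  classify {zero} p = inj₁ λ ()
  classify {suc n} p with p zero in q | classify (λ i → p (suc i))
  ... | false | inj₁ h = inj₁ λ { zero → q ; (suc i) → h i }
  ... | false | inj₂ (inj₁ (i , e , u)) = inj₂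
      (inj₁ (suc i , e , λ { zero r → contradiction (trans (sym q) r) λ () ; (suc j) r → cong suc (u j r) }))
  ... | false | inj₂ (inj₂ (inj₁ x)) = inj₂ (inj₂ (inj₁ x))
  ... | false | inj₂ (inj₂ (inj₂ x)) = inj₂ (inj₂ (inj₂ x))
  ... | true | inj₁ h = inj₂ (inj₁ (zero , q , λ { zero r → refl ; (suc j) r → contradiction (trans (sym (h j)) r) λ () }))
  ... | true | inj₂ (inj₁ (i , e , u)) = inj₂
      (inj₂ (inj₁ (cong (true xor_) (proj₁ (sumB-one (λ i → p (suc i)) i e u)) , s≤s
      (proj₂ (sumB-one (λ i → p (suc i)) i e u)))))
  ... | true | inj₂ (inj₂ (inj₁ (_ , x))) = inj₂ (inj₂ (inj₂ (s≤s x)))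
  ... | true | inj₂ (inj₂ (inj₂ x)) = inj₂ (inj₂ (inj₂ (ℕP.≤-trans x (ℕP.n≤1+n _))))
... | inj₁ h = contradiction (trans (sym e) (trans (sumB-cong h) (sumB-zero n))) λ ()
... | inj₂ (inj₁ u) = inj₁ u
... | inj₂ (inj₂ (inj₁ (z , _))) = contradiction (trans (sym e) z) λ ()
... | inj₂ (inj₂ (inj₂ x)) = inj₂ x

dot-++ : ∀ {k l} (u x : Vec Bool k) (v y : Vec Bool l) → dot (u ++ᵛ v) (x ++ᵛ y) ≡ dot u x xor dot v y
dot-++ [] [] v y = refl
dot-++ (p ∷ u) (q ∷ x) v y = trans (cong ((p ∧ q) xor_) (dot-++ u x v y)) (sym (xor-assoc (p ∧ q) (dot u x) (dot v y)))

dot-tabulate : ∀ {k} (g : Fin k → Bool) x → dot (tabulate g) x ≡ sumB (λ i → g i ∧ lookup x i)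
dot-tabulate g x = trans (dot-lookup (tabulate g) x) (sumB-cong (λ i → cong (_∧ lookup x i) (VecP.lookup∘tabulate g i)))

sumB-at : ∀ {k} (i : Fin k) (g : Fin k → Bool) → sumB (λ j → (i == j) ∧ g j) ≡ g i
sumB-at i g = trans (sumB-cong (λ j → ∧-if (i == j) (g j))) (BS.sum-== i g)

lookup-zeros : ∀ {k} (x : Vec Bool k) → (∀ i → lookup x i ≡ false) → x ≡ zeros
lookup-zeros [] h = refl
lookup-zeros (p ∷ x) h = cong₂ _∷_ (h zero) (lookup-zeros x (λ i → h (suc i)))

zeros-++ : ∀ k {l} → zeros {k} ++ᵛ zeros {l} ≡ zeros
zeros-++ zero = refl
zeros-++ (suc k) = cong (false ∷_) (zeros-++ k)

-- Cohomology

module Homology (T : FaceData) (S : IsProjectivePlaneTriangulation T) where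
  open FaceData T
  open IsProjectivePlaneTriangulation S
  open Dual T S
  open CubicGraph op op-op op-vertex using (parity; bad; _⊕_; _==ᵈ_; ==ᵈ-refl; ==ᵈ-sound; bool-ext)
  open CubicGraph op op-op op-vertex using (involution-sum; pairing; pairing-⊕; pairing-cong; pairing-dart; ∧-sumB)
  open CubicGraph op op-op op-vertex using (Bridgeless; Perfect; Solution)
  open CubicGraph op op-op op-vertex using (Reachable)

  -- A face set with a single boundary edge uv would have just one boundary edge at u, but it has
  -- an even number of them.
  bridgeless : Bridgeless
  bridgeless χ odd = conclude (unique-or-three (λ x → L (remQuot {m} 3 x)) (trans (BS.sum-flatten m L) L-odd))
    where
    L χₒ : D → Bool
    L d = not (χ (proj₁ d)) ∧ χ (proj₁ (op d))
    χₒ d = χ (proj₁ (op d))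
    both : D → Bool
    both d = χ (proj₁ d) ∧ χ (proj₁ (op d))
    both-op : ∀ d → both (op d) ≡ both d
    both-op d = trans (∧-comm (χ (proj₁ (op d))) _) (cong (λ e → χ (proj₁ e) ∧ χ (proj₁ (op d))) (op-op d))
    L-split : ∀ d → L d ≡ χₒ d xor both d
    L-split d = go (χ (proj₁ d)) (χ (proj₁ (op d)))
      where
      go : ∀ x y → not x ∧ y ≡ y xor (x ∧ y)
      go true true = refl
      go true false = refl
      go false y = sym (xor-identityʳ y)
    -- For an invariant weight the edges inside the face set count twice, so the cut weighs mod 2 as
    -- much as all darts of the set. Weight 1 shows that the cut is odd; weight `inc u` shows that
    -- it is even at `u`, since every face has an even number of edges at `u`.
    weighted : ∀ (g : D → Bool) → (∀ d → g (op d) ≡ g d) → pairing g L ≡ pairing g (λ d → χ (proj₁ d))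
    weighted g s = trans (pairing-cong g L-split) (trans (pairing-⊕ g χₒ both)
      (trans (cong (pairing g χₒ xor_) (involution-sum (λ d → g d ∧ both d) (λ d → cong₂ _∧_ (s d) (both-op d))))
        (trans (xor-identityʳ _) (trans (BS.Σ²-cong {m} {3} {λ d → g d ∧ χₒ d} {λ d → g (op d) ∧ χₒ d}
            (λ d → cong (_∧ χₒ d) (sym (s d))))
          (BS.Σ²-reindex op op-op (λ d → g d ∧ χ (proj₁ d)))))))
    L-odd : BS.Σ² L ≡ true
    L-odd = trans (weighted (λ _ → true) (λ _ → refl)) (trans (sumB-cong (λ f → thrice (χ f))) odd)
      where
      thrice : ∀ x → x xor (x xor (x xor false)) ≡ x
      thrice true = refl
      thrice false = refl
    at-vertex : ∀ u → pairing (inc u) L ≡ false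
    at-vertex u = trans (weighted (inc u) (inc-op u))
        (trans (sumB-cong (λ f → trans (sumB-cong {3} (λ i → ∧-comm (inc u (f , i)) (χ f)))
        (trans (∧-sumB {3} (χ f) (λ i → inc u (f , i)))
            (trans (cong (χ f ∧_) (corners-even (λ i → u == face f i))) (∧-zeroʳ (χ f)))))) (sumB-zero m))
    conclude : (∃ λ x → L (remQuot {m} 3 x) ≡ true × ∀ y → L (remQuot {m} 3 y) ≡ true → y ≡ x) ⊎ 3 ≤ sumℕ
        (λ x → ι (L (remQuot {m} 3 x))) →
      3 ≤ ℕS.Σ² (λ d → ι (L d))
    conclude (inj₂ le) = ℕP.≤-trans le (ℕP.≤-reflexive (ℕS.sum-flatten m (λ d → ι (L d))))
    conclude (inj₁ (x , e , only)) = contradiction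
        (trans (sym (at-vertex (a d))) (trans (pairing-cong (inc (a d)) L≡) (trans (pairing-dart (inc (a d)) d) inc-a))) λ ()
      where
      d : D
      d = remQuot {m} 3 x
      L≡ : ∀ c → L c ≡ (d ==ᵈ c)
      L≡ c = bool-ext (λ p → subst (λ c → (d ==ᵈ c) ≡ true)
          (trans (cong (remQuot {m} 3) (sym (only (combine (proj₁ c) (proj₂ c))
                 (trans (cong L (FP.remQuot-combine {m} (proj₁ c) (proj₂ c))) p))))
                     (FP.remQuot-combine {m} (proj₁ c) (proj₂ c))) (==ᵈ-refl d))
               (λ p → subst (λ c → L c ≡ true) (==ᵈ-sound d c p) e)
      inc-a : inc (a d) d ≡ true
      inc-a = cong₂ _xor_ (==-refl (a d)) (==-≢ (a≢b d))

  crossing : ∀ {f g} → Adjacent T f g → g ≡ f ⊎ (∃ λ i → proj₁ (op (f , i)) ≡ g)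
  crossing {f} {g} (u , v , E , E′) with dart-of f E | dart-of g E′
  ... | i , p | k , p′ with same-edge (f , i) (g , k) (ends-trans p p′)
  ...   | inj₁ e = inj₁ (cong proj₁ e)
  ...   | inj₂ e = inj₂ (i , sym (cong proj₁ e))

  reachable : Reachable
  reachable P spread f g p = go (connected f g) p
    where
    go : ∀ {f g} → Star (Adjacent T) f g → P f → P g
    go ε p = p
    go (x ◅ xs) p with crossing x
    ... | inj₁ refl = go xs p
    ... | inj₂ (i , refl) = go xs (spread _ p)

  pairing-comm : ∀ x y → pairing x y ≡ pairing y x
  pairing-comm x y = BS.Σ²-cong (λ d → ∧-comm (x d) (y d))

  darts : List D
  darts = cartesianProduct (allFin m) (allFin 3)

  module Coboundary (z : D → Bool) where
    -- `γ` selects the equations to be added. An obstruction is then a functional that vanishes on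
    -- the coboundaries `inc u` and is 1 on `z`.
    Dual : Equation n → Set
    Dual (v , r) = ∃ λ (γ : D → Bool) → (∀ u → lookup v u ≡ pairing γ (inc u)) × r ≡ pairing γ z

    row : D → Equation n
    row d = tabulate (λ u → inc u d) , z d

    Dual-add : ∀ {u r v s} → Dual (u , r) → Dual (v , s) → Dual (u ⊞ v , r xor s)
    Dual-add {u} {r} {v} {s} (γ , p , q) (γ′ , p′ , q′) = γ ⊕ γ′ ,
      (λ x → trans (VecP.lookup-zipWith _xor_ x u v) (trans (cong₂ _xor_ (p x) (p′ x)) (sym (both (inc x))))) ,
      trans (cong₂ _xor_ q q′) (sym (both z))
      where
      both : ∀ y → pairing (γ ⊕ γ′) y ≡ pairing γ y xor pairing γ′ y
      both y = trans (pairing-comm (γ ⊕ γ′) y) (trans (pairing-⊕ y γ γ′) (cong₂ _xor_ (pairing-comm y γ) (pairing-comm y γ′)))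

    Dual-row : ∀ d → Dual (row d)
    Dual-row d = (d ==ᵈ_) , (λ u → trans (VecP.lookup∘tabulate (λ u → inc u d) u) (sym (at (inc u)))) , sym (at z)
      where
      at : ∀ y → pairing (d ==ᵈ_) y ≡ y d
      at y = trans (pairing-comm (d ==ᵈ_) y) (pairing-dart y d)

    dot-inc : ∀ x d → dot (tabulate (λ u → inc u d)) x ≡ δ (lookup x) d
    dot-inc x d = trans (dot-tabulate (λ u → inc u d) x)
        (trans (sumB-cong (λ u → ∧-distribʳ-xor (lookup x u) (u == a d) (u == b d)))
      (trans (sumB-distrib (λ u → (u == a d) ∧ lookup x u) (λ u → (u == b d) ∧ lookup x u))
        (cong₂ _xor_ (flip (a d)) (flip (b d)))))
      where
      flip : ∀ y → sumB (λ u → (u == y) ∧ lookup x u) ≡ lookup x y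
      flip y = trans (sumB-cong (λ u → cong (_∧ lookup x u) (==-sym u y))) (sumB-at y (lookup x))

    coboundary? : (∃ λ (c : Fin n → Bool) → ∀ d → δ c d ≡ z d) ⊎
      (∃ λ γ → (∀ u → pairing γ (inc u) ≡ false) × pairing γ z ≡ true)
    coboundary? with fredholm Dual (λ {u} {r} {v} {s} → Dual-add {u} {r} {v} {s}) (map row darts)
        (AllP.map⁺ (All.tabulate (λ {d} _ → Dual-row d)))
    ... | inj₂ (γ , p , q) = inj₂ (γ , (λ u → trans (sym (p u)) (VecP.lookup-replicate u false)) , sym q)
    ... | inj₁ (x , sol) = inj₁ (lookup x , λ { d@(f , i) → trans (sym (dot-inc x d))
            (All.lookup (AllP.map⁻ sol) (∈-cartesianProduct⁺ (∈-allFin f) (∈-allFin i))) })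

  Edge : Fin n → Fin n → Set
  Edge u v = IsEdge T u v

  edge-dart : ∀ u v → Edge u v → D
  edge-dart u v (l , f , p , q) = f , proj₁ (dart-of f ((λ e → FP.<⇒≢ l e) , p , q))

  edge-dart-ends : ∀ u v (e : Edge u v) → Ends u v (edge-dart u v e)
  edge-dart-ends u v (l , f , p , q) = proj₂ (dart-of f ((λ e → FP.<⇒≢ l e) , p , q))

  edges : List D
  edges = gather (λ u → collect (isEdge? T u) (edge-dart u))

  #edges : length edges ≡ edgeCount T
  #edges = trans (length-gather (λ u → collect (isEdge? T u) (edge-dart u)))
      (sumFin-cong (λ u → length-collect (isEdge? T u) (edge-dart u)))

  edges-complete : ∀ d → ∃ λ e → e ∈ˡ edges × (e ≡ d ⊎ e ≡ op d)
  edges-complete d = go (FP.<-cmp (a d) (b d))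
    where
    find : ∀ u v → Ends u v d → u <ᶠ v → ∃ λ e → e ∈ˡ edges × (e ≡ d ⊎ e ≡ op d)
    find u v p l with ∈-collect (isEdge? T u) (edge-dart u) v
        (l , proj₁ d , proj₁ (proj₂ (ends⇒edgeOf d p)) , proj₂ (proj₂ (ends⇒edgeOf d p)))
    ... | e , x = edge-dart u v e , ∈-gather (λ u → collect (isEdge? T u) (edge-dart u)) u x ,
          same-edge d (edge-dart u v e) (ends-trans p (edge-dart-ends u v e))
    go : Tri (a d <ᶠ b d) (a d ≡ b d) (b d <ᶠ a d) → _
    go (tri< l _ _) = find (a d) (b d) (inj₁ (refl , refl)) l
    go (tri≈ _ e _) = contradiction e (a≢b d)
    go (tri> _ _ l) = find (b d) (a d) (inj₂ (refl , refl)) l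

  record Path (f g : Fin m) : Set where
    field
      crossed : D → Bool
      symm    : ∀ d → crossed (op d) ≡ crossed d
      ends    : ∀ h → parity crossed h ≡ (f == h) xor (g == h)

  path : ∀ f g → Path f g
  path f g = go (connected f g)
    where
    open CubicGraph op op-op op-vertex using (edge; edge-op)
    row-at : ∀ (x : Bool) (i : Fin 3) → sumB (λ j → x ∧ (i == j)) ≡ x
    row-at true zero = refl
    row-at true (suc zero) = refl
    row-at true (suc (suc zero)) = refl
    row-at false i = refl
    parity-edge : ∀ d h → parity (edge d) h ≡ (proj₁ d == h) xor (proj₁ (op d) == h)
    parity-edge d h = trans (sumB-distrib {3} (λ i → d ==ᵈ (h , i)) (λ i → op d ==ᵈ (h , i)))
      (cong₂ _xor_ (row-at (proj₁ d == h) (proj₂ d)) (row-at (proj₁ (op d) == h) (proj₂ (op d))))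
    go : ∀ {f g} → Star (Adjacent T) f g → Path f g
    go {f} ε = record { crossed = λ _ → false ; symm = λ _ → refl ; ends = λ h → sym (xor-same (f == h)) }
    go {f} {g} (x ◅ xs) with crossing x | go xs
    ... | inj₁ refl | p = p
    ... | inj₂ (i , refl) | p = record { crossed = edge d ⊕ Path.crossed p ; symm = λ e → cong₂ _xor_ (edge-op d e)
        (Path.symm p e)
          ; ends = λ h → trans (sumB-distrib {3} (λ i → edge d (h , i)) (λ i → Path.crossed p (h , i)))
              (trans (cong₂ _xor_ (parity-edge d h) (Path.ends p h)) (telescope (f == h) (proj₁ (op d) == h) (g == h))) }
      where
      d : D
      d = f , i
      telescope : ∀ x y z → (x xor y) xor (y xor z) ≡ x xor z
      telescope x y z = trans (xor-assoc x y (y xor z))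
          (cong (x xor_) (trans (sym (xor-assoc y y z)) (cong (_xor z) (xor-same y))))

  -- A vertex lies on some face, and the Euler formula rules out a complex with neither vertices nor
  -- faces.
  base-face : Fin m
  base-face = first n m refl refl
    where
    first : ∀ n′ m′ → n ≡ n′ → m ≡ m′ → Fin m
    first (suc n′) m′ refl e = proj₁ (vertex-on-face zero)
    first zero (suc m′) e refl = zero
    first zero zero e e′ = contradiction (trans (sym (cong₂ _+_ e e′)) euler) λ ()

  Annihilates : (D → Bool) → Set
  Annihilates γ = ∀ u → pairing γ (inc u) ≡ false

  -- The coboundaries `inc u` of single vertices span all coboundaries.
  annihilates-δ : ∀ γ → Annihilates γ → ∀ c → pairing γ (δ c) ≡ false
  annihilates-δ γ A c = trans (pairing-cong γ (λ d → sym (expand d))) (trans (sum-out (λ u d → c u ∧ inc u d))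
      (trans (sumB-cong (λ u → trans (scale (c u) (inc u)) (trans (cong (c u ∧_) (A u)) (∧-zeroʳ (c u))))) (sumB-zero n)))
    where
    expand : ∀ d → sumB (λ u → c u ∧ inc u d) ≡ δ c d
    expand d = trans (sumB-cong (λ u → trans (∧-comm (c u) (inc u d)) (∧-distribʳ-xor (c u) (u == a d) (u == b d))))
      (trans (sumB-distrib (λ u → (u == a d) ∧ c u) (λ u → (u == b d) ∧ c u)) (cong₂ _xor_ (flip (a d)) (flip (b d))))
      where
      flip : ∀ y → sumB (λ u → (u == y) ∧ c u) ≡ c y
      flip y = trans (sumB-cong (λ u → cong (_∧ c u) (==-sym u y))) (sumB-at y c)
    sum-out : ∀ {k} (g : Fin k → D → Bool) → pairing γ (λ d → sumB (λ u → g u d)) ≡ sumB (λ u → pairing γ (g u))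
    sum-out {zero} g = trans (BS.Σ²-cong {m} {3} {λ d → γ d ∧ false} {λ _ → false} (λ d → ∧-zeroʳ (γ d)))
        (trans (sumB-cong {m} (λ _ → refl)) (sumB-zero m))
    sum-out {suc k} g = trans (pairing-⊕ γ (g zero) (λ d → sumB (λ u → g (suc u) d)))
        (cong (pairing γ (g zero) xor_) (sum-out (λ u → g (suc u))))
    scale : ∀ x y → pairing γ (λ d → x ∧ y d) ≡ x ∧ pairing γ y
    scale true  y = refl
    scale false y = trans (BS.Σ²-cong {m} {3} {λ d → γ d ∧ false} {λ _ → false} (λ d → ∧-zeroʳ (γ d)))
        (trans (sumB-cong {m} (λ _ → refl)) (sumB-zero m))

  -- The first cohomology group has dimension at most e - (n - 1) - (m - 1) = 1: the colourings c
  -- with c v₀ = 0, the two cocycles and the paths to the faces other than the base face are too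
  -- many for e dimensions.
  one-class : ∀ (z z′ γ γ′ : D → Bool) →
    (∀ d → z (op d) ≡ z d) → (∀ d → z′ (op d) ≡ z′ d) → (∀ f → parity z f ≡ false) → (∀ f → parity z′ f ≡ false) →
    Annihilates γ → Annihilates γ′ → pairing γ z ≡ true → pairing γ z′ ≡ false → pairing γ′ z′ ≡ true → ⊥
  one-class z z′ γ γ′ zs zs′ ze ze′ A A′ γz γz′ γ′z′ = refute (kernel rows small)
    where
    v₀ : Fin n
    v₀ = face base-face zero
    p : Fin m → D → Bool
    p i = Path.crossed (path base-face i)
    N : ℕ
    N = n + (m + 2)
    row : D → Vec Bool N
    row d = tabulate (λ u → inc u d) ++ᵛ (tabulate (λ i → p i d) ++ᵛ (z d ∷ z′ d ∷ []))
    -- Two normalisations: they remove the constant colourings and the trivial path from the base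
    -- face to itself.
    row-v row-f : Vec Bool N
    row-v = tabulate (λ u → v₀ == u) ++ᵛ zeros
    row-f = zeros {n} ++ᵛ (tabulate (λ i → base-face == i) ++ᵛ zeros)
    rows : List (Vec Bool N)
    rows = row-v ∷ row-f ∷ map row edges
    -- There are E + 2 rows and V + F + 2 = E + 3 unknowns, so the system has a nonzero solution;
    -- the rest shows that it would have to be zero.
    small : suc (length rows) ≤ N
    small = ℕP.≤-reflexive (trans (cong (λ k → suc (suc (suc k))) (trans (length-map row edges) #edges))
      (trans (sym (trans (ℕP.+-comm (1 + edgeCount T) 2) refl)) (trans (cong (_+ 2) (sym euler)) (ℕP.+-assoc n m 2))))
    module Solved (c : Vec Bool n) (t : Vec Bool m) (s s′ : Bool)
        (at-v₀ : lookup c v₀ ≡ false) (at-f₀ : lookup t base-face ≡ false)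
        (on-edges : ∀ d → δ (lookup c) d xor (sumB (λ i → p i d ∧ lookup t i) xor ((z d ∧ s) xor (z′ d ∧ s′))) ≡ false) where
      paths : D → Bool
      paths d = sumB (λ i → p i d ∧ lookup t i)
      -- Degrees at the faces isolate the paths, because coboundaries and cocycles have even degree
      -- everywhere. At a face other than the base face only the path ending there contributes.
      parity-paths : ∀ f → parity paths f ≡ sumB (λ i → ((base-face == f) xor (i == f)) ∧ lookup t i)
      parity-paths f = trans (sumB-comm {3} {m} (λ i k → p k (f , i) ∧ lookup t k)) (sumB-cong (λ k →
        trans (sumB-cong {3} (λ i → ∧-comm (p k (f , i)) (lookup t k))) (trans (∧-sumB {3} (lookup t k) (λ i → p k (f , i)))
          (trans (∧-comm (lookup t k) (parity (p k) f)) (cong (_∧ lookup t k) (Path.ends (path base-face k) f))))))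
      parity-scaled : ∀ (y : D → Bool) x f → parity y f ≡ false → parity (λ d → y d ∧ x) f ≡ false
      parity-scaled y x f e = trans (sumB-cong {3} (λ i → ∧-comm (y (f , i)) x))
          (trans (∧-sumB {3} x (λ i → y (f , i))) (trans (cong (x ∧_) e) (∧-zeroʳ x)))
      parity-Φ : ∀ f → parity paths f ≡ false
      parity-Φ f = trans (sym (trans (sumB-distrib {3} (λ i → δ (lookup c) (f , i))
          (λ i → paths (f , i) xor ((z (f , i) ∧ s) xor (z′ (f , i) ∧ s′))))
        (trans (cong₂ _xor_ (corners-even (λ i → lookup c (face f i)))
            (trans (sumB-distrib {3} (λ i → paths (f , i)) (λ i → (z (f , i) ∧ s) xor (z′ (f , i) ∧ s′)))
          (cong (parity paths f xor_) (trans (sumB-distrib {3} (λ i → z (f , i) ∧ s) (λ i → z′ (f , i) ∧ s′))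
              (cong₂ _xor_ (parity-scaled z s f (ze f)) (parity-scaled z′ s′ f (ze′ f))))))) (xor-identityʳ _))))
        (trans (sumB-cong {3} (λ i → on-edges (f , i))) refl)
      t-zero : ∀ f → lookup t f ≡ false
      t-zero f with base-face ≟ f
      ... | yes refl = at-f₀
      ... | no n = trans (sym (trans (sumB-cong
          (λ i → cong (_∧ lookup t i) (trans (cong (_xor (i == f)) (==-≢ n)) (==-sym i f)))) (sumB-at f (lookup t))))
          (trans (sym (parity-paths f)) (parity-Φ f))
      paths-zero : ∀ d → paths d ≡ false
      paths-zero d = trans (sumB-cong (λ i → trans (cong (p i d ∧_) (t-zero i)) (∧-zeroʳ (p i d)))) (sumB-zero m)
      scaled : ∀ θ y x → pairing θ (λ d → y d ∧ x) ≡ pairing θ y ∧ x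
      scaled θ y true  = trans (pairing-cong θ (λ d → ∧-comm (y d) true)) (sym (∧-comm (pairing θ y) true))
      scaled θ y false = trans (BS.Σ²-cong {m} {3} {λ d → θ d ∧ (y d ∧ false)} {λ _ → false}
          (λ d → trans (cong (θ d ∧_) (∧-zeroʳ (y d))) (∧-zeroʳ (θ d))))
        (trans (sumB-zero m) (sym (∧-zeroʳ (pairing θ y))))
      -- With the paths gone, a functional that kills coboundaries leaves an equation in `s` and
      -- `s′`. The values of `γ` and `γ′` on `z` and `z′` are triangular, so `γ` gives `s = 0` and
      -- `γ′` then gives `s′ = 0`.
      pair : ∀ θ → Annihilates θ → (pairing θ z ∧ s) xor (pairing θ z′ ∧ s′) ≡ false
      pair θ A″ = trans (sym (cong₂ _xor_ (scaled θ z s) (scaled θ z′ s′)))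
          (trans (sym (pairing-⊕ θ (λ d → z d ∧ s) (λ d → z′ d ∧ s′)))
        (trans (pairing-cong θ (λ d → sym (xor-equal (δ (lookup c) d) ((z d ∧ s) xor (z′ d ∧ s′))
          (trans (cong (λ k → δ (lookup c) d xor (k xor ((z d ∧ s) xor (z′ d ∧ s′)))) (sym (paths-zero d)))
              (on-edges d))))) (annihilates-δ θ A″ (lookup c))))
    refute : (∃ λ x → x ≢ zeros × All (λ r → dot r x ≡ false) rows) → ⊥
    refute (x , nonzero , at-v ∷ at-f ∷ sol) with Vec.splitAt n x
    ... | c , rest , refl with Vec.splitAt m rest
    ...   | t , s ∷ s′ ∷ [] , refl = nonzero
        (trans (cong₂ (λ k l → k ++ᵛ (l ++ᵛ (s ∷ s′ ∷ []))) c-zero (lookup-zeros t C.t-zero))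
              (trans (cong₂ (λ k l → zeros {n} ++ᵛ (zeros {m} ++ᵛ (k ∷ l ∷ []))) s-zero s′-zero)
                  (trans (cong (zeros {n} ++ᵛ_) (zeros-++ m)) (zeros-++ n))))
      where
      dot-zerosˡ : ∀ {k} (y : Vec Bool k) → dot zeros y ≡ false
      dot-zerosˡ [] = refl
      dot-zerosˡ (_ ∷ y) = dot-zerosˡ y
      unit : ∀ {k} (i : Fin k) (y : Vec Bool k) → dot (tabulate (i ==_)) y ≡ lookup y i
      unit i y = trans (dot-tabulate (i ==_) y) (sumB-at i (lookup y))
      at-v₀ : lookup c v₀ ≡ false
      at-v₀ = trans (sym (trans (dot-++ (tabulate (v₀ ==_)) c zeros (t ++ᵛ (s ∷ s′ ∷ [])))
          (trans (cong₂ _xor_ (unit v₀ c) (dot-zerosˡ (t ++ᵛ (s ∷ s′ ∷ [])))) (xor-identityʳ _)))) at-v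
      at-f₀ : lookup t base-face ≡ false
      at-f₀ = trans (sym (trans (dot-++ (zeros {n}) c (tabulate (base-face ==_) ++ᵛ zeros) (t ++ᵛ (s ∷ s′ ∷ [])))
          (trans (cong₂ _xor_ (dot-zerosˡ c)
        (trans (dot-++ (tabulate (base-face ==_)) t zeros (s ∷ s′ ∷ [])) (cong₂ _xor_ (unit base-face t) refl)))
            (xor-identityʳ _)))) at-f
      dot-row : ∀ d → dot (row d) (c ++ᵛ (t ++ᵛ (s ∷ s′ ∷ []))) ≡ δ (lookup c) d xor
          (sumB (λ i → p i d ∧ lookup t i) xor ((z d ∧ s) xor (z′ d ∧ s′)))
      dot-row d = trans (dot-++ (tabulate (λ u → inc u d)) c _ _) (cong₂ _xor_ (Coboundary.dot-inc z c d)
        (trans (dot-++ (tabulate (λ i → p i d)) t _ _)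
            (cong₂ _xor_ (dot-tabulate (λ i → p i d) t) (cong ((z d ∧ s) xor_) (xor-identityʳ (z′ d ∧ s′))))))
      Ψ : D → Bool
      Ψ d = δ (lookup c) d xor (sumB (λ i → p i d ∧ lookup t i) xor ((z d ∧ s) xor (z′ d ∧ s′)))
      Ψ-op : ∀ d → Ψ (op d) ≡ Ψ d
      Ψ-op d = cong₂ _xor_ (δ-op (lookup c) d)
          (cong₂ _xor_ (sumB-cong (λ i → cong (_∧ lookup t i) (Path.symm (path base-face i) d)))
        (cong₂ _xor_ (cong (_∧ s) (zs d)) (cong (_∧ s′) (zs′ d))))
      on-edges : ∀ d → Ψ d ≡ false
      on-edges d with edges-complete d
      ... | e , x , inj₁ refl = trans (sym (dot-row e)) (All.lookup (AllP.map⁻ sol) x)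
      ... | e , x , inj₂ refl = trans (sym (Ψ-op d)) (trans (sym (dot-row e)) (All.lookup (AllP.map⁻ sol) x))
      module C = Solved c t s s′ at-v₀ at-f₀ on-edges
      s-zero : s ≡ false
      s-zero = trans (sym (trans (cong₂ (λ k l → (k ∧ s) xor (l ∧ s′)) γz γz′) (xor-identityʳ s))) (C.pair γ A)
      s′-zero : s′ ≡ false
      s′-zero = trans (sym (trans (cong₂ (λ k l → (pairing γ′ z ∧ k) xor (l ∧ s′)) s-zero γ′z′)
          (cong (_xor s′) (∧-zeroʳ (pairing γ′ z))))) (C.pair γ′ A′)
      δ-zero : ∀ d → lookup c (a d) ≡ lookup c (b d)
      δ-zero d = xor-equal _ _ (trans (sym (trans (cong (δ (lookup c) d xor_) (trans (cong₂ _xor_ (C.paths-zero d)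
        (cong₂ (λ k l → (z d ∧ k) xor (z′ d ∧ l)) s-zero s′-zero)) (cong₂ _xor_ (∧-zeroʳ (z d)) (∧-zeroʳ (z′ d)))))
            (xor-identityʳ _))) (on-edges d))
      on-face : ∀ f i → lookup c (face f i) ≡ lookup c (face f zero)
      on-face f zero = refl
      on-face f (suc zero) = sym (δ-zero (f , suc (suc zero)))
      on-face f (suc (suc zero)) = δ-zero (f , suc zero)
      -- What is left is a colouring with zero coboundary. It is constant on each face, hence
      -- constant by connectedness, and it vanishes at `v₀`.
      Blank : Fin m → Set
      Blank f = ∀ i → lookup c (face f i) ≡ false
      blank-from : ∀ f i → lookup c (face f i) ≡ false → Blank f
      blank-from f i e k = trans (on-face f k) (trans (sym (on-face f i)) e)
      spread : ∀ d → Blank (proj₁ d) → Blank (proj₁ (op d))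
      spread d h with op-ends d
      ... | inj₁ (e , _) = blank-from (proj₁ (op d)) (next (proj₂ (op d)))
          (trans (cong (lookup c) (sym e)) (h (next (proj₂ d))))
      ... | inj₂ (e , _) = blank-from (proj₁ (op d)) (next (next (proj₂ (op d))))
          (trans (cong (lookup c) (sym e)) (h (next (proj₂ d))))
      c-zero : c ≡ zeros
      c-zero = lookup-zeros c (λ u → let (f , i , e) = vertex-on-face u in
        subst (λ v → lookup c v ≡ false) e (reachable Blank spread base-face f (blank-from base-face zero at-v₀) i))

-- From cocycles to colourings.

toColour : Bool → Colour
toColour true  = Colour.B
toColour false = Colour.W

toColour-injective : ∀ p q → toColour p ≡ toColour q → p ≡ q
toColour-injective true  true  e = refl
toColour-injective false false e = refl

module Colouring (T : FaceData) (S : IsProjectivePlaneTriangulation T) where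
  open FaceData T
  open Dual T S
  open Homology T S
  open CubicGraph op op-op op-vertex using (parity; bad)
  open CubicGraph op op-op op-vertex using (pairing)
  open CubicGraph op op-op op-vertex using (Perfect; Solution; module Petersen)
  open CubicGraph op op-op op-vertex using (perfect-solution)
  open CubicGraph op op-op op-vertex using (near-perfect)

  Result : Set
  Result = Σ (Fin n → Colour) λ c → Weak T c ⊎ NearWeak T c

  complement : (D → Bool) → D → Bool
  complement y d = true xor y d

  -- The edges in `y` are those with ends of equal colour, so the monochromatic faces are exactly
  -- those with all three edges in `y`.
  colour : ∀ (y : D → Bool) (c : Fin n → Bool) → (∀ d → δ c d ≡ complement y d) →
    (∀ f g → bad y f ≡ true → bad y g ≡ true → f ≡ g) → Result
  colour y c e few = (λ u → toColour (c u)) , decide (search (λ f → bad y f))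
    where
    mono⇒bad : ∀ f → Monochromatic T (λ u → toColour (c u)) f → bad y f ≡ true
    mono⇒bad f h = cong₂ _∧_ (on zero) (cong₂ _∧_ (on (suc zero)) (on (suc (suc zero))))
      where
      on : ∀ i → y (f , i) ≡ true
      on i = go (y (f , i)) (trans (sym (e (f , i)))
          (trans (cong (_xor c (b (f , i))) (toColour-injective _ _ (h (next i) (next (next i))))) (xor-same (c (b (f , i))))))
        where
        go : ∀ x → true xor x ≡ false → x ≡ true
        go true e = refl
    bad⇒mono : ∀ f → bad y f ≡ true → Monochromatic T (λ u → toColour (c u)) f
    bad⇒mono f h i j = cong toColour (trans (to-zero i) (sym (to-zero j)))
      where
      all-true : ∀ x y z → x ∧ (y ∧ z) ≡ true → x ≡ true × y ≡ true × z ≡ true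
      all-true true true true e = refl , refl , refl
      ys : y (f , zero) ≡ true × y (f , suc zero) ≡ true × y (f , suc (suc zero)) ≡ true
      ys = all-true _ _ _ h
      same : ∀ i → y (f , i) ≡ true → c (face f (next i)) ≡ c (face f (next (next i)))
      same i p = xor-equal _ _ (trans (e (f , i)) (cong (true xor_) p))
      to-zero : ∀ i → c (face f i) ≡ c (face f zero)
      to-zero zero = refl
      to-zero (suc zero) = sym (same (suc (suc zero)) (proj₂ (proj₂ ys)))
      to-zero (suc (suc zero)) = same (suc zero) (proj₁ (proj₂ ys))
    search : ∀ {k} (g : Fin k → Bool) → (∀ i → g i ≡ false) ⊎ ∃ λ i → g i ≡ true
    search {zero} g = inj₁ λ ()
    search {suc k} g with g zero in e | search (λ i → g (suc i))
    ... | true | _ = inj₂ (zero , e)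
    ... | false | inj₂ (i , p) = inj₂ (suc i , p)
    ... | false | inj₁ h = inj₁ λ { zero → e ; (suc i) → h i }
    decide : (∀ f → bad y f ≡ false) ⊎ (∃ λ f → bad y f ≡ true) → Weak T (λ u → toColour (c u)) ⊎ NearWeak T
        (λ u → toColour (c u))
    decide (inj₁ none) = inj₁ λ f h → contradiction (trans (sym (mono⇒bad f h)) (none f)) λ ()
    decide (inj₂ (f , p)) = inj₂ (f , bad⇒mono f p , λ g h → few g f (mono⇒bad g h) p)

  complement-even : ∀ (y : D → Bool) → (∀ f → parity y f ≡ true) → ∀ f → parity (complement y) f ≡ false
  complement-even y o f = trans (sumB-distrib {3} (λ _ → true) (λ i → y (f , i))) (cong (true xor_) (o f))

  result : Result
  result = from-matching (Petersen.petersen bridgeless)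
    where
    from-matching : (∃ λ y → Perfect y) → Result
    from-matching (y , P) = go (Coboundary.coboundary? (complement y))
      where
      go : (∃ λ (c : Fin n → Bool) → ∀ d → δ c d ≡ complement y d) ⊎
          (∃ λ γ → (∀ u → pairing γ (inc u) ≡ false) × pairing γ (complement y) ≡ true) → Result
      go (inj₁ (c , e)) = colour y c e (λ f g p _ → contradiction (trans (sym p) (Perfect.good P f)) λ ())
      go (inj₂ (γ , A , γz)) = go′ (near-perfect bridgeless reachable γ P base-face)
        where
        go′ : Solution γ → Result
        go′ s = go″ (Coboundary.coboundary? (complement (Solution.y s)))
          where
          go″ : (∃ λ (c : Fin n → Bool) → ∀ d → δ c d ≡ complement (Solution.y s) d) ⊎
            (∃ λ γ → (∀ u → pairing γ (inc u) ≡ false) × pairing γ (complement (Solution.y s)) ≡ true) → Result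
          go″ (inj₁ (c , e)) = colour (Solution.y s) c e (Solution.few s)
          -- If the second complement were no coboundary either, the two complements would be
          -- independent classes: `γ` is 1 on the first and 0 on the second, and `γ′` is 1 on the
          -- second.
          go″ (inj₂ (γ′ , A′ , γz′)) = ⊥-elim (one-class (complement y) (complement (Solution.y s)) γ γ′
            (λ d → cong (true xor_) (Perfect.symm P d)) (λ d → cong (true xor_) (Solution.symm s d))
            (complement-even y (Perfect.odd P)) (complement-even (Solution.y s) (Solution.odd s))
            A A′ γz (Solution.zero-class s) γz′)

theorem2p2 : (T : FaceData) → IsProjectivePlaneTriangulation T →
    Σ (Fin (FaceData.n T) → Colour) λ c → Weak T c ⊎ NearWeak T c
theorem2p2 T S = Colouring.result T S
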